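{- There is a polynomial-time algorithm which, given a finite graph $G$ that contains none of $P_9$, $C_3$, $C_5$ as an induced subgraph, decides whether $G$ is $3$-colourable, and outputs a $3$-colouring of $G$ if one exists.
   Context: Graphs are finite and simple. $P_9$ denotes the path on $9$ vertices and $C_\ell$ the cycle of length $\ell$. A $3$-colouring is an assignment of colours from $\{1,2,3\}$ to all the vertices such that adjacent vertices receive distinct colours. Polynomial time means polynomial in the size of $G$. -}

module Defs where

open import Data.Bool using (Bool; true; false; T; _∨_)
open import Data.Fin using (Fin; toℕ)
open import Data.List using (List; []; _∷_; tabulate)
open import Data.Maybe using (Maybe; just; nothing)
open import Data.Nat using (ℕ; zero; suc; _+_; _∸_; _≡ᵇ_; _≤ᵇ_; ∣_-_∣)
open import Data.Nat.Properties using (∣n-n∣≡0; ∣-∣-comm)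
open import Data.Product using (Σ-syntax; ∃-syntax; _×_; _,_)
open import Function.Definitions using (Injective)
open import Relation.Binary.PropositionalEquality
  using (_≡_; _≢_; refl; cong; cong₂)
open import Relation.Nullary using (¬_)

record Graph (n : ℕ) : Set where
  field
    adj         : Fin n → Fin n → Bool
    symmetric   : ∀ u v → adj u v ≡ adj v u
    irreflexive : ∀ v → adj v v ≡ false

open Graph public

path : (k : ℕ) → Graph k
path k .adj i j = ∣ toℕ i - toℕ j ∣ ≡ᵇ 1
path k .symmetric i j = cong (_≡ᵇ 1) (∣-∣-comm (toℕ i) (toℕ j))
path k .irreflexive i = cong (_≡ᵇ 1) (∣n-n∣≡0 (toℕ i))

-- On the vertices 0 , … , ℓ-1, being cyclically consecutive means being at
-- distance 1 or ℓ-1 as natural numbers.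
cycle : (ℓ : ℕ) → {T (3 ≤ᵇ ℓ)} → Graph ℓ
cycle ℓ .adj i j = (∣ toℕ i - toℕ j ∣ ≡ᵇ 1) ∨ (∣ toℕ i - toℕ j ∣ ≡ᵇ ℓ ∸ 1)
cycle ℓ .symmetric i j =
  cong (λ d → (d ≡ᵇ 1) ∨ (d ≡ᵇ ℓ ∸ 1)) (∣-∣-comm (toℕ i) (toℕ j))
cycle (suc (suc (suc k))) .irreflexive i =
  cong (λ d → (d ≡ᵇ 1) ∨ (d ≡ᵇ suc (suc k))) (∣n-n∣≡0 (toℕ i))

ContainsInduced : ∀ {n m} → Graph n → Graph m → Set
ContainsInduced {n} {m} G H =
  Σ[ f ∈ (Fin m → Fin n) ]
    Injective _≡_ _≡_ f × (∀ i j → adj G (f i) (f j) ≡ adj H i j)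

IsColouring : ∀ {n} → Graph n → (Fin n → Fin 3) → Set
IsColouring G c = ∀ u v → adj G u v ≡ true → c u ≢ c v

ThreeColourable : ∀ {n} → Graph n → Set
ThreeColourable G = ∃[ c ] IsColouring G c

-- The model of computation is the WHILE language over binary trees
-- (N. D. Jones, "Computability and Complexity from a Programming Perspective"),
-- in a variable-free presentation: a program maps one tree to one tree, and a
-- store holding several variables is a tuple of trees built with `pair`.

infixr 5 _∙_

data Tree : Set where
  nil : Tree
  _∙_ : Tree → Tree → Tree

infixr 4 _⨾_
infix  3 if_then_else_ while_repeat_

data Program : Set where
  skip null head tail : Program
  pair                : Program → Program → Program
  _⨾_                 : Program → Program → Program
  if_then_else_       : Program → Program → Program → Program
  while_repeat_           : Program → Program → Program

-- `p ⟨ x ⟩⇓ y [ t ]`: on input x, the program p halts with output y after t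
-- steps.  A test succeeds when its output is not nil; that output is then
-- discarded, and the chosen branch or the loop body runs on x itself.
--
-- Every construct costs one step plus the cost of the subprograms it runs.
-- This unit cost is realistic because trees are immutable and shared: each step
-- copies or follows a pointer or allocates one cell, and trees are never
-- compared for equality.  Hence running times agree with those of Turing
-- machines up to a polynomial, as long as the output, written out in full, has
-- polynomial size.

infix 2 _⟨_⟩⇓_[_]

data _⟨_⟩⇓_[_] : Program → Tree → Tree → ℕ → Set where
  skip     : ∀ {x} → skip ⟨ x ⟩⇓ x [ 1 ]
  null     : ∀ {x} → null ⟨ x ⟩⇓ nil [ 1 ]
  head-nil : head ⟨ nil ⟩⇓ nil [ 1 ]
  head-∙   : ∀ {x y} → head ⟨ x ∙ y ⟩⇓ x [ 1 ]
  tail-nil : tail ⟨ nil ⟩⇓ nil [ 1 ]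
  tail-∙   : ∀ {x y} → tail ⟨ x ∙ y ⟩⇓ y [ 1 ]
  pair     : ∀ {p q x y z s t} →
             p ⟨ x ⟩⇓ y [ s ] → q ⟨ x ⟩⇓ z [ t ] →
             pair p q ⟨ x ⟩⇓ y ∙ z [ suc (s + t) ]
  seq      : ∀ {p q x y z s t} →
             p ⟨ x ⟩⇓ y [ s ] → q ⟨ y ⟩⇓ z [ t ] →
             (p ⨾ q) ⟨ x ⟩⇓ z [ suc (s + t) ]
  if-true  : ∀ {b p q x u v y s t} →
             b ⟨ x ⟩⇓ u ∙ v [ s ] → p ⟨ x ⟩⇓ y [ t ] →
             (if b then p else q) ⟨ x ⟩⇓ y [ suc (s + t) ]
  if-false : ∀ {b p q x y s t} →
             b ⟨ x ⟩⇓ nil [ s ] → q ⟨ x ⟩⇓ y [ t ] →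
             (if b then p else q) ⟨ x ⟩⇓ y [ suc (s + t) ]
  stop     : ∀ {b p x s} →
             b ⟨ x ⟩⇓ nil [ s ] →
             (while b repeat p) ⟨ x ⟩⇓ x [ suc s ]
  loop     : ∀ {b p x u v y z r s t} →
             b ⟨ x ⟩⇓ u ∙ v [ r ] → p ⟨ x ⟩⇓ y [ s ] →
             (while b repeat p) ⟨ y ⟩⇓ z [ t ] →
             (while b repeat p) ⟨ x ⟩⇓ z [ suc (r + s + t) ]

deterministic : ∀ {p x y z s t} →
  p ⟨ x ⟩⇓ y [ s ] → p ⟨ x ⟩⇓ z [ t ] → y ≡ z × s ≡ t
deterministic skip     skip     = refl , refl
deterministic null     null     = refl , refl
deterministic head-nil head-nil = refl , refl
deterministic head-∙   head-∙   = refl , refl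
deterministic tail-nil tail-nil = refl , refl
deterministic tail-∙   tail-∙   = refl , refl
deterministic (pair d e) (pair d′ e′)
  with refl , refl ← deterministic d d′
     | refl , refl ← deterministic e e′ = refl , refl
deterministic (seq d e) (seq d′ e′)
  with refl , refl ← deterministic d d′
  with refl , refl ← deterministic e e′ = refl , refl
deterministic (if-true d e) (if-true d′ e′)
  with refl , refl ← deterministic d d′
     | refl , refl ← deterministic e e′ = refl , refl
deterministic (if-true d _) (if-false d′ _) with () , _ ← deterministic d d′
deterministic (if-false d _) (if-true d′ _) with () , _ ← deterministic d d′
deterministic (if-false d e) (if-false d′ e′)
  with refl , refl ← deterministic d d′
     | refl , refl ← deterministic e e′ = refl , refl
deterministic (stop d) (stop d′)
  with refl , refl ← deterministic d d′ = refl , refl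
deterministic (stop d) (loop d′ _ _) with () , _ ← deterministic d d′
deterministic (loop d _ _) (stop d′) with () , _ ← deterministic d d′
deterministic (loop d e f) (loop d′ e′ f′)
  with refl , refl ← deterministic d d′
     | refl , refl ← deterministic e e′
  with refl , refl ← deterministic f f′ = refl , refl

encodeBool : Bool → Tree
encodeBool false = nil
encodeBool true  = nil ∙ nil

encodeℕ : ℕ → Tree
encodeℕ zero    = nil
encodeℕ (suc n) = nil ∙ encodeℕ n

encodeList : List Tree → Tree
encodeList []       = nil
encodeList (t ∷ ts) = t ∙ encodeList ts

-- The list of rows of the adjacency matrix.
encodeGraph : ∀ {n} → Graph n → Tree
encodeGraph G =
  encodeList (tabulate λ u → encodeList (tabulate λ v → encodeBool (adj G u v)))

-- An answer is either "not 3-colourable" (`nothing`) or a 3-colouring, which is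
-- written as the list of the colours of the vertices in order.
Answer : ℕ → Set
Answer n = Maybe (Fin n → Fin 3)

encodeAnswer : ∀ {n} → Answer n → Tree
encodeAnswer nothing  = nil
encodeAnswer (just c) = nil ∙ encodeList (tabulate λ v → encodeℕ (toℕ (c v)))

Correct : ∀ {n} → Graph n → Answer n → Set
Correct G nothing  = ¬ ThreeColourable G
Correct G (just c) = IsColouring G c

{-# OPTIONS --safe #-}

-- A connected, non-bipartite graph G without induced P₉, C₃, C₅ has an induced
-- C₇ or C₉: a longer odd closed walk contains nine consecutive vertices with a
-- chord, which shortens it.  Guess this cycle C and its colours.  Every vertex
-- adjacent to C then has at most two available colours; if C is a C₉ and there is
-- no C₇, this covers G.  Otherwise consider the vertices far from (not adjacent
-- to) a C₇.
-- An edge xy between two far vertices folds onto an edge of C, in a way that can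
-- be read off the neighbours of x and y, so x and y are coloured like that edge.
-- A far vertex w without far neighbours is harmless unless it has neighbours v, u
-- adjacent to vertices c, d of C of different colours.  For each such pair c, d,
-- choose w₂ with the colour of c and with N(w₂) ∩ N(c) minimal, then w₃ in the
-- same way among the vertices which the colours guessed so far do not restrict.
-- If the colours of w₂, w₃ and some of their neighbours are guessed as well, an
-- unrestricted w can have the colour of c only if w v c v₃ w₃ u₃ d u₂ w₂ is an
-- induced P₉ for some v.  Thus the colours of constantly many vertices leave at
-- most two candidates at every vertex, and 2-satisfiability finishes.
-- The algorithm tries all guesses and keeps whatever colours a whole component.
-- It is written in a language of loops over the vertices in which every value has
-- polynomial size, so that every term runs in polynomial time.
module Submission where

open import Defs
open import Data.Bool using (Bool; true; false; T) renaming (if_then_else_ to ifᵇ_then_else_)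
open import Data.Bool.Properties using (¬-not) renaming (_≟_ to _≟ᵇ_)
open import Data.Empty using (⊥; ⊥-elim)
open import Data.Fin using (Fin; zero; suc; toℕ)
open import Data.Fin.Patterns
open import Data.Fin.Properties using (all?; toℕ<n; toℕ-injective) renaming (_≟_ to _≟ᶠ_)
open import Data.List using (List; []; _∷_; length; lookup; map; tabulate)
open import Data.List.Membership.Propositional.Properties using (∈-lookup)
open import Data.List.Relation.Unary.All using (All; []; _∷_)
import Data.List.Relation.Unary.All as All
open import Data.List.Relation.Unary.All.Properties using (++⁺)
open import Data.Maybe
  using (Maybe; just; nothing; is-just; zipWith; _<∣>_; to-witness-T)
import Data.Maybe as Maybe
open import Data.Nat
  using (ℕ; zero; suc; _+_; _*_; _^_; _≤_; _<_; _≡ᵇ_; _<ᵇ_; _≟_; z≤n; s≤s)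
open import Data.Nat.Induction using (<-rec)
open import Data.Nat.Properties
open import Data.Nat.Solver using (module +-*-Solver)
open import Data.Product using (Σ-syntax; ∃-syntax; _×_; _,_; proj₁; proj₂)
open import Data.Sum using (_⊎_; inj₁; inj₂) renaming ([_,_]′ to either)
open import Data.Unit using (⊤; tt)
import Data.Vec.Functional as Vector
open import Function using (_∘_)
open import Function.Definitions using (Injective)
open import Relation.Binary.PropositionalEquality
  using (_≡_; _≢_; refl; sym; trans; cong; subst; subst₂)
open import Relation.Nullary using (¬_; Dec; yes; no)
open import Relation.Nullary.Decidable using (toWitness; _→-dec_)

-- A language of polynomial-time functions

-- The graph enters the proof through two kinds of facts only: there is no induced P₉, and there are
-- no closed walks of length 3 or 5, nor of length 7 in a component without a C₇. Cycles are
-- therefore kept as closed walks, and most of the non-adjacencies that an induced P₉ requires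
-- follow because an edge would close a short odd walk. Soundness and completeness are separate. An
-- attempt colours a component only if 2-satisfiability settles all of it, so no guess can do harm,
-- and the algorithm never tests whether a guess is a cycle or is coloured consistently. For
-- completeness one good guess per component suffices. The colouring that shows this guess to
-- succeed is not the given 3-colouring γ: it agrees with γ near the cycle, but may recolour far
-- vertices. A single search serves both cycle lengths. It has nine places for the cycle, some of
-- which repeat a vertex of a C₇, and six further vertices for each ordered pair of places. The
-- degree of the polynomial is large, but constant.

data Sort : Set where
  vertex : Sort
  const  : ℕ → Sort

size : Sort → ℕ → ℕ
size vertex    n = n
size (const k) n = k

infixr 6 _⊗_

data Ty : Set where
  bool : Ty
  ix   : Sort → Ty
  _⊗_  : Ty → Ty → Ty
  arr  : Sort → Ty → Ty

Val : Ty → ℕ → Set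
Val bool      n = Bool
Val (ix s)    n = Fin (size s n)
Val (A ⊗ B)   n = Val A n × Val B n
Val (arr s A) n = Fin (size s n) → Val A n

-- The last index is processed first, as by a loop that counts down.
fold : ∀ {S : Set} n → (Fin n → S → S) → S → S
fold zero    f s = s
fold (suc n) f s = f zero (fold n (f ∘ suc) s)

infixr 9 _⊙_

data Mor : Ty → Ty → Set where
  idₘ     : ∀ {A} → Mor A A
  _⊙_     : ∀ {A B C} → Mor B C → Mor A B → Mor A C
  ⟨_,_⟩ₘ  : ∀ {A B C} → Mor A B → Mor A C → Mor A (B ⊗ C)
  fstₘ    : ∀ {A B} → Mor (A ⊗ B) A
  sndₘ    : ∀ {A B} → Mor (A ⊗ B) B
  litₘ    : ∀ {A} → Bool → Mor A bool
  numₘ    : ∀ {A k} → Fin k → Mor A (ix (const k))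
  condₘ   : ∀ {A B} → Mor A bool → Mor A B → Mor A B → Mor A B
  eqₘ     : ∀ {s} → Mor (ix s ⊗ ix s) bool
  tabₘ    : ∀ {A B s} → Mor (A ⊗ ix s) B → Mor A (arr s B)
  atₘ     : ∀ {A s} → Mor (arr s A ⊗ ix s) A
  nilₘ    : ∀ {A B} → Mor A (arr (const 0) B)
  consₘ   : ∀ {A B k} → Mor A B → Mor A (arr (const k) B) → Mor A (arr (const (suc k)) B)
  loopₘ   : ∀ {A S} s → Mor A S → Mor ((A ⊗ ix s) ⊗ S) S → Mor A S

⟦_⟧ : ∀ {A B} → Mor A B → ∀ {n} → Val A n → Val B n
⟦ idₘ ⟧ a = a
⟦ g ⊙ f ⟧ a = ⟦ g ⟧ (⟦ f ⟧ a)
⟦ ⟨ f , g ⟩ₘ ⟧ a = ⟦ f ⟧ a , ⟦ g ⟧ a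
⟦ fstₘ ⟧ = proj₁
⟦ sndₘ ⟧ = proj₂
⟦ litₘ b ⟧ a = b
⟦ numₘ i ⟧ a = i
⟦ condₘ b f g ⟧ a = ifᵇ ⟦ b ⟧ a then ⟦ f ⟧ a else ⟦ g ⟧ a
⟦ eqₘ ⟧ (i , j) = toℕ i ≡ᵇ toℕ j
⟦ tabₘ f ⟧ a i = ⟦ f ⟧ (a , i)
⟦ atₘ ⟧ (f , i) = f i
⟦ nilₘ ⟧ a = Vector.[]
⟦ consₘ f g ⟧ a = ⟦ f ⟧ a Vector.∷ ⟦ g ⟧ a
⟦ loopₘ s init body ⟧ {n} a = fold (size s n) (λ i t → ⟦ body ⟧ ((a , i) , t)) (⟦ init ⟧ a)

-- Compilation to tree programs, with bounds on the number of steps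

enc : ∀ A {n} → Val A n → Tree
enc bool      b       = encodeBool b
enc (ix s)    i       = encodeℕ (toℕ i)
enc (A ⊗ B)   (a , b) = enc A a ∙ enc B b
enc (arr s A) f       = encodeList (tabulate (enc A ∘ f))

numeral : ℕ → Program
numeral zero    = null
numeral (suc k) = pair null (numeral k)

boolean : Bool → Program
boolean false = null
boolean true  = pair null null

bound : Sort → Program
bound vertex    = head
bound (const k) = numeral k

-- The state of a loop is counter ∙ (accumulator ∙ environment); the body q
-- computes the new accumulator from the decremented counter.
countdown : Program → Program
countdown q =
  while head repeat
    (pair (head ⨾ tail) tail ⨾ pair head (pair q (tail ⨾ tail)))

-- An input a over a graph with n vertices is presented as encodeℕ n ∙ enc a.
compile : ∀ {A B} → Mor A B → Program
compile idₘ = tail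
compile (g ⊙ f) = pair head (compile f) ⨾ compile g
compile ⟨ f , g ⟩ₘ = pair (compile f) (compile g)
compile fstₘ = tail ⨾ head
compile sndₘ = tail ⨾ tail
compile (litₘ b) = boolean b
compile (numₘ i) = numeral (toℕ i)
compile (condₘ b f g) = if compile b then compile f else compile g
compile eqₘ =
  tail ⨾
  (while (if head then tail else null) repeat pair (head ⨾ tail) (tail ⨾ tail)) ⨾
  (if head then null else if tail then null else pair null null)
compile atₘ =
  tail ⨾ (while tail repeat pair (head ⨾ tail) (tail ⨾ tail)) ⨾ (head ⨾ head)
compile (tabₘ {s = s} f) =
  pair (bound s) (pair null skip) ⨾
  countdown
    (pair (pair (tail ⨾ tail ⨾ head) (pair (tail ⨾ tail ⨾ tail) head) ⨾ compile f)
          (tail ⨾ head)) ⨾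
  (tail ⨾ head)
compile nilₘ = null
compile (consₘ f g) = pair (compile f) (compile g)
compile (loopₘ s init body) =
  pair (bound s) (pair (compile init) skip) ⨾
  countdown
    (pair (tail ⨾ tail ⨾ head)
          (pair (pair (tail ⨾ tail ⨾ tail) head) (tail ⨾ head)) ⨾ compile body) ⨾
  (tail ⨾ head)

infix 2 _⟨_⟩⇓_≲_

_⟨_⟩⇓_≲_ : Program → Tree → Tree → ℕ → Set
p ⟨ x ⟩⇓ y ≲ c = ∃[ t ] (p ⟨ x ⟩⇓ y [ t ]) × t ≤ c

pair≲ : ∀ {p q x y z s t} → p ⟨ x ⟩⇓ y ≲ s → q ⟨ x ⟩⇓ z ≲ t →
        pair p q ⟨ x ⟩⇓ y ∙ z ≲ suc (s + t)
pair≲ (_ , d , l) (_ , e , m) = _ , pair d e , s≤s (+-mono-≤ l m)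

seq≲ : ∀ {p q x y z s t} → p ⟨ x ⟩⇓ y ≲ s → q ⟨ y ⟩⇓ z ≲ t →
       (p ⨾ q) ⟨ x ⟩⇓ z ≲ suc (s + t)
seq≲ (_ , d , l) (_ , e , m) = _ , seq d e , s≤s (+-mono-≤ l m)

true≲ : ∀ {b p q x u v y s t} → b ⟨ x ⟩⇓ u ∙ v ≲ s → p ⟨ x ⟩⇓ y ≲ t →
        (if b then p else q) ⟨ x ⟩⇓ y ≲ suc (s + t)
true≲ (_ , d , l) (_ , e , m) = _ , if-true d e , s≤s (+-mono-≤ l m)

false≲ : ∀ {b p q x y s t} → b ⟨ x ⟩⇓ nil ≲ s → q ⟨ x ⟩⇓ y ≲ t →
         (if b then p else q) ⟨ x ⟩⇓ y ≲ suc (s + t)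
false≲ (_ , d , l) (_ , e , m) = _ , if-false d e , s≤s (+-mono-≤ l m)

stop≲ : ∀ {b p x s} → b ⟨ x ⟩⇓ nil ≲ s → (while b repeat p) ⟨ x ⟩⇓ x ≲ suc s
stop≲ (_ , d , l) = _ , stop d , s≤s l

loop≲ : ∀ {b p x u v y z r s t} →
        b ⟨ x ⟩⇓ u ∙ v ≲ r → p ⟨ x ⟩⇓ y ≲ s → (while b repeat p) ⟨ y ⟩⇓ z ≲ t →
        (while b repeat p) ⟨ x ⟩⇓ z ≲ suc (r + s + t)
loop≲ (_ , d , l) (_ , e , m) (_ , f , o) =
  _ , loop d e f , s≤s (+-mono-≤ (+-mono-≤ l m) o)

weaken≲ : ∀ {p x y s t} → s ≤ t → p ⟨ x ⟩⇓ y ≲ s → p ⟨ x ⟩⇓ y ≲ t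
weaken≲ le (t , d , l) = t , d , ≤-trans l le

skip≲ : ∀ {x} → skip ⟨ x ⟩⇓ x ≲ 1
skip≲ = _ , skip , ≤-refl

null≲ : ∀ {x} → null ⟨ x ⟩⇓ nil ≲ 1
null≲ = _ , null , ≤-refl

head≲ : ∀ {x y} → head ⟨ x ∙ y ⟩⇓ x ≲ 1
head≲ = _ , head-∙ , ≤-refl

tail≲ : ∀ {x y} → tail ⟨ x ∙ y ⟩⇓ y ≲ 1
tail≲ = _ , tail-∙ , ≤-refl

numeral≲ : ∀ k {x} → numeral k ⟨ x ⟩⇓ encodeℕ k ≲ 1 + 2 * k
numeral≲ zero    = null≲
numeral≲ (suc k) =
  weaken≲ (≤-reflexive (cong (λ m → suc (suc m)) (sym (+-suc k (k + 0)))))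
    (pair≲ null≲ (numeral≲ k))

boolean≲ : ∀ b {x} → boolean b ⟨ x ⟩⇓ encodeBool b ≲ 3
boolean≲ false = weaken≲ (s≤s z≤n) null≲
boolean≲ true  = pair≲ null≲ null≲

bound≲ : ∀ s {n x} → bound s ⟨ encodeℕ n ∙ x ⟩⇓ encodeℕ (size s n) ≲ 1 + 2 * size s n
bound≲ vertex    = weaken≲ (s≤s z≤n) head≲
bound≲ (const k) = numeral≲ k

-- The offset `o` makes the induction possible: `k` iterations take the counter from `o + k` down to
-- `o`. As `fold` treats index zero last, the other indices run first, at offset `suc o`, and one
-- iteration at counter `o` remains. Apart from the body, an iteration takes 14 steps.
countdown≲ :
  ∀ {S : Set} (e : S → Tree) {q env z c} k o (f : Fin k → S → S) (s : S) {t} →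
  (∀ i s → q ⟨ encodeℕ (o + toℕ i) ∙ (e s ∙ env) ⟩⇓ e (f i s) ≲ c) →
  countdown q ⟨ encodeℕ o ∙ (e (fold k f s) ∙ env) ⟩⇓ z ≲ t →
  countdown q ⟨ encodeℕ (o + k) ∙ (e s ∙ env) ⟩⇓ z ≲ k * (14 + c) + t
countdown≲ e zero o f s step rest =
  subst (λ m → countdown _ ⟨ encodeℕ m ∙ _ ⟩⇓ _ ≲ _) (sym (+-identityʳ o)) rest
countdown≲ e {q} {env} {z} {c} (suc k) o f s {t} step rest =
  subst₂ (λ m b → countdown q ⟨ encodeℕ m ∙ (e s ∙ env) ⟩⇓ z ≲ b)
    (sym (+-suc o k)) (arith k (14 + c) t)
    (countdown≲ e k (suc o) (f ∘ suc) s
      (λ i s → subst (λ m → q ⟨ encodeℕ m ∙ (e s ∙ env) ⟩⇓ e (f (suc i) s) ≲ c)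
                 (+-suc o (toℕ i)) (step (suc i) s))
      (weaken≲ (≤-reflexive (arith′ c t))
        (loop≲ head≲
          (seq≲ (pair≲ (seq≲ head≲ tail≲) tail≲)
            (pair≲ head≲ (pair≲ (subst (λ m → q ⟨ encodeℕ m ∙ _ ⟩⇓ _ ≲ c) (+-identityʳ o)
                                   (step zero (fold k (f ∘ suc) s)))
                                (seq≲ tail≲ tail≲))))
          rest)))
  where
  arith : ∀ k c t → k * c + (c + t) ≡ suc k * c + t
  arith k c t = trans (sym (+-assoc (k * c) c t)) (cong (_+ t) (+-comm (k * c) c))
  arith′ : ∀ c t → suc (1 + suc (suc (3 + 1) + suc (1 + suc (c + 3))) + t) ≡ 14 + c + t
  arith′ c t = cong (λ m → m + t) (cong (11 +_) (+-comm c 3))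

nth≲ : ∀ {m} (f : Fin m → Tree) (i : Fin m) → ∃[ rest ]
       ((while tail repeat pair (head ⨾ tail) (tail ⨾ tail))
          ⟨ encodeList (tabulate f) ∙ encodeℕ (toℕ i) ⟩⇓ (f i ∙ rest) ∙ nil
          ≲ toℕ i * 9 + 2)
nth≲ f zero = _ , stop≲ tail≲
nth≲ f (suc i) =
  _ , loop≲ tail≲ (pair≲ (seq≲ head≲ tail≲) (seq≲ tail≲ tail≲)) (proj₂ (nth≲ (f ∘ suc) i))

-- Both numerals lose a cell until one of them is empty; they were equal exactly if both are empty
-- by then. Hence the number of iterations is at most `a`.
equal≲ : ∀ a b → ∃[ x ] ∃[ y ]
  ((while (if head then tail else null) repeat pair (head ⨾ tail) (tail ⨾ tail))
     ⟨ encodeℕ a ∙ encodeℕ b ⟩⇓ x ∙ y ≲ a * 11 + 4) ×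
  ((if head then null else if tail then null else pair null null)
     ⟨ x ∙ y ⟩⇓ encodeBool (a ≡ᵇ b) ≲ 7)
equal≲ zero zero = _ , _ , stop≲ (false≲ head≲ null≲) , false≲ head≲ (false≲ tail≲ (pair≲ null≲ null≲))
equal≲ zero (suc b) =
  _ , _ , stop≲ (false≲ head≲ null≲) ,
  weaken≲ (s≤s (s≤s (s≤s (s≤s (s≤s z≤n))))) (false≲ head≲ (true≲ tail≲ null≲))
equal≲ (suc a) zero =
  _ , _ , weaken≲ (m≤n+m 4 (suc a * 11)) (stop≲ (true≲ head≲ tail≲)) ,
  weaken≲ (s≤s (s≤s (s≤s z≤n))) (true≲ head≲ null≲)
equal≲ (suc a) (suc b) with x , y , w , r ← equal≲ a b =
  x , y , loop≲ (true≲ head≲ tail≲) (pair≲ (seq≲ head≲ tail≲) (seq≲ tail≲ tail≲)) w , r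

-- The types fix the length of every loop, so the bound can depend on `n` without depending on the
-- input. A conditional is charged for both branches.
cost : ∀ {A B} → Mor A B → ℕ → ℕ
cost idₘ n = 1
cost (g ⊙ f) n = suc (suc (1 + cost f n) + cost g n)
cost ⟨ f , g ⟩ₘ n = suc (cost f n + cost g n)
cost fstₘ n = 3
cost sndₘ n = 3
cost (litₘ b) n = 3
cost (numₘ i) n = 1 + 2 * toℕ i
cost (condₘ b f g) n = suc (cost b n + (cost f n + cost g n))
cost (eqₘ {s}) n = suc (1 + suc ((size s n * 11 + 4) + 7))
cost (tabₘ {s = s} f) n =
  suc (suc ((1 + 2 * size s n) + 3) +
       suc ((size s n * (14 + suc (suc (13 + cost f n) + 3)) + 2) + 3))
cost (atₘ {s = s}) n = suc (1 + suc ((size s n * 9 + 2) + 3))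
cost nilₘ n = 1
cost (consₘ f g) n = suc (cost f n + cost g n)
cost (loopₘ s init body) n =
  suc (suc ((1 + 2 * size s n) + suc (cost init n + 1)) +
       suc ((size s n * (14 + suc (17 + cost body n)) + 2) + 3))

compile≲ : ∀ {A B} (m : Mor A B) {n} (a : Val A n) →
           compile m ⟨ encodeℕ n ∙ enc A a ⟩⇓ enc B (⟦ m ⟧ a) ≲ cost m n
compile≲ idₘ a = tail≲
compile≲ (g ⊙ f) a = seq≲ (pair≲ head≲ (compile≲ f a)) (compile≲ g (⟦ f ⟧ a))
compile≲ ⟨ f , g ⟩ₘ a = pair≲ (compile≲ f a) (compile≲ g a)
compile≲ fstₘ a = seq≲ tail≲ head≲
compile≲ sndₘ a = seq≲ tail≲ tail≲
compile≲ (litₘ b) a = boolean≲ b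
compile≲ (numₘ i) a = numeral≲ (toℕ i)
compile≲ (condₘ b f g) {n} a with ⟦ b ⟧ a | compile≲ b a
... | true  | t = weaken≲ (s≤s (+-monoʳ-≤ (cost b n) (m≤m+n (cost f n) (cost g n))))
                    (true≲ t (compile≲ f a))
... | false | t = weaken≲ (s≤s (+-monoʳ-≤ (cost b n) (m≤n+m (cost g n) (cost f n))))
                    (false≲ t (compile≲ g a))
compile≲ (eqₘ {s}) {n} (i , j) with x , y , w , r ← equal≲ (toℕ i) (toℕ j) =
  seq≲ tail≲
    (seq≲ (weaken≲ (+-monoˡ-≤ 4 (*-monoˡ-≤ 11 (<⇒≤ (toℕ<n i)))) w) r)
compile≲ (tabₘ {A} {B} {s = s} f) {n} a =
  seq≲ (pair≲ (bound≲ s) (pair≲ null≲ skip≲))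
    -- The counter falls while values are prepended, so the list comes out in increasing order of
    -- the indices.
    (seq≲ (subst (λ z → countdown _ ⟨ _ ⟩⇓ nil ∙ (z ∙ _) ≲ _) (folded (size s n) _)
             (countdown≲ (λ t → t) (size s n) 0 (λ i t → enc B (⟦ f ⟧ (a , i)) ∙ t) nil
               (λ i t → pair≲ (seq≲ (pair≲ (seq≲ tail≲ (seq≲ tail≲ head≲))
                                           (pair≲ (seq≲ tail≲ (seq≲ tail≲ tail≲)) head≲))
                                    (compile≲ f (a , i)))
                              (seq≲ tail≲ head≲))
               (stop≲ head≲)))
          (seq≲ tail≲ head≲))
  where
  folded : ∀ k (g : Fin k → Tree) →
           fold k (λ i t → g i ∙ t) nil ≡ encodeList (tabulate g)
  folded zero    g = refl
  folded (suc k) g = cong (g zero ∙_) (folded k (g ∘ suc))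
compile≲ (atₘ {A} {s}) {n} (f , i) =
  seq≲ tail≲
    (seq≲ (weaken≲ (+-monoˡ-≤ 2 (*-monoˡ-≤ 9 (<⇒≤ (toℕ<n i))))
             (proj₂ (nth≲ (enc A ∘ f) i)))
          (seq≲ head≲ head≲))
compile≲ nilₘ a = null≲
compile≲ (consₘ f g) a = pair≲ (compile≲ f a) (compile≲ g a)
compile≲ (loopₘ {A} {S} s init body) {n} a =
  seq≲ (pair≲ (bound≲ s) (pair≲ (compile≲ init a) skip≲))
    (seq≲ (countdown≲ (enc S) (size s n) 0 (λ i t → ⟦ body ⟧ ((a , i) , t)) (⟦ init ⟧ a)
             (λ i t → seq≲ (pair≲ (seq≲ tail≲ (seq≲ tail≲ head≲))
                              (pair≲ (pair≲ (seq≲ tail≲ (seq≲ tail≲ tail≲)) head≲)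
                                     (seq≲ tail≲ head≲)))
                        (compile≲ body ((a , i) , t)))
             (stop≲ head≲))
          (seq≲ tail≲ head≲))

-- Polynomial bounds

PolyBounded : (ℕ → ℕ) → Set
PolyBounded f = ∃[ a ] ∃[ k ] ∀ n → f n ≤ a * suc n ^ k

poly-const : ∀ c → PolyBounded (λ _ → c)
poly-const c = c , 0 , λ n → ≤-reflexive (sym (*-identityʳ c))

poly-id : PolyBounded (λ n → n)
poly-id = 1 , 1 , λ n → ≤-trans (n≤1+n n)
  (≤-reflexive (sym (trans (*-identityˡ _) (*-identityʳ (suc n)))))

-- The base `suc n` is never zero, so both powers may be raised to the common exponent `k + l`.
poly-+ : ∀ {f g} → PolyBounded f → PolyBounded g → PolyBounded (λ n → f n + g n)
poly-+ {f} {g} (a , k , p) (b , l , q) = a + b , k + l , λ n → begin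
  f n + g n                                  ≤⟨ +-mono-≤ (p n) (q n) ⟩
  a * suc n ^ k + b * suc n ^ l              ≤⟨ +-mono-≤
    (*-monoʳ-≤ a (^-monoʳ-≤ (suc n) (m≤m+n k l)))
    (*-monoʳ-≤ b (^-monoʳ-≤ (suc n) (m≤n+m l k))) ⟩
  a * suc n ^ (k + l) + b * suc n ^ (k + l)  ≡⟨ *-distribʳ-+ (suc n ^ (k + l)) a b ⟨
  (a + b) * suc n ^ (k + l)                  ∎
  where open ≤-Reasoning

poly-* : ∀ {f g} → PolyBounded f → PolyBounded g → PolyBounded (λ n → f n * g n)
poly-* {f} {g} (a , k , p) (b , l , q) = a * b , k + l , λ n → begin
  f n * g n                          ≤⟨ *-mono-≤ (p n) (q n) ⟩
  (a * suc n ^ k) * (b * suc n ^ l)  ≡⟨ [m*n]*[o*p]≡[m*o]*[n*p] a (suc n ^ k) b (suc n ^ l) ⟩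
  (a * b) * (suc n ^ k * suc n ^ l)  ≡⟨ cong (a * b *_) (^-distribˡ-+-* (suc n) k l) ⟨
  (a * b) * suc n ^ (k + l)          ∎
  where open ≤-Reasoning

poly-size : ∀ s → PolyBounded (size s)
poly-size vertex    = poly-id
poly-size (const k) = poly-const k

poly-cost : ∀ {A B} (m : Mor A B) → PolyBounded (cost m)
poly-cost idₘ = poly-const 1
poly-cost (g ⊙ f) = poly-+ (poly-const 1) (poly-+ (poly-+ (poly-const 2) (poly-cost f)) (poly-cost g))
poly-cost ⟨ f , g ⟩ₘ = poly-+ (poly-const 1) (poly-+ (poly-cost f) (poly-cost g))
poly-cost fstₘ = poly-const 3
poly-cost sndₘ = poly-const 3
poly-cost (litₘ b) = poly-const 3
poly-cost (numₘ i) = poly-const _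
poly-cost (condₘ b f g) =
  poly-+ (poly-const 1) (poly-+ (poly-cost b) (poly-+ (poly-cost f) (poly-cost g)))
poly-cost (eqₘ {s}) =
  poly-+ (poly-const 3)
    (poly-+ (poly-+ (poly-* (poly-size s) (poly-const 11)) (poly-const 4)) (poly-const 7))
poly-cost (tabₘ {s = s} f) =
  poly-+ (poly-const 1)
    (poly-+ (poly-+ (poly-const 1)
              (poly-+ (poly-+ (poly-const 1) (poly-* (poly-const 2) (poly-size s))) (poly-const 3)))
      (poly-+ (poly-const 1)
        (poly-+ (poly-+
          (poly-* (poly-size s)
            (poly-+ (poly-const 15) (poly-+ (poly-+ (poly-const 14) (poly-cost f)) (poly-const 3))))
          (poly-const 2)) (poly-const 3))))
poly-cost (atₘ {s = s}) =
  poly-+ (poly-const 3)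
    (poly-+ (poly-+ (poly-* (poly-size s) (poly-const 9)) (poly-const 2)) (poly-const 3))
poly-cost nilₘ = poly-const 1
poly-cost (consₘ f g) = poly-+ (poly-const 1) (poly-+ (poly-cost f) (poly-cost g))
poly-cost (loopₘ s init body) =
  poly-+ (poly-const 1)
    (poly-+ (poly-+ (poly-const 1)
              (poly-+ (poly-+ (poly-const 1) (poly-* (poly-const 2) (poly-size s)))
                (poly-+ (poly-const 1) (poly-+ (poly-cost init) (poly-const 1)))))
      (poly-+ (poly-const 1)
        (poly-+ (poly-+
          (poly-* (poly-size s) (poly-+ (poly-const 32) (poly-cost body)))
          (poly-const 2)) (poly-const 3))))

^-distribʳ-* : ∀ k m n → (m * n) ^ k ≡ m ^ k * n ^ k
^-distribʳ-* zero    m n = refl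
^-distribʳ-* (suc k) m n =
  trans (cong (m * n *_) (^-distribʳ-* k m n)) ([m*n]*[o*p]≡[m*o]*[n*p] m n (m ^ k) (n ^ k))

-- For positive `n` the base `suc n` is at most `2 * n`, which costs a factor `2 ^ k`. At zero the
-- additive constant is the bound.
poly-standard : ∀ {f} → PolyBounded f → ∃[ a ] ∃[ k ] ∀ n → f n ≤ a * n ^ k + a
poly-standard {f} (a , k , p) = a * 2 ^ k , k , bounded
  where
  open ≤-Reasoning
  bounded : ∀ n → f n ≤ a * 2 ^ k * n ^ k + a * 2 ^ k
  bounded zero = begin
    f 0                            ≤⟨ p 0 ⟩
    a * 1 ^ k                      ≤⟨ *-monoʳ-≤ a (^-monoˡ-≤ k {1} {2} (s≤s z≤n)) ⟩
    a * 2 ^ k                      ≤⟨ m≤n+m _ _ ⟩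
    a * 2 ^ k * 0 ^ k + a * 2 ^ k  ∎
  bounded n@(suc m) = begin
    f n                            ≤⟨ p n ⟩
    a * suc n ^ k                  ≤⟨ *-monoʳ-≤ a (^-monoˡ-≤ k (+-monoˡ-≤ n {1} {n} (s≤s z≤n))) ⟩
    a * (n + n) ^ k                ≡⟨ cong (λ d → a * (n + d) ^ k) (+-identityʳ n) ⟨
    a * (2 * n) ^ k                ≡⟨ cong (a *_) (^-distribʳ-* k 2 n) ⟩
    a * (2 ^ k * n ^ k)            ≡⟨ *-assoc a (2 ^ k) (n ^ k) ⟨
    a * 2 ^ k * n ^ k              ≤⟨ m≤m+n _ _ ⟩
    a * 2 ^ k * n ^ k + a * 2 ^ k  ∎

-- The colouring algorithm as a function

infixr 7 _and_
infixr 6 _or_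
infixr 5 _implies_
infix  8 _==_

-- Written with conditionals because the language has nothing else: the terms then denote these
-- functions by mere computation, and `attempt≡` and `candidates≡` hold by `refl`.
_and_ _or_ _implies_ : Bool → Bool → Bool
a and b     = ifᵇ a then b else false
a or b      = ifᵇ a then true else b
a implies b = ifᵇ a then b else true

neg : Bool → Bool
neg a = ifᵇ a then false else true

_==_ : ∀ {n} → Fin n → Fin n → Bool
i == j = toℕ i ≡ᵇ toℕ j

any all : ∀ {n} → (Fin n → Bool) → Bool
any {n} p = fold n (λ i b → p i or b) false
all {n} p = fold n (λ i b → p i and b) true

flip : Fin 2 → Fin 2
flip s = ifᵇ s == 0F then 1F else 0F

Adjacency Lists Literals Candidates Implications Partial : ℕ → Set
Adjacency n    = Fin n → Fin n → Bool
Lists n        = Fin n → Fin 3 → Bool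
Literals n     = Fin n → Fin 2 → Bool
Candidates n   = Fin n → Fin 2 → Fin 3
Implications n = Fin n → Fin 2 → Fin n → Fin 2 → Bool
Partial n      = Fin n → Bool × Fin 3

Base : ℕ → ℕ → Set
Base n m = Fin m → Fin n × Fin 3

Extra : ℕ → ℕ → ℕ → Set
Extra n m k = Fin m → Fin m → Fin k → Fin n × Fin 3

private
  variable
    n m k : ℕ
    Δ : Ty

-- Warshall's algorithm: (w , r) runs over the intermediate literals.
closure : Implications n → Implications n
closure {n} E =
  fold n (λ w R → fold 2 (λ r R v s u t → R v s u t or R v s w r and R w r u t) R)
    (λ v s u t → v == u and s == t or E v s u t)

connected : Adjacency n → Fin n → Fin n → Bool
connected G v u = closure (λ v _ u _ → G v u) v 0F u 0F

-- A literal (v , s) says that v gets the colour c v s; the two candidate colours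
-- of a vertex may coincide.
conflict : Adjacency n → Candidates n → Implications n
conflict G c v s u t = G v u and c v s == c u (flip t)

-- A literal is added together with all its consequences, unless it implies its own negation. A
-- vertex both of whose literals do so is passed over, so that an unsatisfiable component does not
-- spoil the others.
choose : Implications n → Literals n
choose {n} R = fold n
  (λ v A →
    ifᵇ A v 0F or A v 1F then A
    else ifᵇ neg (R v 0F v 1F) then (λ u t → A u t or R v 0F u t)
    else ifᵇ neg (R v 1F v 0F) then (λ u t → A u t or R v 1F u t)
    else A)
  (λ _ _ → false)

assigned : Adjacency n → Literals n → Fin n → Bool
assigned G A v = all λ u → connected G v u implies (A u 0F or A u 1F)

adopt : Adjacency n → Candidates n → Literals n → Partial n → Partial n
adopt G c A g v =
  ifᵇ proj₁ (g v) or neg (assigned G A v) then g v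
  else (true , (ifᵇ A v 0F then c v 0F else c v 1F))

opaque
  attempt : Adjacency n → Candidates n → Partial n → Partial n
  attempt G c = adopt G c (choose (closure (conflict G c)))

is : Fin n × Fin 3 → Fin n → Fin 3 → Bool
is p v a = proj₁ p == v and proj₂ p == a

guessed : Base n m → Extra n m k → Lists n
guessed C X v a =
  any (λ i → is (C i) v a) or any λ i → any λ j → any λ k → is (X i j k) v a

available : Adjacency n → Lists n → Lists n
available G F v a = neg (any λ u → G v u and F u a)

forced : Lists n → Lists n
forced L v a = all λ b → b == a or neg (L v b)

refined : Adjacency n → Lists n → Lists n
refined G L v a = L v a and neg (any λ u → G v u and forced L u a)

near : Adjacency n → Base n m → Fin n → Bool
near G C v = any λ i → G v (proj₁ (C i))

linked : Adjacency n → (Fin n → Bool) → Fin n → Bool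
linked G N v = neg (N v) and any λ u → G v u and neg (N u)

covered : Adjacency n → (Fin n → Bool) → Fin n → Fin n → Bool
covered G N x c = all λ v → (G x v and N v) implies G v c

-- x and its far neighbours may be coloured like the adjacent vertices C i and C j.
valid : Adjacency n → (Fin n → Bool) → Base n m → Fin n → Fin m → Fin m → Bool
valid G N C x i j =
  G (proj₁ (C i)) (proj₁ (C j)) and covered G N x (proj₁ (C i)) and
  all λ y → (G x y and neg (N y)) implies covered G N y (proj₁ (C j))

-- Both orders of `i` and `j` are tested in the same pass. For adjacent far vertices x and y the
-- valid pairs differ by a swap, so each pass sets both colours or neither, and at the end x and y
-- have the colours of the two ends of one edge of C.
pick : Adjacency n → (Fin n → Bool) → Base n m → Fin n → Fin 3
pick {m = m} G N C x =
  fold m (λ i r → fold m (λ j r →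
    ifᵇ valid G N C x i j then proj₂ (C i)
    else ifᵇ valid G N C x j i then proj₂ (C j)
    else r) r) 0F

safe : Adjacency n → Lists n → Lists n
safe G L v a = all λ u → G v u implies neg (L u a)

-- Where `lists` uses it under a correct guess, the vertices of C at distance two from `v` show at
-- least two colours, so one colour is left.
third : Adjacency n → Base n m → Lists n
third G C v a =
  neg (any λ u → G v u and any λ i → G u (proj₁ (C i)) and proj₂ (C i) == a)

-- A vertex v far from C either lies on an edge of far vertices and is folded onto
-- C, or has all its neighbours near C; in the latter case, if neither its own
-- list was refined nor some colour is free at all its neighbours, then the guess
-- is assumed to be such that v avoids the colours of the vertices of C at
-- distance two.
lists : Adjacency n → Base n m → (Fin n → Bool) → Lists n → Lists n → Lists n
lists G C N L₁ L₂ v a =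
  ifᵇ linked G N v then pick G N C v == a
  else ifᵇ all (L₂ v) then
    (ifᵇ any (safe G L₁ v) then safe G L₁ v a else third G C v a)
  else L₂ v a

-- Junk values: an empty list gives 2 and 0, and a list of all colours loses 1.
extremes : Lists n → Candidates n
extremes L v s =
  ifᵇ s == 0F
  then (ifᵇ L v 0F then 0F else ifᵇ L v 1F then 1F else 2F)
  else (ifᵇ L v 2F then 2F else ifᵇ L v 1F then 1F else 0F)

extend : Adjacency n → Base n m → Lists n → Candidates n
extend G C L = extremes (lists G C (near G C) L (refined G L))

opaque
  candidates : Adjacency n → Base n m → Extra n m k → Candidates n
  candidates G C X = extend G C (available G (guessed C X))

twoColours : Candidates n
twoColours v s = ifᵇ s == 0F then 0F else 1F

-- The same functions as terms

infixr 6 _andₘ_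
infixr 5 _orₘ_
infixr 4 _impliesₘ_
infix  7 _==ₘ_
infixl 8 _!_
infix 9 _↑

_andₘ_ _orₘ_ _impliesₘ_ : ∀ {A} → Mor A bool → Mor A bool → Mor A bool
a andₘ b     = condₘ a b (litₘ false)
a orₘ b      = condₘ a (litₘ true) b
a impliesₘ b = condₘ a b (litₘ true)

negₘ : ∀ {A} → Mor A bool → Mor A bool
negₘ a = condₘ a (litₘ false) (litₘ true)

_==ₘ_ : ∀ {A s} → Mor A (ix s) → Mor A (ix s) → Mor A bool
i ==ₘ j = eqₘ ⊙ ⟨ i , j ⟩ₘ

_!_ : ∀ {A s B} → Mor A (arr s B) → Mor A (ix s) → Mor A B
f ! i = atₘ ⊙ ⟨ f , i ⟩ₘ

_↑ : ∀ {A B C} → Mor A C → Mor (A ⊗ B) C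
f ↑ = f ⊙ fstₘ

flipₘ : ∀ {A} → Mor A (ix (const 2)) → Mor A (ix (const 2))
flipₘ s = condₘ (s ==ₘ numₘ 0F) (numₘ 1F) (numₘ 0F)

letₘ : ∀ {A B C} → Mor A B → Mor (A ⊗ B) C → Mor A C
letₘ e f = f ⊙ ⟨ idₘ , e ⟩ₘ

anyₘ allₘ : ∀ {A s} → Mor (A ⊗ ix s) bool → Mor A bool
anyₘ {s = s} p = loopₘ s (litₘ false) ((p ↑) orₘ sndₘ)
allₘ {s = s} p = loopₘ s (litₘ true) ((p ↑) andₘ sndₘ)

#0 : ∀ {A B} → Mor (A ⊗ B) B
#0 = sndₘ
#1 : ∀ {A B C} → Mor ((A ⊗ B) ⊗ C) B
#1 = #0 ↑
#2 : ∀ {A B C D} → Mor (((A ⊗ B) ⊗ C) ⊗ D) B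
#2 = #1 ↑
#3 : ∀ {A B C D E} → Mor ((((A ⊗ B) ⊗ C) ⊗ D) ⊗ E) B
#3 = #2 ↑
#4 : ∀ {A B C D E F} → Mor (((((A ⊗ B) ⊗ C) ⊗ D) ⊗ E) ⊗ F) B
#4 = #3 ↑
#5 : ∀ {A B C D E F G} → Mor ((((((A ⊗ B) ⊗ C) ⊗ D) ⊗ E) ⊗ F) ⊗ G) B
#5 = #4 ↑
#6 : ∀ {A B C D E F G H} → Mor (((((((A ⊗ B) ⊗ C) ⊗ D) ⊗ E) ⊗ F) ⊗ G) ⊗ H) B
#6 = #5 ↑

sign colour vc adjT listsT litT candT implT partT setT : Ty
baseT : ℕ → Ty
extraT : ℕ → ℕ → Ty
sign   = ix (const 2)
colour = ix (const 3)
vc     = ix vertex ⊗ colour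
setT   = arr vertex bool
adjT   = arr vertex (arr vertex bool)
listsT = arr vertex (arr (const 3) bool)
litT   = arr vertex (arr (const 2) bool)
candT  = arr vertex (arr (const 2) colour)
implT  = arr vertex (arr (const 2) (arr vertex (arr (const 2) bool)))
baseT m  = arr (const m) vc
extraT m k = arr (const m) (arr (const m) (arr (const k) vc))
partT  = arr vertex (bool ⊗ colour)

closureₘ : Mor Δ implT → Mor Δ implT
closureₘ E =
  loopₘ vertex
    (tabₘ (tabₘ (tabₘ (tabₘ
      ((#3 ==ₘ #1 andₘ #2 ==ₘ #0) orₘ E ↑ ↑ ↑ ↑ ! #3 ! #2 ! #1 ! #0)))))
    (loopₘ (const 2) #0
      (tabₘ (tabₘ (tabₘ (tabₘ
        (#4 ! #3 ! #2 ! #1 ! #0 orₘ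
         (#4 ! #3 ! #2 ! w ! #5 andₘ #4 ! w ! #5 ! #1 ! #0)))))))
  where
  -- The variable of the outer loop has index 7: the state of that loop at the start of the inner
  -- one lies between the two loop variables.
  w : ∀ {A B C D E F G H} → Mor ((((((((A ⊗ B) ⊗ C) ⊗ D) ⊗ E) ⊗ F) ⊗ G) ⊗ H) ⊗ sign) B
  w = #6 ↑

connectedₘ : Mor Δ adjT → Mor Δ adjT
connectedₘ G =
  letₘ (closureₘ (tabₘ (tabₘ (tabₘ (tabₘ (G ↑ ↑ ↑ ↑ ! #3 ! #1))))))
    (tabₘ (tabₘ (#2 ! #1 ! numₘ 0F ! #0 ! numₘ 0F)))

conflictₘ : Mor Δ adjT → Mor Δ candT → Mor Δ implT
conflictₘ G c = tabₘ (tabₘ (tabₘ (tabₘ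
  (G ↑ ↑ ↑ ↑ ! #3 ! #1 andₘ c ↑ ↑ ↑ ↑ ! #3 ! #2 ==ₘ c ↑ ↑ ↑ ↑ ! #1 ! flipₘ #0))))

chooseₘ : Mor Δ implT → Mor Δ litT
chooseₘ R = loopₘ vertex (tabₘ (tabₘ (litₘ false)))
  (condₘ (#0 ! #1 ! numₘ 0F orₘ #0 ! #1 ! numₘ 1F) #0
  (condₘ (negₘ (R ↑ ↑ ! #1 ! numₘ 0F ! #1 ! numₘ 1F))
    (tabₘ (tabₘ (#2 ! #1 ! #0 orₘ R ↑ ↑ ↑ ↑ ! #3 ! numₘ 0F ! #1 ! #0)))
  (condₘ (negₘ (R ↑ ↑ ! #1 ! numₘ 1F ! #1 ! numₘ 0F))
    (tabₘ (tabₘ (#2 ! #1 ! #0 orₘ R ↑ ↑ ↑ ↑ ! #3 ! numₘ 1F ! #1 ! #0)))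
    #0)))

adoptₘ : Mor Δ adjT → Mor Δ candT → Mor Δ litT → Mor Δ partT → Mor Δ partT
adoptₘ G c B g = tabₘ
  (condₘ (fstₘ ⊙ (g ↑ ! #0) orₘ
          negₘ (allₘ ((connectedₘ G) ↑ ↑ ! #1 ! #0 impliesₘ
                      (B ↑ ↑ ! #0 ! numₘ 0F orₘ B ↑ ↑ ! #0 ! numₘ 1F))))
    (g ↑ ! #0)
    ⟨ litₘ true , condₘ (B ↑ ! #0 ! numₘ 0F) (c ↑ ! #0 ! numₘ 0F) (c ↑ ! #0 ! numₘ 1F) ⟩ₘ)

opaque
  attemptₘ : Mor Δ adjT → Mor Δ candT → Mor Δ partT → Mor Δ partT
  attemptₘ G c g = adoptₘ G c (chooseₘ (closureₘ (conflictₘ G c))) g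

isₘ : Mor Δ vc → Mor Δ (ix vertex) → Mor Δ colour → Mor Δ bool
isₘ p v a = (fstₘ ⊙ p) ==ₘ v andₘ (sndₘ ⊙ p) ==ₘ a

availableₘ : Mor Δ adjT → Mor Δ listsT → Mor Δ listsT
availableₘ G F = tabₘ (tabₘ (negₘ (anyₘ
  (G ↑ ↑ ↑ ! #2 ! #0 andₘ F ↑ ↑ ↑ ! #0 ! #1))))

forcedₘ : Mor Δ listsT → Mor Δ (ix vertex) → Mor Δ colour → Mor Δ bool
forcedₘ L v a = allₘ (#0 ==ₘ a ↑ orₘ negₘ (L ↑ ! v ↑ ! #0))

nearₘ : Mor Δ adjT → Mor Δ (baseT m) → Mor Δ setT
nearₘ G C = tabₘ (anyₘ (G ↑ ↑ ! #1 ! (fstₘ ⊙ (C ↑ ↑ ! #0))))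

linkedₘ : Mor Δ adjT → Mor Δ setT → Mor Δ (ix vertex) → Mor Δ bool
linkedₘ G N v = negₘ (N ! v) andₘ anyₘ (G ↑ ! v ↑ ! #0 andₘ negₘ (N ↑ ! #0))

coveredₘ : Mor Δ adjT → Mor Δ setT → Mor Δ (ix vertex) → Mor Δ (ix vertex) → Mor Δ bool
coveredₘ G N x c = allₘ ((G ↑ ! x ↑ ! #0 andₘ N ↑ ! #0) impliesₘ G ↑ ! #0 ! c ↑)

safeₘ : Mor Δ adjT → Mor Δ listsT → Mor Δ (ix vertex) → Mor Δ colour → Mor Δ bool
safeₘ G L v a = allₘ (G ↑ ! v ↑ ! #0 impliesₘ negₘ (L ↑ ! #0 ! a ↑))

thirdₘ : Mor Δ adjT → Mor Δ (baseT m) → Mor Δ (ix vertex) → Mor Δ colour → Mor Δ bool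
thirdₘ G C v a = negₘ (anyₘ (G ↑ ! v ↑ ! #0 andₘ
  anyₘ (G ↑ ↑ ! #1 ! (fstₘ ⊙ (C ↑ ↑ ! #0)) andₘ (sndₘ ⊙ (C ↑ ↑ ! #0)) ==ₘ a ↑ ↑)))

extremesₘ : Mor Δ listsT → Mor Δ candT
extremesₘ L = tabₘ (tabₘ (condₘ (#0 ==ₘ numₘ 0F)
  (condₘ (L ↑ ↑ ! #1 ! numₘ 0F) (numₘ 0F)
    (condₘ (L ↑ ↑ ! #1 ! numₘ 1F) (numₘ 1F) (numₘ 2F)))
  (condₘ (L ↑ ↑ ! #1 ! numₘ 2F) (numₘ 2F)
    (condₘ (L ↑ ↑ ! #1 ! numₘ 1F) (numₘ 1F) (numₘ 0F)))))

twoColoursₘ : Mor Δ candT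
twoColoursₘ = tabₘ (tabₘ (condₘ (#0 ==ₘ numₘ 0F) (numₘ 0F) (numₘ 1F)))

guessedₘ : Mor Δ (baseT m) → Mor Δ (extraT m k) → Mor Δ listsT
guessedₘ C X = tabₘ (tabₘ
  (anyₘ (isₘ (C ↑ ↑ ↑ ! #0) #2 #1) orₘ
   anyₘ (anyₘ (anyₘ (isₘ (X ↑ ↑ ↑ ↑ ↑ ! #2 ! #1 ! #0) #4 #3)))))

refinedₘ : Mor Δ adjT → Mor Δ listsT → Mor Δ listsT
refinedₘ G L = tabₘ (tabₘ (L ↑ ↑ ! #1 ! #0 andₘ
  negₘ (anyₘ (G ↑ ↑ ↑ ! #2 ! #0 andₘ forcedₘ (L ↑ ↑ ↑) #0 #1))))

validₘ : Mor Δ adjT → Mor Δ setT → Mor Δ (baseT m) →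
         Mor Δ (ix vertex) → Mor Δ (ix (const m)) → Mor Δ (ix (const m)) → Mor Δ bool
validₘ G N C x i j =
  G ! (fstₘ ⊙ (C ! i)) ! (fstₘ ⊙ (C ! j)) andₘ
  coveredₘ G N x (fstₘ ⊙ (C ! i)) andₘ
  allₘ ((G ↑ ! x ↑ ! #0 andₘ negₘ (N ↑ ! #0)) impliesₘ
        coveredₘ (G ↑) (N ↑) #0 ((fstₘ ⊙ (C ! j)) ↑))

pickₘ : Mor Δ adjT → Mor Δ setT → Mor Δ (baseT m) → Mor Δ (ix vertex) → Mor Δ colour
pickₘ {m = m} G N C x =
  loopₘ (const m) (numₘ 0F) (loopₘ (const m) #0
    (condₘ (validₘ (G ↑ ↑ ↑ ↑) (N ↑ ↑ ↑ ↑) (C ↑ ↑ ↑ ↑) (x ↑ ↑ ↑ ↑) #3 #1)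
      (sndₘ ⊙ (C ↑ ↑ ↑ ↑ ! #3))
    (condₘ (validₘ (G ↑ ↑ ↑ ↑) (N ↑ ↑ ↑ ↑) (C ↑ ↑ ↑ ↑) (x ↑ ↑ ↑ ↑) #1 #3)
      (sndₘ ⊙ (C ↑ ↑ ↑ ↑ ! #1))
      #0)))

listsₘ : Mor Δ adjT → Mor Δ (baseT m) → Mor Δ setT → Mor Δ listsT → Mor Δ listsT → Mor Δ listsT
listsₘ G C N L₁ L₂ = tabₘ (tabₘ
  (condₘ (linkedₘ (G ↑ ↑) (N ↑ ↑) #1) (pickₘ (G ↑ ↑) (N ↑ ↑) (C ↑ ↑) #1 ==ₘ #0)
  (condₘ (allₘ ((L₂ ↑ ↑ ! #1) ↑ ! #0))
    (condₘ (anyₘ (safeₘ (G ↑ ↑ ↑) (L₁ ↑ ↑ ↑) #2 #0))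
      (safeₘ (G ↑ ↑) (L₁ ↑ ↑) #1 #0) (thirdₘ (G ↑ ↑) (C ↑ ↑) #1 #0))
    (L₂ ↑ ↑ ! #1 ! #0))))

extendₘ : Mor Δ adjT → Mor Δ (baseT m) → Mor Δ listsT → Mor Δ candT
extendₘ G C L = extremesₘ (listsₘ G C (nearₘ G C) L (refinedₘ G L))

opaque
  candidatesₘ : Mor Δ adjT → Mor Δ (baseT m) → Mor Δ (extraT m k) → Mor Δ candT
  candidatesₘ G C X = extendₘ G C (availableₘ G (guessedₘ C X))

-- Boolean functions and loops

private
  variable
    a b : Bool

true≢false : true ≢ false
true≢false ()

and-intro : a ≡ true → b ≡ true → (a and b) ≡ true
and-intro refl refl = refl

and-elim : (a and b) ≡ true → a ≡ true × b ≡ true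
and-elim {true} p = refl , p

or-introˡ : a ≡ true → (a or b) ≡ true
or-introˡ refl = refl

or-introʳ : b ≡ true → (a or b) ≡ true
or-introʳ {a = true}  p = refl
or-introʳ {a = false} p = p

or-elim : (a or b) ≡ true → a ≡ true ⊎ b ≡ true
or-elim {true}  p = inj₁ refl
or-elim {false} p = inj₂ p

implies-intro : (a ≡ true → b ≡ true) → (a implies b) ≡ true
implies-intro {true}  f = f refl
implies-intro {false} f = refl

implies-elim : (a implies b) ≡ true → a ≡ true → b ≡ true
implies-elim p refl = p

neg-intro : ¬ a ≡ true → neg a ≡ true
neg-intro {true}  f = ⊥-elim (f refl)
neg-intro {false} f = refl

neg-elim : neg a ≡ true → ¬ a ≡ true
neg-elim () refl

decide : ∀ b → b ≡ true ⊎ neg b ≡ true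
decide true  = inj₁ refl
decide false = inj₂ refl

==-intro : ∀ {i j : Fin n} → i ≡ j → i == j ≡ true
==-intro {i = i} refl = true-of (toℕ i)
  where
  true-of : ∀ k → (k ≡ᵇ k) ≡ true
  true-of zero    = refl
  true-of (suc k) = true-of k

==-elim : ∀ {i j : Fin n} → i == j ≡ true → i ≡ j
==-elim {i = i} {j} p = toℕ-injective (≡ᵇ⇒≡ (toℕ i) (toℕ j) (subst T (sym p) tt))

any-intro : ∀ {p : Fin n → Bool} i → p i ≡ true → any p ≡ true
any-intro zero    q = or-introˡ q
any-intro {p = p} (suc i) q = or-introʳ {a = p zero} (any-intro i q)

any-elim : ∀ {p : Fin n → Bool} → any p ≡ true → ∃[ i ] p i ≡ true
any-elim {suc n} {p} q with or-elim {p zero} q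
... | inj₁ r = zero , r
... | inj₂ r with i , s ← any-elim r = suc i , s

all-intro : ∀ {p : Fin n → Bool} → (∀ i → p i ≡ true) → all p ≡ true
all-intro {zero}  q = refl
all-intro {suc n} q = and-intro (q zero) (all-intro (q ∘ suc))

all-elim : ∀ {p : Fin n → Bool} → all p ≡ true → ∀ i → p i ≡ true
all-elim {suc n} {p} q zero    = proj₁ (and-elim {p zero} q)
all-elim {suc n} {p} q (suc i) = all-elim (proj₂ (and-elim {p zero} q)) i

fold-keeps : ∀ {S : Set} (P : S → Set) {f : Fin n → S → S} {s} →
             (∀ i s → P s → P (f i s)) → P s → P (fold n f s)
fold-keeps {zero}  P step p = p
fold-keeps {suc n} P step p = step zero _ (fold-keeps P (step ∘ suc) p)

-- Iteration `i` establishes `Q` from any state, and the iterations after it, those of smaller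
-- index, keep it.
fold-visits : ∀ {S : Set} (Q : S → Set) {f : Fin n → S → S} {s} i →
              (∀ s → Q (f i s)) → (∀ j s → Q s → Q (f j s)) → Q (fold n f s)
fold-visits Q zero    reach keep = reach _
fold-visits Q (suc i) reach keep = keep zero _ (fold-visits Q i reach (keep ∘ suc))

-- 2-satisfiability

module Closure {n : ℕ} (E : Implications n) where

  Holds : Implications n → Fin n → Fin 2 → Fin n → Fin 2 → Set
  Holds R v s u t = R v s u t ≡ true

  private
    step : Fin n → Fin 2 → Implications n → Implications n
    step w r R v s u t = R v s u t or R v s w r and R w r u t

    -- An invariant for one pivot, in place of the usual one about paths with restricted interior:
    -- it arises at the iteration of its pivot and survives all other iterations.
    Through : Fin n → Fin 2 → Implications n → Set
    Through w r R = ∀ {v s u t} → Holds R v s w r → Holds R w r u t → Holds R v s u t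

    step-elim : ∀ w r R {v s u t} → Holds (step w r R) v s u t →
                Holds R v s u t ⊎ (Holds R v s w r × Holds R w r u t)
    step-elim w r R {v} {s} {u} {t} p with or-elim {R v s u t} p
    ... | inj₁ q = inj₁ q
    ... | inj₂ q = inj₂ (and-elim {R v s w r} q)

    step-old : ∀ w r R {v s u t} → Holds R v s u t → Holds (step w r R) v s u t
    step-old w r R p = or-introˡ p

    step-new : ∀ w r R {v s u t} → Holds R v s w r → Holds R w r u t →
               Holds (step w r R) v s u t
    step-new w r R {v} {s} {u} {t} p q = or-introʳ {a = R v s u t} (and-intro p q)

    through : ∀ w r R → Through w r (step w r R)
    through w r R p q with step-elim w r R p | step-elim w r R q
    ... | inj₁ p       | inj₁ q       = step-new w r R p q
    ... | inj₁ p       | inj₂ (_ , q) = step-new w r R p q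
    ... | inj₂ (p , _) | inj₁ q       = step-new w r R p q
    ... | inj₂ (p , _) | inj₂ (_ , q) = step-new w r R p q

    through-keeps : ∀ w r w′ r′ R → Through w r R → Through w r (step w′ r′ R)
    through-keeps w r w′ r′ R T p q with step-elim w′ r′ R p | step-elim w′ r′ R q
    ... | inj₁ p        | inj₁ q        = step-old w′ r′ R (T p q)
    ... | inj₁ p        | inj₂ (q , q′) = step-new w′ r′ R (T p q) q′
    ... | inj₂ (p , p′) | inj₁ q        = step-new w′ r′ R p (T p′ q)
    ... | inj₂ (p , _)  | inj₂ (_ , q′) = step-new w′ r′ R p q′

    R = closure E

  closure-trans : ∀ {v s w r u t} → Holds R v s w r → Holds R w r u t → Holds R v s u t
  closure-trans {w = w} {r} =
    fold-visits (Through w r) w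
      (λ S → fold-visits {n = 2} (Through w r) {f = step w} {s = S} r (through w r) (through-keeps w r w))
      (λ w′ S T → fold-keeps {n = 2} (Through w r) {f = step w′} {s = S} (through-keeps w r w′) T)

  private
    start : ∀ {v s u t} → v == u and s == t or E v s u t ≡ true → Holds R v s u t
    start {v} {s} {u} {t} p =
      fold-keeps (λ R → Holds R v s u t)
        (λ w R q → fold-keeps {n = 2} (λ R → Holds R v s u t) {f = step w} {s = R} (λ r R q → step-old w r R q) q) p

  closure-refl : ∀ {v s} → Holds R v s v s
  closure-refl {v} {s} = start {v} {s} {v} {s} (or-introˡ {a = v == v and s == s}
    (and-intro {a = v == v} (==-intro {i = v} refl) (==-intro {i = s} refl)))

  closure-⊇ : ∀ {v s u t} → Holds E v s u t → Holds R v s u t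
  closure-⊇ {v} {s} {u} {t} p = start {v} {s} {u} {t} (or-introʳ {a = v == u and s == t} p)

  -- The induction principle of the closure. Contraposition, the spreading of truth and the
  -- extraction of odd walks are all instances for a suitable `P`.
  closure-least : (P : Fin n → Fin 2 → Fin n → Fin 2 → Set) →
    (∀ {v s} → P v s v s) →
    (∀ {v s w r u t} → P v s w r → P w r u t → P v s u t) →
    (∀ {v s u t} → Holds E v s u t → P v s u t) →
    ∀ {v s u t} → Holds R v s u t → P v s u t
  closure-least P P-refl P-trans P-⊇ {v} {s} {u} {t} =
    fold-keeps (λ R → ∀ v s u t → Holds R v s u t → P v s u t)
      (λ w R below → fold-keeps {n = 2} (λ R → ∀ v s u t → Holds R v s u t → P v s u t) {f = step w} {s = R}
        (λ r R below v s u t p → enlarge w r R below v s u t (step-elim w r R p)) below)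
      base v s u t
    where
    enlarge : ∀ w r R → (∀ v s u t → Holds R v s u t → P v s u t) → ∀ v s u t →
              Holds R v s u t ⊎ (Holds R v s w r × Holds R w r u t) → P v s u t
    enlarge w r R below v s u t (inj₁ p)       = below v s u t p
    enlarge w r R below v s u t (inj₂ (p , q)) = P-trans (below v s w r p) (below w r u t q)

    base : ∀ v s u t → v == u and s == t or E v s u t ≡ true → P v s u t
    base v s u t p with or-elim {v == u and s == t} p
    ... | inj₂ q = P-⊇ q
    ... | inj₁ q with refl ← ==-elim {i = v} (proj₁ (and-elim {v == u} q))
                    | refl ← ==-elim {i = s} (proj₂ (and-elim {v == u} q)) = P-refl

flip-flip : ∀ s → flip (flip s) ≡ s
flip-flip 0F = refl
flip-flip 1F = refl

module Connected {n : ℕ} (G : Adjacency n) where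
  open Closure {n} (λ v _ u _ → G v u)

  connected-refl : ∀ {v} → connected G v v ≡ true
  connected-refl = closure-refl

  connected-step : ∀ {v u w} → connected G v u ≡ true → G u w ≡ true → connected G v w ≡ true
  connected-step p q = closure-trans {r = 0F} p (closure-⊇ q)

  connected-before : ∀ {v u w} → G v u ≡ true → connected G u w ≡ true → connected G v w ≡ true
  connected-before p q = closure-trans {r = 0F} (closure-⊇ p) q

  connected-trans : ∀ {v u w} → connected G v u ≡ true → connected G u w ≡ true →
                    connected G v w ≡ true
  connected-trans p q = closure-trans {r = 0F} p q

  connected-induction : ∀ {v} (P : Fin n → Set) → P v →
    (∀ {u w} → connected G v u ≡ true → P u → G u w ≡ true → P w) →
    ∀ {u} → connected G v u ≡ true → P u
  connected-induction {v} P base step {u} p =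
    -- Reachability from `v` is carried along with `P`, because `step` asks for it.
    proj₂ (closure-least (λ x _ y _ → (connected G v x ≡ true × P x) → (connected G v y ≡ true × P y))
      (λ q → q) (λ f g q → g (f q))
      (λ {x} {_} {y} e (c , q) → connected-step c e , step c q e) p (connected-refl {v} , base))

module TwoSat {n : ℕ} (E : Implications n)
  (contrapositive : ∀ {v s u t} → E v s u t ≡ true → E u (flip t) v (flip s) ≡ true) where

  open Closure E

  private
    R = closure E

  closure-contrapositive : ∀ {v s u t} → Holds R v s u t → Holds R u (flip t) v (flip s)
  closure-contrapositive =
    closure-least (λ v s u t → Holds R u (flip t) v (flip s))
      closure-refl (λ p q → closure-trans q p) (λ p → closure-⊇ (contrapositive p))

  Closed Consistent : Literals n → Set
  Closed A     = ∀ {v s u t} → A v s ≡ true → Holds R v s u t → A u t ≡ true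
  Consistent A = ∀ {v s} → A v s ≡ true → ¬ A v (flip s) ≡ true

  private
    Good : Literals n → Set
    Good A = Closed A × Consistent A

    Defined : Fin n → Literals n → Set
    Defined v A = A v 0F or A v 1F ≡ true

    grow : Fin n → Fin 2 → Literals n → Literals n
    grow v s A u t = A u t or R v s u t

    -- If a consequence of `(v , s)` contradicts a literal of `A`, contraposition and closedness put
    -- `(v , flip s)` into `A`. If two consequences contradict each other, contraposition of one
    -- shows that `(v , s)` implies its own negation.
    grow-good : ∀ v s A → ¬ A v (flip s) ≡ true → ¬ Holds R v s v (flip s) →
                Good A → Good (grow v s A)
    grow-good v s A unset nonbad (closed , consistent) = closed′ , consistent′
      where
      closed′ : Closed (grow v s A)
      closed′ {x} {p} {y} {q} a r with or-elim {A x p} a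
      ... | inj₁ a = or-introˡ (closed a r)
      ... | inj₂ b = or-introʳ {a = A y q} (closure-trans b r)
      clash : ∀ {x p} → A x p ≡ true → ¬ Holds R v s x (flip p)
      clash {x} {p} a r = unset (closed a
        (subst (λ q → Holds R x q v (flip s)) (flip-flip p) (closure-contrapositive r)))
      consistent′ : Consistent (grow v s A)
      consistent′ {x} {p} a b with or-elim {A x p} a | or-elim {A x (flip p)} b
      ... | inj₁ a | inj₁ b = consistent a b
      ... | inj₁ a | inj₂ b = clash a b
      ... | inj₂ a | inj₁ b = clash b (subst (Holds R v s x) (sym (flip-flip p)) a)
      ... | inj₂ a | inj₂ b = nonbad (closure-trans a
        (subst (λ q → Holds R x q v (flip s)) (flip-flip p) (closure-contrapositive b)))

    grow-defines : ∀ v s A → Defined v (grow v s A)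
    grow-defines v 0F A = or-introˡ (or-introʳ {a = A v 0F} (closure-refl {v} {0F}))
    grow-defines v 1F A =
      or-introʳ {a = grow v 1F A v 0F} (or-introʳ {a = A v 1F} (closure-refl {v} {1F}))

    grow-keeps : ∀ v s A {u} → Defined u A → Defined u (grow v s A)
    grow-keeps v s A {u} d with or-elim {A u 0F} d
    ... | inj₁ p = or-introˡ (or-introˡ p)
    ... | inj₂ p = or-introʳ {a = grow v s A u 0F} (or-introˡ p)

    body : Fin n → Literals n → Literals n
    body v A =
      ifᵇ A v 0F or A v 1F then A
      else ifᵇ neg (R v 0F v 1F) then grow v 0F A
      else ifᵇ neg (R v 1F v 0F) then grow v 1F A
      else A

    body-good : ∀ v A → Good A → Good (body v A)
    body-good v A good with A v 0F in e₀
    ... | true = good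
    ... | false with A v 1F in e₁
    ... | true = good
    ... | false with R v 0F v 1F in r₀
    ... | false = grow-good v 0F A (λ p → true≢false (trans (sym p) e₁))
                    (λ p → true≢false (trans (sym p) r₀)) good
    ... | true with R v 1F v 0F in r₁
    ... | false = grow-good v 1F A (λ p → true≢false (trans (sym p) e₀))
                    (λ p → true≢false (trans (sym p) r₁)) good
    ... | true = good

    body-defines : ∀ v A → ¬ (Holds R v 0F v 1F × Holds R v 1F v 0F) → Defined v (body v A)
    body-defines v A nonbad with A v 0F or A v 1F in e
    ... | true = e
    ... | false with R v 0F v 1F in r₀
    ... | false = grow-defines v 0F A
    ... | true with R v 1F v 0F in r₁
    ... | false = grow-defines v 1F A
    ... | true = ⊥-elim (nonbad (refl , refl))

    body-keeps : ∀ v A {u} → Defined u A → Defined u (body v A)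
    body-keeps v A d with A v 0F or A v 1F
    ... | true = d
    ... | false with R v 0F v 1F
    ... | false = grow-keeps v 0F A d
    ... | true with R v 1F v 0F
    ... | false = grow-keeps v 1F A d
    ... | true = d

    empty-closed : Closed (λ _ _ → false)
    empty-closed ()

    empty-consistent : Consistent (λ _ _ → false)
    empty-consistent ()

    good : Good (choose R)
    good = fold-keeps Good {f = body} body-good
      ((λ {v} {s} {u} {t} → empty-closed {v} {s} {u} {t}) , λ {v} {s} → empty-consistent {v} {s})

  choose-closed : Closed (choose R)
  choose-closed = proj₁ good

  choose-consistent : Consistent (choose R)
  choose-consistent = proj₂ good

  choose-defined : ∀ v → ¬ (Holds R v 0F v 1F × Holds R v 1F v 0F) →
                   choose R v 0F or choose R v 1F ≡ true
  choose-defined v nonbad =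
    fold-visits (Defined v) v (λ A → body-defines v A nonbad) (λ u A → body-keeps u A)

-- Walks, and partial colourings of whole components

data Walk {n} (G : Adjacency n) : ℕ → Fin n → Fin n → Set where
  []  : ∀ {v} → Walk G 0 v v
  _∷_ : ∀ {k v u w} → G v u ≡ true → Walk G k u w → Walk G (suc k) v w

infixr 5 _∷_ _++ʷ_

_++ʷ_ : ∀ {n} {G : Adjacency n} {k l v u w} → Walk G k v u → Walk G l u w → Walk G (k + l) v w
[]      ++ʷ q = q
(e ∷ p) ++ʷ q = e ∷ (p ++ʷ q)

flips : ℕ → Fin 2 → Fin 2
flips zero    s = s
flips (suc k) s = flips k (flip s)

flips-+ : ∀ k l s → flips (k + l) s ≡ flips l (flips k s)
flips-+ zero    l s = refl
flips-+ (suc k) l s = flips-+ k l (flip s)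

flip-other : ∀ s t → flip t ≢ s → t ≡ s
flip-other 0F 0F _ = refl
flip-other 0F 1F p = ⊥-elim (p refl)
flip-other 1F 0F p = ⊥-elim (p refl)
flip-other 1F 1F _ = refl

reversed : ∀ {n} (Γ : Graph n) {v u} → adj Γ v u ≡ true → adj Γ u v ≡ true
reversed Γ {v} {u} e = trans (symmetric Γ u v) e

module _ {n : ℕ} (Γ : Graph n) where

  private
    G = adj Γ

  conflict-contrapositive : ∀ (c : Candidates n) {v s u t} →
    conflict G c v s u t ≡ true → conflict G c u (flip t) v (flip s) ≡ true
  conflict-contrapositive c {v} {s} {u} {t} p with q , r ← and-elim {G v u} p =
    and-intro (trans (symmetric Γ u v) q)
      (==-intro (trans (sym (==-elim {i = c v s} r)) (cong (c v) (sym (flip-flip s)))))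

  -- Neighbours of coloured vertices are coloured too, so the coloured set is a union of components
  -- and a later attempt never meets an earlier colour.
  Sound : Partial n → Set
  Sound g = ∀ {v u} → proj₁ (g v) ≡ true → G v u ≡ true →
            proj₁ (g u) ≡ true × proj₂ (g v) ≢ proj₂ (g u)

  module _ (c : Candidates n) where

    open TwoSat (conflict G c) (λ {v} {s} {u} {t} → conflict-contrapositive c {v} {s} {u} {t})
    open Closure (conflict G c)
    open Connected G

    private
      A = choose (closure (conflict G c))

      colour-of : Fin n → Fin 3
      colour-of v = ifᵇ A v 0F then c v 0F else c v 1F

    solution : Literals n
    solution = A

    private
      chosen : ∀ v → A v 0F or A v 1F ≡ true → ∃[ s ] A v s ≡ true × colour-of v ≡ c v s
      chosen v p with A v 0F in e
      ... | true  = 0F , e , refl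
      ... | false = 1F , p , refl

      proper : ∀ {v u} → G v u ≡ true → A v 0F or A v 1F ≡ true → A u 0F or A u 1F ≡ true →
               colour-of v ≢ colour-of u
      proper {v} {u} e p q same with s , Avs , cv ← chosen v p | t , Aut , cu ← chosen u q =
        choose-consistent Aut
          (choose-closed Avs (closure-⊇ {v} {s} {u} {flip t} (and-intro e (==-intro
            (trans (sym cv) (trans same (trans cu (cong (c u) (sym (flip-flip t))))))))))

      self : ∀ v → assigned G A v ≡ true → A v 0F or A v 1F ≡ true
      self v p = implies-elim (all-elim p v) connected-refl

      along : ∀ {v u} → G v u ≡ true → assigned G A v ≡ true → assigned G A u ≡ true
      along {v} {u} e p = all-intro λ w → implies-intro {connected G u w}
        λ q → implies-elim (all-elim p w) (connected-before e q)

      opaque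
        unfolding attempt

        old : ∀ g {v} → proj₁ (g v) ≡ true → attempt G c g v ≡ g v
        old g {v} p with proj₁ (g v)
        old g refl | true = refl

        new : ∀ g {v} → assigned G A v ≡ true →
              attempt G c g v ≡ g v × proj₁ (g v) ≡ true ⊎
              attempt G c g v ≡ (true , colour-of v)
        new g {v} p with proj₁ (g v) | assigned G A v
        ... | true  | _    = inj₁ (refl , refl)
        ... | false | true = inj₂ refl

        cases : ∀ g {v} → proj₁ (attempt G c g v) ≡ true →
                proj₁ (g v) ≡ true ⊎ (¬ proj₁ (g v) ≡ true × assigned G A v ≡ true)
        cases g {v} p with proj₁ (g v) in e | assigned G A v
        ... | true  | _     = inj₁ refl
        ... | false | true  = inj₂ ((λ ()) , refl)
        ... | false | false = inj₁ (trans (sym e) p)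

    attempt-keeps-done : ∀ g v → proj₁ (g v) ≡ true → proj₁ (attempt G c g v) ≡ true
    attempt-keeps-done g v p = trans (cong proj₁ (old g p)) p

    attempt-done : ∀ g v → assigned G A v ≡ true → proj₁ (attempt G c g v) ≡ true
    attempt-done g v p with new g p
    ... | inj₁ (e , q) = trans (cong proj₁ e) q
    ... | inj₂ e       = cong proj₁ e

    -- Holds for arbitrary candidates: closedness and consistency of the chosen literals make the
    -- colouring proper wherever a whole component is assigned. Wrong guesses thus merely leave
    -- vertices uncoloured.
    attempt-sound : ∀ g → Sound g → Sound (attempt G c g)
    attempt-sound g sound {v} {u} d e with cases g d
    ... | inj₁ p with q , r ← sound p e =
      attempt-keeps-done g u q ,
      λ s → r (trans (cong proj₂ (sym (old g p))) (trans s (cong proj₂ (old g q))))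
    ... | inj₂ (undone , p) with new g p | new g (along e p)
    ... | inj₁ (_ , q) | _ = ⊥-elim (undone q)
    ... | inj₂ _ | inj₁ (_ , q) =
      ⊥-elim (undone (proj₁ (sound q (trans (symmetric Γ u v) e))))
    ... | inj₂ gv | inj₂ gu =
      cong proj₁ gu ,
      λ s → proper e (self v p) (self u (along e p))
              (trans (cong proj₂ (sym gv)) (trans s (cong proj₂ gu)))

    -- A proper colouring by candidates is a truth assignment on the component that all implications
    -- respect. Hence the true literal of a vertex does not imply the false one, and
    -- `choose-defined` applies.
    all-assigned : ∀ v₀ (γ : Fin n → Fin 3) →
      (∀ {v} → connected G v₀ v ≡ true → γ v ≡ c v 0F ⊎ γ v ≡ c v 1F) →
      (∀ {v u} → connected G v₀ v ≡ true → G v u ≡ true → γ v ≢ γ u) →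
      assigned G A v₀ ≡ true
    all-assigned v₀ γ candidate γ-proper =
      all-intro λ u → implies-intro {connected G v₀ u} λ p → choose-defined u (nonbad p)
      where
      Q : Fin n → Set
      Q v = connected G v₀ v ≡ true

      True : Fin n → Fin 2 → Set
      -- If both candidates equal `γ v`, only the literal with index 0 counts as true; each vertex
      -- must have exactly one true literal.
      True v s = Q v × s ≡ (ifᵇ c v 0F == γ v then 0F else 1F)

      colour-true : ∀ {v s} → True v s → c v s ≡ γ v
      colour-true {v} (q , e) with c v 0F == γ v in d
      colour-true {v} (q , refl) | true = ==-elim d
      colour-true {v} (q , refl) | false with candidate q
      ... | inj₁ p = ⊥-elim (true≢false (trans (sym (==-intro (sym p))) d))
      ... | inj₂ p = sym p

      truth-spreads : ∀ {v s u t} → closure (conflict G c) v s u t ≡ true → True v s → True u t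
      truth-spreads = closure-least (λ v s u t → True v s → True u t) (λ x → x) (λ f g x → g (f x))
        λ {v} {s} {u} {t} p x →
          let e , same = and-elim {G v u} p in
          let q = connected-step (proj₁ x) e in
          q , flip-other _ t λ f → γ-proper (proj₁ x) e
            (trans (sym (colour-true x)) (trans (==-elim {i = c v s} same) (colour-true (q , f))))

      nonbad : ∀ {u} → Q u → ¬ (closure (conflict G c) u 0F u 1F ≡ true ×
                                closure (conflict G c) u 1F u 0F ≡ true)
      nonbad {u} q (p₀ , p₁) with (ifᵇ c u 0F == γ u then 0F else 1F) in e
      ... | 0F with () ← trans (proj₂ (truth-spreads p₀ (q , sym e))) e
      ... | 1F with () ← trans (proj₂ (truth-spreads p₁ (q , sym e))) e

  -- With the same two colours everywhere, an implication along an edge flips the sign. A vertex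
  -- left unassigned has its literal 0 implying its literal 1, and the chain of implications behind
  -- this is a closed walk of odd length.
  two-colours-or-odd-walk : ∀ v₀ →
    assigned G (solution twoColours) v₀ ≡ true ⊎
    ∃[ u ] connected G v₀ u ≡ true × ∃[ k ] Walk G k u u × flips k 0F ≡ 1F
  two-colours-or-odd-walk v₀ with decide (assigned G A v₀)
    where A = solution twoColours
  ... | inj₁ p = inj₁ p
  ... | inj₂ p with decide (any λ u → neg (connected G v₀ u implies (A u 0F or A u 1F)))
    where A = solution twoColours
  ... | inj₂ q = ⊥-elim (neg-elim p (all-intro λ u → recover u (decide _)))
    where
    A = solution twoColours
    recover : ∀ u → let b = connected G v₀ u implies (A u 0F or A u 1F) in
              b ≡ true ⊎ neg b ≡ true → b ≡ true
    recover u (inj₁ r) = r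
    recover u (inj₂ r) = ⊥-elim (neg-elim q (any-intro u r))
  ... | inj₁ q with u , r ← any-elim q with decide (connected G v₀ u)
  ... | inj₂ d = ⊥-elim (neg-elim r (implies-intro {connected G v₀ u} λ e → ⊥-elim (neg-elim d e)))
  ... | inj₁ d with decide (closure (conflict G twoColours) u 0F u 1F)
  ... | inj₂ e = ⊥-elim (neg-elim r (implies-intro {connected G v₀ u}
          λ _ → choose-defined u λ (x , _) → neg-elim e x))
    where
    open TwoSat (conflict G twoColours)
      (λ {v} {s} {u} {t} → conflict-contrapositive twoColours {v} {s} {u} {t})
  ... | inj₁ e = inj₂ (u , d , closure-least
          (λ v s w t → ∃[ k ] Walk G k v w × flips k s ≡ t)
          (0 , [] , refl)
          (λ (k , p , x) (l , q , y) → k + l , p ++ʷ q ,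
             trans (flips-+ k l _) (trans (cong (flips l) x) y))
          (λ {v} {s} {w} {t} p → let e , same = and-elim {G v w} p in
             1 , e ∷ [] , opposite s t (==-elim {i = twoColours v s} same))
          e)
    where
    open Closure (conflict G twoColours)
    opposite : ∀ s t → twoColours u s ≡ twoColours u (flip t) → flip s ≡ t
    opposite 0F 1F _ = refl
    opposite 1F 0F _ = refl
    opposite 0F 0F ()
    opposite 1F 1F ()

-- Induced paths and cycles

-- If no two vertices of H have the same neighbours, a map that preserves adjacency and
-- non-adjacency is injective. So distinctness of vertices never has to be proved separately.
TwinFree : ∀ {m} → Graph m → Set
TwinFree H = ∀ i j → (∀ l → adj H i l ≡ adj H j l) → i ≡ j

twinFree? : ∀ {m} (H : Graph m) → Dec (TwinFree H)
twinFree? H = all? λ i → all? λ j → (all? λ l → adj H i l ≟ᵇ adj H j l) →-dec (i ≟ᶠ j)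

path₉-twinFree : TwinFree (path 9)
path₉-twinFree = toWitness {a? = twinFree? (path 9)} tt

cycle₃-twinFree : TwinFree (cycle 3)
cycle₃-twinFree = toWitness {a? = twinFree? (cycle 3)} tt

cycle₅-twinFree : TwinFree (cycle 5)
cycle₅-twinFree = toWitness {a? = twinFree? (cycle 5)} tt

module _ {n : ℕ} (Γ : Graph n) where

  private
    G = adj Γ

  contains : ∀ {m} (H : Graph m) → TwinFree H → (f : Fin m → Fin n) →
             (∀ i j → G (f i) (f j) ≡ adj H i j) → ContainsInduced Γ H
  contains H twinFree f same = f , injective , same
    where
    injective : Injective _≡_ _≡_ f
    injective {i} {j} e = twinFree i j λ l →
      trans (sym (same i l)) (trans (cong (λ v → G v (f l)) e) (same j l))

  contains-upper : ∀ {m} (H : Graph m) → TwinFree H → (f : Fin m → Fin n) →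
    (∀ i j → T (toℕ i <ᵇ toℕ j) → G (f i) (f j) ≡ adj H i j) → ContainsInduced Γ H
  contains-upper H twinFree f upper = contains H twinFree f same
    where
    compare : ∀ {m} (i j : Fin m) → T (toℕ i <ᵇ toℕ j) ⊎ i ≡ j ⊎ T (toℕ j <ᵇ toℕ i)
    compare zero    zero    = inj₂ (inj₁ refl)
    compare zero    (suc j) = inj₁ tt
    compare (suc i) zero    = inj₂ (inj₂ tt)
    compare (suc i) (suc j) with compare i j
    ... | inj₁ p        = inj₁ p
    ... | inj₂ (inj₁ p) = inj₂ (inj₁ (cong suc p))
    ... | inj₂ (inj₂ p) = inj₂ (inj₂ p)
    same : ∀ i j → G (f i) (f j) ≡ adj H i j
    same i j with compare i j
    ... | inj₁ p           = upper i j p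
    ... | inj₂ (inj₁ refl) = trans (irreflexive Γ (f i)) (sym (irreflexive H i))
    ... | inj₂ (inj₂ p)    =
      trans (symmetric Γ (f i) (f j)) (trans (upper j i p) (symmetric H j i))

  nonadjacent : ∀ {v u} → ¬ G v u ≡ true → G v u ≡ false
  nonadjacent p = ¬-not p

  no-closed-3 : ¬ ContainsInduced Γ (cycle 3) → ∀ v → ¬ Walk G 3 v v
  no-closed-3 free a (ab ∷ bc ∷ ca ∷ []) =
    free (contains-upper (cycle 3) cycle₃-twinFree (lookup (a ∷ _ ∷ _ ∷ [])) upper)
    where
    upper : ∀ i j → T (toℕ i <ᵇ toℕ j) → G _ _ ≡ adj (cycle 3) i j
    upper 0F 1F _ = ab
    upper 0F 2F _ = trans (symmetric Γ _ _) ca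
    upper 1F 2F _ = bc

  -- Any two non-consecutive places of a closed walk of length five have a common neighbour on it,
  -- so an edge between them would close a triangle.
  no-closed-5 : ¬ ContainsInduced Γ (cycle 3) → ¬ ContainsInduced Γ (cycle 5) →
                ∀ v → ¬ Walk G 5 v v
  no-closed-5 free₃ free₅ a (ab ∷ bc ∷ cd ∷ de ∷ ea ∷ []) =
    free₅ (contains-upper (cycle 5) cycle₅-twinFree (lookup (a ∷ _ ∷ _ ∷ _ ∷ _ ∷ [])) upper)
    where
    chord : ∀ {x y z} → G x y ≡ true → G y z ≡ true → G x z ≡ false
    chord xy yz = nonadjacent λ xz →
      no-closed-3 free₃ _ (xy ∷ yz ∷ trans (symmetric Γ _ _) xz ∷ [])
    upper : ∀ i j → T (toℕ i <ᵇ toℕ j) → G _ _ ≡ adj (cycle 5) i j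
    upper 0F 1F _ = ab
    upper 0F 2F _ = chord ab bc
    upper 0F 3F _ = trans (symmetric Γ _ _) (chord de ea)
    upper 0F 4F _ = trans (symmetric Γ _ _) ea
    upper 1F 2F _ = bc
    upper 1F 3F _ = chord bc cd
    upper 1F 4F _ = trans (symmetric Γ _ _) (chord ea ab)
    upper 2F 3F _ = cd
    upper 2F 4F _ = chord cd de
    upper 3F 4F _ = de

  Starts : Fin n → List (Fin n) → Set
  Starts v []       = ⊤
  Starts v (x ∷ xs) = G v x ≡ true × All (λ y → G v y ≡ false) xs

  InducedPath : List (Fin n) → Set
  InducedPath []       = ⊤
  InducedPath (x ∷ xs) = Starts x xs × InducedPath xs

  inducedPath-pattern : ∀ xs → InducedPath xs → ∀ i j →
    T (toℕ i <ᵇ toℕ j) → G (lookup xs i) (lookup xs j) ≡ adj (path (length xs)) i j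
  inducedPath-pattern (x ∷ y ∷ xs) ((e , _) , _) zero (suc zero)    _ = e
  inducedPath-pattern (x ∷ y ∷ xs) ((_ , a) , _) zero (suc (suc j)) _ =
    All.lookup a (∈-lookup j)
  inducedPath-pattern (x ∷ xs) (_ , p) (suc i) (suc j) lt = inducedPath-pattern xs p i j lt

  contains-path₉ : ∀ xs → length xs ≡ 9 → InducedPath xs → ContainsInduced Γ (path 9)
  contains-path₉ xs e p =
    subst (λ m → TwinFree (path m) → ContainsInduced Γ (path m)) e
      (λ t → contains-upper (path (length xs)) t (lookup xs) (inducedPath-pattern xs p))
      path₉-twinFree

  closed-reverse : ∀ {k v u} → Walk G k v u → G v u ≡ true → Walk G (suc k) u u
  closed-reverse p e = trans (symmetric Γ _ _) e ∷ p

  -- A search for certificates in a partially known graph: the known edges and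
  -- non-edges are given as pairs of positions in a list of vertices, and two
  -- vertices are also known to be non-adjacent if an edge between them would
  -- close an odd walk of a forbidden length.
  module Search (Q : Fin n → Set) (ks : List ℕ)
                (no-closed : All (λ k → ∀ v → Q v → ¬ Walk G (suc k) v v) ks)
                (d : Fin n) (vs : List (Fin n)) (inside : All Q (d ∷ vs)) where

    at : ℕ → List (Fin n) → Fin n
    at _       []       = d
    at zero    (v ∷ vs) = v
    at (suc i) (v ∷ vs) = at i vs

    h : ℕ → Fin n
    h i = at i vs

    h-inside : ∀ i → Q (h i)
    h-inside i = go i vs (All.tail inside)
      where
      go : ∀ i vs → All Q vs → Q (at i vs)
      go _       []       _        = All.head inside
      go zero    (v ∷ vs) (q ∷ qs) = q
      go (suc i) (v ∷ vs) (q ∷ qs) = go i vs qs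

    Edge NonEdge : ℕ × ℕ → Set
    Edge (i , j)    = G (h i) (h j) ≡ true
    NonEdge (i , j) = G (h i) (h j) ≡ false

    pair? : ∀ {b} {E : List (ℕ × ℕ)} → All (λ (i , j) → G (h i) (h j) ≡ b) E →
            ∀ i j → Maybe (G (h i) (h j) ≡ b)
    pair? []               i j = nothing
    pair? (_∷_ {a , b} e E) i j with a ≟ i | b ≟ j | a ≟ j | b ≟ i
    ... | yes refl | yes refl | _        | _        = just e
    ... | _        | _        | yes refl | yes refl = just (trans (symmetric Γ _ _) e)
    ... | _        | _        | _        | _        = pair? E i j

    module _ {E N : List (ℕ × ℕ)} (edges : All Edge E) (nonEdges : All NonEdge N) where

      walk? : ∀ k i j → Maybe (Walk G k (h i) (h j))
      walk? zero i j with i ≟ j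
      ... | yes refl = just []
      ... | no _     = nothing
      walk? (suc k) i j = go edges
        where
        go : ∀ {E} → All Edge E → Maybe (Walk G (suc k) (h i) (h j))
        go []                = nothing
        go (_∷_ {a , b} e E) with a ≟ i | b ≟ i
        ... | yes refl | _        = Maybe.map (e ∷_) (walk? k b j) <∣> go E
        ... | no _     | yes refl =
          Maybe.map (trans (symmetric Γ _ _) e ∷_) (walk? k a j) <∣> go E
        ... | no _     | no _     = go E

      -- An entry `k` of `ks` stands for the forbidden length `suc k`: a known walk of length `k`
      -- from `i` to `j` leaves no room for an edge.
      apart? : ∀ i j → Maybe (G (h i) (h j) ≡ false)
      apart? i j = pair? nonEdges i j <∣> go no-closed
        where
        go : ∀ {ks} → All (λ k → ∀ v → Q v → ¬ Walk G (suc k) v v) ks →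
             Maybe (G (h i) (h j) ≡ false)
        go []                = nothing
        go (_∷_ {k} none rest) =
          Maybe.map (λ p → nonadjacent λ e → none (h j) (h-inside j) (closed-reverse p e)) (walk? k i j)
          <∣> go rest

      all-apart? : ∀ i js → Maybe (All (λ y → G (h i) y ≡ false) (map h js))
      all-apart? i []       = just []
      all-apart? i (j ∷ js) = zipWith _∷_ (apart? i j) (all-apart? i js)

      path? : ∀ is → Maybe (InducedPath (map h is))
      path? []           = just tt
      path? (i ∷ [])     = just (tt , tt)
      path? (i ∷ j ∷ is) =
        zipWith _,_ (zipWith _,_ (pair? edges i j) (all-apart? i is)) (path? (j ∷ is))

      closed? : ∀ i → Maybe ⊥
      closed? i = go no-closed
        where
        go : ∀ {ks} → All (λ k → ∀ v → Q v → ¬ Walk G (suc k) v v) ks → Maybe ⊥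
        go []               = nothing
        go (_∷_ {k} none rest) = Maybe.map (none (h i) (h-inside i)) (walk? (suc k) i i) <∣> go rest

      oddly-closed : ∀ i {_ : T (is-just (closed? i))} → ⊥
      oddly-closed i {t} = to-witness-T (closed? i) t

      -- The hidden argument is discharged by running the search, which inspects only numerical
      -- positions; the vertices themselves may stay variables.
      nine-path : ¬ ContainsInduced Γ (path 9) → ∀ is → length (map h is) ≡ 9 →
                  {_ : T (is-just (path? is))} → ⊥
      nine-path free is e {t} = free (contains-path₉ (map h is) e (to-witness-T (path? is) t))

-- Cycles up to rotation

module Rotation {n m : ℕ} (G : Adjacency n) (after : Fin m → Fin m) where

  -- Only consecutive adjacencies are recorded. In a ring of length 7 a chord would close a walk of
  -- length 3 or 5, and in one of length 9 a walk of length 3, 5 or 7.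
  Ring : (Fin m → Fin n) → Set
  Ring c = ∀ i → G (c i) (c (after i)) ≡ true

  rotate : ℕ → Fin m → Fin m
  rotate zero    i = i
  rotate (suc k) i = after (rotate k i)

  rotate-next : ∀ k i → rotate k (after i) ≡ after (rotate k i)
  rotate-next zero    i = refl
  rotate-next (suc k) i = cong after (rotate-next k i)

  rotate-ring : ∀ {c} → Ring c → ∀ k → Ring (c ∘ rotate k)
  rotate-ring {c} ring k i =
    subst (λ j → G (c (rotate k i)) (c j) ≡ true) (sym (rotate-next k i)) (ring (rotate k i))

-- Graphs with an induced cycle of length seven

next : Fin 7 → Fin 7
next 0F = 1F
next 1F = 2F
next 2F = 3F
next 3F = 4F
next 4F = 5F
next 5F = 6F
next 6F = 0F

module SevenCycle {n : ℕ} (Γ : Graph n)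
  (free₉ : ¬ ContainsInduced Γ (path 9))
  (none₃ : ∀ v → ¬ Walk (adj Γ) 3 v v)
  (none₅ : ∀ v → ¬ Walk (adj Γ) 5 v v) where

  private
    G = adj Γ
    V = Fin n

  open Rotation G next public

  Far Near : (Fin 7 → V) → V → Set
  Far c x  = ∀ i → G x (c i) ≡ false
  Near c v = ∃[ i ] G v (c i) ≡ true

  rotation-to : ∀ j → ∃[ k ] rotate k 0F ≡ j
  rotation-to 0F = 0 , refl
  rotation-to 1F = 1 , refl
  rotation-to 2F = 2 , refl
  rotation-to 3F = 3 , refl
  rotation-to 4F = 4 , refl
  rotation-to 5F = 5 , refl
  rotation-to 6F = 6 , refl

  rotation-back : ∀ k i → ∃[ j ] rotate k j ≡ i
  rotation-back zero    i = i , refl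
  rotation-back (suc k) i with j , e ← rotation-back k i =
    next⁶ j , trans (sym (rotate-next k (next⁶ j))) (trans (cong (rotate k) (next⁷ j)) e)
    where
    next⁶ : Fin 7 → Fin 7
    next⁶ j = next (next (next (next (next (next j)))))
    next⁷ : ∀ j → next (next⁶ j) ≡ j
    next⁷ 0F = refl
    next⁷ 1F = refl
    next⁷ 2F = refl
    next⁷ 3F = refl
    next⁷ 4F = refl
    next⁷ 5F = refl
    next⁷ 6F = refl

  module Points (c : Fin 7 → V) (ring : Ring c) (vs : List V) where

    open Search Γ (λ _ → ⊤) (2 ∷ 4 ∷ []) ((λ v _ → none₃ v) ∷ (λ v _ → none₅ v) ∷ [])
      (c 0F) (c 0F ∷ c 1F ∷ c 2F ∷ c 3F ∷ c 4F ∷ c 5F ∷ c 6F ∷ vs)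
      (All.universal (λ _ → tt) _) public

    ring-edges : All Edge ((0 , 1) ∷ (1 , 2) ∷ (2 , 3) ∷ (3 , 4) ∷ (4 , 5) ∷ (5 , 6) ∷ (6 , 0) ∷ [])
    ring-edges = ring 0F ∷ ring 1F ∷ ring 2F ∷ ring 3F ∷ ring 4F ∷ ring 5F ∷ ring 6F ∷ []

    far : ∀ p → Far c (h p) →
      All NonEdge ((p , 0) ∷ (p , 1) ∷ (p , 2) ∷ (p , 3) ∷ (p , 4) ∷ (p , 5) ∷ (p , 6) ∷ [])
    far p f = f 0F ∷ f 1F ∷ f 2F ∷ f 3F ∷ f 4F ∷ f 5F ∷ f 6F ∷ []

  module _ {c : Fin 7 → V} (ring : Ring c) {v x y : V}
           (xv : G x v ≡ true) (yx : G y x ≡ true) (fx : Far c x) (fy : Far c y) where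

    open Points c ring (v ∷ x ∷ y ∷ [])

    -- Short odd walks leave `c 2F` and `c 5F` as the only possible further neighbours of `v` on the
    -- cycle. With neither of them, y x v followed by the vertices 0 to 5 of the cycle would be an
    -- induced P₉. So `v` is attached like a copy of a vertex of the cycle.
    clone₀ : G v (c 0F) ≡ true → G v (c 2F) ≡ true ⊎ G v (c 5F) ≡ true
    clone₀ v0 with G v (c 2F) in e₂ | G v (c 5F) in e₅
    ... | true  | _     = inj₁ refl
    ... | false | true  = inj₂ refl
    ... | false | false = ⊥-elim (nine-path
      (++⁺ ring-edges (_∷_ {x = 7 , 0} v0 (_∷_ {x = 8 , 7} xv (_∷_ {x = 9 , 8} yx []))))
      (_∷_ {x = 7 , 2} e₂ (_∷_ {x = 7 , 5} e₅ (++⁺ (far 8 fx) (far 9 fy))))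
      free₉ (9 ∷ 8 ∷ 7 ∷ 0 ∷ 1 ∷ 2 ∷ 3 ∷ 4 ∷ 5 ∷ []) refl)

  clone : ∀ {c} → Ring c → ∀ {v x y} → G x v ≡ true → G y x ≡ true → Far c x → Far c y →
          Near c v → ∃[ i ] G v (c i) ≡ true × G v (c (next (next i))) ≡ true
  clone {c} ring {v} xv yx fx fy (j , e) with k , refl ← rotation-to j
    with clone₀ {c ∘ rotate k} (rotate-ring ring k) xv yx (λ i → fx _) (λ i → fy _) e
  ... | inj₁ p = rotate k 0F , e , subst (λ i → G v (c i) ≡ true) r p
    where
    r : rotate k 2F ≡ next (next (rotate k 0F))
    r = trans (rotate-next k 1F) (cong next (rotate-next k 0F))
  ... | inj₂ p = rotate k 5F , p , subst (λ i → G v (c i) ≡ true) r e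
    where
    r : rotate k 0F ≡ next (next (rotate k 5F))
    r = trans (rotate-next k 6F) (cong next (rotate-next k 5F))

  module _ {c : Fin 7 → V} (ring : Ring c) {v x y z : V}
           (xv : G x v ≡ true) (yx : G y x ≡ true) (zy : G z y ≡ true)
           (fx : Far c x) (fy : Far c y) (fz : Far c z) where

    -- Otherwise z y x v followed by the vertices 2 to 6 of the cycle is an induced P₉.
    mates₀ : G v (c 0F) ≡ true → G v (c 2F) ≡ true → G z v ≡ true
    mates₀ v0 v2 with G z v in e
    ... | true  = refl
    ... | false = ⊥-elim (nine-path
      (++⁺ ring-edges (_∷_ {x = 7 , 0} v0 (_∷_ {x = 7 , 2} v2
        (_∷_ {x = 8 , 7} xv (_∷_ {x = 9 , 8} yx (_∷_ {x = 10 , 9} zy []))))))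
      (_∷_ {x = 10 , 7} e (++⁺ (far 8 fx) (++⁺ (far 9 fy) (far 10 fz))))
      free₉ (10 ∷ 9 ∷ 8 ∷ 7 ∷ 2 ∷ 3 ∷ 4 ∷ 5 ∷ 6 ∷ []) refl)
      where open Points c ring (v ∷ x ∷ y ∷ z ∷ [])

  -- Far vertices with a common far neighbour have the same neighbours near the cycle. What is read
  -- off one far edge therefore persists along all walks of far vertices.
  mates : ∀ {c} → Ring c → ∀ {v x y z} → G x v ≡ true → G y x ≡ true → G z y ≡ true →
          Far c x → Far c y → Far c z → Near c v → G z v ≡ true
  mates {c} ring {v} xv yx zy fx fy fz near with i , p , q ← clone ring xv yx fx fy near
    with k , refl ← rotation-to i =
    mates₀ {c ∘ rotate k} (rotate-ring ring k) xv yx zy (λ _ → fx _) (λ _ → fy _) (λ _ → fz _)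
      p (subst (λ i → G v (c i) ≡ true)
           (sym (trans (rotate-next k 1F) (cong next (rotate-next k 0F)))) q)

  -- The edge between x and y folds onto an edge of the cycle.
  Folds : (Fin 7 → V) → V → V → Set
  Folds c x y = ∃[ i ] ∃[ j ] G (c i) (c j) ≡ true ×
    (∀ {u} → G x u ≡ true → Near c u → G u (c i) ≡ true) ×
    (∀ {u} → G y u ≡ true → Near c u → G u (c j) ≡ true)

  module _ {c : Fin 7 → V} (ring : Ring c) {v x y : V}
           (xv : G x v ≡ true) (yx : G y x ≡ true) (fx : Far c x) (fy : Far c y)
           (v0 : G v (c 0F) ≡ true) (v2 : G v (c 2F) ≡ true) where

    private
      module Clash (w u : V) where
        open Points c ring (v ∷ x ∷ y ∷ w ∷ u ∷ []) public

        base : All Edge _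
        base = ++⁺ ring-edges
          (_∷_ {x = 7 , 0} v0 (_∷_ {x = 7 , 2} v2 (_∷_ {x = 8 , 7} xv (_∷_ {x = 9 , 8} yx []))))

        clash : ∀ E (es : All Edge E) {_ : T (is-just (closed? (++⁺ base es) [] 11))} →
                ∀ {A : Set} → A
        -- Position 11 is `u`, the vertex whose attachment is to be refuted; the search finds a
        -- closed walk of length 3 or 5 through it.
        clash E es {t} = ⊥-elim (oddly-closed (++⁺ base es) [] 11 {t})

      Toward : V → Fin 7 → Set
      Toward z k = ∀ {u} → G z u ≡ true → Near c u → G u (c k) ≡ true

      cases : ∀ {k u} → (∀ i → G u (c i) ≡ true → G u (c (next (next i))) ≡ true →
                         G u (c k) ≡ true) →
              ∃[ i ] G u (c i) ≡ true × G u (c (next (next i))) ≡ true → G u (c k) ≡ true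
      cases f (i , p , q) = f i p q

      xy = reversed Γ yx

      x-to-0 : ∀ {w} → G y w ≡ true → G w (c 4F) ≡ true → Toward x 0F
      x-to-0 {w} zw wj {u} zu near =
        cases {k = 0F} go (clone ring zu yx fx fy near)
        where
        open Clash w u
        go : ∀ i → G u (c i) ≡ true → G u (c (next (next i))) ≡ true → G u (c 0F) ≡ true
        go 0F p q = p
        go 1F p q = clash ((8 , 11) ∷ (11 , 1) ∷ (11 , 3) ∷ (9 , 10) ∷ (10 , 4) ∷ [])
                   (zu ∷ p ∷ q ∷ zw ∷ wj ∷ [])
        go 2F p q = clash ((8 , 11) ∷ (11 , 2) ∷ (11 , 4) ∷ (9 , 10) ∷ (10 , 4) ∷ [])
                   (zu ∷ p ∷ q ∷ zw ∷ wj ∷ [])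
        go 3F p q = clash ((8 , 11) ∷ (11 , 3) ∷ (11 , 5) ∷ (9 , 10) ∷ (10 , 4) ∷ [])
                   (zu ∷ p ∷ q ∷ zw ∷ wj ∷ [])
        go 4F p q = clash ((8 , 11) ∷ (11 , 4) ∷ (11 , 6) ∷ (9 , 10) ∷ (10 , 4) ∷ [])
                   (zu ∷ p ∷ q ∷ zw ∷ wj ∷ [])
        go 5F p q = q
        go 6F p q = clash ((8 , 11) ∷ (11 , 6) ∷ (11 , 1) ∷ (9 , 10) ∷ (10 , 4) ∷ [])
                   (zu ∷ p ∷ q ∷ zw ∷ wj ∷ [])

      y-to-6 : ∀ {w} → G y w ≡ true → G w (c 4F) ≡ true → Toward y 6F
      y-to-6 {w} zw wj {u} zu near =
        cases {k = 6F} go (clone ring zu xy fy fx near)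
        where
        open Clash w u
        go : ∀ i → G u (c i) ≡ true → G u (c (next (next i))) ≡ true → G u (c 6F) ≡ true
        go 0F p q = clash ((9 , 11) ∷ (11 , 0) ∷ (11 , 2) ∷ (9 , 10) ∷ (10 , 4) ∷ [])
                   (zu ∷ p ∷ q ∷ zw ∷ wj ∷ [])
        go 1F p q = clash ((9 , 11) ∷ (11 , 1) ∷ (11 , 3) ∷ (9 , 10) ∷ (10 , 4) ∷ [])
                   (zu ∷ p ∷ q ∷ zw ∷ wj ∷ [])
        go 2F p q = clash ((9 , 11) ∷ (11 , 2) ∷ (11 , 4) ∷ (9 , 10) ∷ (10 , 4) ∷ [])
                   (zu ∷ p ∷ q ∷ zw ∷ wj ∷ [])
        go 3F p q = clash ((9 , 11) ∷ (11 , 3) ∷ (11 , 5) ∷ (9 , 10) ∷ (10 , 4) ∷ [])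
                   (zu ∷ p ∷ q ∷ zw ∷ wj ∷ [])
        go 4F p q = q
        go 5F p q = clash ((9 , 11) ∷ (11 , 5) ∷ (11 , 0) ∷ (9 , 10) ∷ (10 , 4) ∷ [])
                   (zu ∷ p ∷ q ∷ zw ∷ wj ∷ [])
        go 6F p q = p

      x-to-2 : ∀ {w} → G y w ≡ true → G w (c 5F) ≡ true → Toward x 2F
      x-to-2 {w} zw wj {u} zu near =
        cases {k = 2F} go (clone ring zu yx fx fy near)
        where
        open Clash w u
        go : ∀ i → G u (c i) ≡ true → G u (c (next (next i))) ≡ true → G u (c 2F) ≡ true
        go 0F p q = q
        go 1F p q = clash ((8 , 11) ∷ (11 , 1) ∷ (11 , 3) ∷ (9 , 10) ∷ (10 , 5) ∷ [])
                   (zu ∷ p ∷ q ∷ zw ∷ wj ∷ [])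
        go 2F p q = p
        go 3F p q = clash ((8 , 11) ∷ (11 , 3) ∷ (11 , 5) ∷ (9 , 10) ∷ (10 , 5) ∷ [])
                   (zu ∷ p ∷ q ∷ zw ∷ wj ∷ [])
        go 4F p q = clash ((8 , 11) ∷ (11 , 4) ∷ (11 , 6) ∷ (9 , 10) ∷ (10 , 5) ∷ [])
                   (zu ∷ p ∷ q ∷ zw ∷ wj ∷ [])
        go 5F p q = clash ((8 , 11) ∷ (11 , 5) ∷ (11 , 0) ∷ (9 , 10) ∷ (10 , 5) ∷ [])
                   (zu ∷ p ∷ q ∷ zw ∷ wj ∷ [])
        go 6F p q = clash ((8 , 11) ∷ (11 , 6) ∷ (11 , 1) ∷ (9 , 10) ∷ (10 , 5) ∷ [])
                   (zu ∷ p ∷ q ∷ zw ∷ wj ∷ [])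

      y-to-3 : ∀ {w} → G y w ≡ true → G w (c 5F) ≡ true → Toward y 3F
      y-to-3 {w} zw wj {u} zu near =
        cases {k = 3F} go (clone ring zu xy fy fx near)
        where
        open Clash w u
        go : ∀ i → G u (c i) ≡ true → G u (c (next (next i))) ≡ true → G u (c 3F) ≡ true
        go 0F p q = clash ((9 , 11) ∷ (11 , 0) ∷ (11 , 2) ∷ (9 , 10) ∷ (10 , 5) ∷ [])
                   (zu ∷ p ∷ q ∷ zw ∷ wj ∷ [])
        go 1F p q = q
        go 2F p q = clash ((9 , 11) ∷ (11 , 2) ∷ (11 , 4) ∷ (9 , 10) ∷ (10 , 5) ∷ [])
                   (zu ∷ p ∷ q ∷ zw ∷ wj ∷ [])
        go 3F p q = p
        go 4F p q = clash ((9 , 11) ∷ (11 , 4) ∷ (11 , 6) ∷ (9 , 10) ∷ (10 , 5) ∷ [])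
                   (zu ∷ p ∷ q ∷ zw ∷ wj ∷ [])
        go 5F p q = clash ((9 , 11) ∷ (11 , 5) ∷ (11 , 0) ∷ (9 , 10) ∷ (10 , 5) ∷ [])
                   (zu ∷ p ∷ q ∷ zw ∷ wj ∷ [])
        go 6F p q = clash ((9 , 11) ∷ (11 , 6) ∷ (11 , 1) ∷ (9 , 10) ∷ (10 , 5) ∷ [])
                   (zu ∷ p ∷ q ∷ zw ∷ wj ∷ [])

      y-to-1 : (∀ {u} → G y u ≡ true → Near c u → ¬ G u (c 4F) ≡ true) →
               (∀ {u} → G y u ≡ true → Near c u → ¬ G u (c 5F) ≡ true) → Toward y 1F
      y-to-1 no4 no5 {u} zu near =
        cases {k = 1F} go (clone ring zu xy fy fx near)
        where
        open Clash v u
        go : ∀ i → G u (c i) ≡ true → G u (c (next (next i))) ≡ true → G u (c 1F) ≡ true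
        go 0F p q = clash ((9 , 11) ∷ (11 , 0) ∷ (11 , 2) ∷ [])
                   (zu ∷ p ∷ q ∷ [])
        go 1F p q = p
        go 2F p q = ⊥-elim (no4 zu near q)
        go 3F p q = ⊥-elim (no5 zu near q)
        go 4F p q = ⊥-elim (no4 zu near p)
        go 5F p q = ⊥-elim (no5 zu near p)
        go 6F p q = q

      x-to-0′ : ∀ {w} → G x w ≡ true → G w (c 5F) ≡ true → Toward x 0F
      x-to-0′ {w} zw wj {u} zu near =
        cases {k = 0F} go (clone ring zu yx fx fy near)
        where
        open Clash w u
        go : ∀ i → G u (c i) ≡ true → G u (c (next (next i))) ≡ true → G u (c 0F) ≡ true
        go 0F p q = p
        go 1F p q = clash ((8 , 11) ∷ (11 , 1) ∷ (11 , 3) ∷ (8 , 10) ∷ (10 , 5) ∷ [])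
                   (zu ∷ p ∷ q ∷ zw ∷ wj ∷ [])
        go 2F p q = clash ((8 , 11) ∷ (11 , 2) ∷ (11 , 4) ∷ (8 , 10) ∷ (10 , 5) ∷ [])
                   (zu ∷ p ∷ q ∷ zw ∷ wj ∷ [])
        go 3F p q = clash ((8 , 11) ∷ (11 , 3) ∷ (11 , 5) ∷ (8 , 10) ∷ (10 , 5) ∷ [])
                   (zu ∷ p ∷ q ∷ zw ∷ wj ∷ [])
        go 4F p q = clash ((8 , 11) ∷ (11 , 4) ∷ (11 , 6) ∷ (8 , 10) ∷ (10 , 5) ∷ [])
                   (zu ∷ p ∷ q ∷ zw ∷ wj ∷ [])
        go 5F p q = q
        go 6F p q = clash ((8 , 11) ∷ (11 , 6) ∷ (11 , 1) ∷ (8 , 10) ∷ (10 , 5) ∷ [])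
                   (zu ∷ p ∷ q ∷ zw ∷ wj ∷ [])

      x-to-2′ : (∀ {u} → G x u ≡ true → Near c u → ¬ G u (c 5F) ≡ true) → Toward x 2F
      x-to-2′ no5 {u} zu near =
        cases {k = 2F} go (clone ring zu yx fx fy near)
        where
        open Clash v u
        go : ∀ i → G u (c i) ≡ true → G u (c (next (next i))) ≡ true → G u (c 2F) ≡ true
        go 0F p q = q
        go 1F p q = clash ((8 , 11) ∷ (11 , 1) ∷ (11 , 3) ∷ [])
                   (zu ∷ p ∷ q ∷ [])
        go 2F p q = p
        go 3F p q = ⊥-elim (no5 zu near q)
        go 4F p q = clash ((8 , 11) ∷ (11 , 4) ∷ (11 , 6) ∷ [])
                   (zu ∷ p ∷ q ∷ [])
        go 5F p q = ⊥-elim (no5 zu near p)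
        go 6F p q = clash ((8 , 11) ∷ (11 , 6) ∷ (11 , 1) ∷ [])
                   (zu ∷ p ∷ q ∷ [])

      meets? : ∀ z k → (∃[ w ] G z w ≡ true × G w (c k) ≡ true) ⊎
                       (∀ {u} → G z u ≡ true → Near c u → ¬ G u (c k) ≡ true)
      meets? z k with decide (any λ w → G z w and G w (c k))
      ... | inj₁ p with w , q ← any-elim p = inj₁ (w , and-elim q)
      ... | inj₂ p = inj₂ λ {u} e _ f → neg-elim p (any-intro u (and-intro e f))

    -- As `v` is attached at 0 and 2, x must fold to one of these. Whether a neighbour of y is
    -- attached at 4 or 5, or else one of x at 5, decides which, and where y goes. Every other
    -- attachment of a neighbour `u` is either excluded by the case or closes a walk of length 3 or
    -- 5 through `u`.
    folds₀ : Folds c x y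
    folds₀ with meets? y 4F
    ... | inj₁ (_ , p , q) = 0F , 6F , reversed Γ (ring 6F) , x-to-0 p q , y-to-6 p q
    ... | inj₂ no4 with meets? y 5F
    ... | inj₁ (_ , p , q) = 2F , 3F , ring 2F , x-to-2 p q , y-to-3 p q
    ... | inj₂ no5 with meets? x 5F
    ... | inj₁ (_ , p , q) = 0F , 1F , ring 0F , x-to-0′ p q , y-to-1 no4 no5
    ... | inj₂ no5′        = 2F , 1F , reversed Γ (ring 1F) , x-to-2′ no5′ , y-to-1 no4 no5

  folds : ∀ {c} → Ring c → ∀ {v x y} → G x v ≡ true → Near c v → G y x ≡ true →
          Far c x → Far c y → Folds c x y
  folds {c} ring {v} xv near yx fx fy with i , p , q ← clone ring xv yx fx fy near
    with k , refl ← rotation-to i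
    with j₁ , j₂ , e , tx , ty ← folds₀ {c ∘ rotate k} (rotate-ring ring k) xv yx
      (λ _ → fx _) (λ _ → fy _) p
      (subst (λ i → G v (c i) ≡ true)
        (sym (trans (rotate-next k 1F) (cong next (rotate-next k 0F)))) q) =
    rotate k j₁ , rotate k j₂ , e , (λ xu near → tx xu (turned near)) , λ yu near → ty yu (turned near)
    where
    turned : ∀ {u} → Near c u → Near (c ∘ rotate k) u
    turned (i , e) with j , refl ← rotation-back k i = j , e

-- Odd walks and induced cycles of length nine

next₉ : Fin 9 → Fin 9
next₉ 0F = 1F
next₉ 1F = 2F
next₉ 2F = 3F
next₉ 3F = 4F
next₉ 4F = 5F
next₉ 5F = 6F
next₉ 6F = 7F
next₉ 7F = 8F
next₉ 8F = 0F

module _ {n : ℕ} (Γ : Graph n) where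

  private
    G = adj Γ
    V = Fin n

  connected-walk : ∀ {v₀ k u w} → connected G v₀ u ≡ true → Walk G k u w → connected G v₀ w ≡ true
  connected-walk q []      = q
  connected-walk q (e ∷ p) = connected-walk (Connected.connected-step G q e) p

  connected-sym : ∀ {v u} → connected G v u ≡ true → connected G u v ≡ true
  connected-sym {v} =
    Connected.connected-induction G (λ u → connected G u v ≡ true)
      (Connected.connected-refl G) (λ _ p e → Connected.connected-before G (reversed Γ e) p)

  closed-walk? : ∀ k v u → Walk G k v u ⊎ ¬ Walk G k v u
  closed-walk? zero v u with decide (v == u)
  ... | inj₁ p with refl ← ==-elim {i = v} p = inj₁ []
  ... | inj₂ p = inj₂ λ { [] → neg-elim p (==-intro {i = v} refl) }
  closed-walk? (suc k) v u = result (search _)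
    where
    search : ∀ {m} (f : Fin m → V) →
      (∃[ i ] G v (f i) ≡ true × Walk G k (f i) u) ⊎ (∀ i → G v (f i) ≡ true → ¬ Walk G k (f i) u)
    search {zero}  f = inj₂ λ ()
    search {suc m} f with G v (f zero) in e | closed-walk? k (f zero) u | search (f ∘ suc)
    ... | _     | _      | inj₁ (i , r) = inj₁ (suc i , r)
    ... | true  | inj₁ p | inj₂ _       = inj₁ (zero , e , p)
    ... | true  | inj₂ p | inj₂ r       = inj₂ λ { zero _ → p ; (suc i) → r i }
    ... | false | _      | inj₂ r       = inj₂ λ { zero e′ _ → ⊥-elim (true≢false (trans (sym e′) e)) ; (suc i) → r i }
    result : (∃[ i ] G v i ≡ true × Walk G k i u) ⊎ (∀ i → G v i ≡ true → ¬ Walk G k i u) →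
             Walk G (suc k) v u ⊎ ¬ Walk G (suc k) v u
    result (inj₁ (i , e , p)) = inj₁ (e ∷ p)
    result (inj₂ none)        = inj₂ λ { (e ∷ p) → none _ e p }

  vertices : ∀ {k u w} → Walk G k u w → List V
  vertices {u = u} []      = u ∷ []
  vertices {u = u} (_ ∷ p) = u ∷ vertices p

  length-vertices : ∀ {k u w} (p : Walk G k u w) → length (vertices p) ≡ suc k
  length-vertices []      = refl
  length-vertices (_ ∷ p) = cong suc (length-vertices p)

  neighbour-on : ∀ v {k u w} (p : Walk G k u w) →
    All (λ y → G v y ≡ false) (vertices p) ⊎
    ∃[ y ] ∃[ b ] ∃[ c ] G v y ≡ true × Walk G b u y × Walk G c y w × b + c ≡ k
  neighbour-on v {u = u} p with G v u in e
  neighbour-on v {k} {u} p  | true = inj₂ (u , 0 , k , e , [] , p , refl)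
  neighbour-on v         [] | false = inj₁ (e ∷ [])
  neighbour-on v    (e′ ∷ p) | false with neighbour-on v p
  ... | inj₁ none = inj₁ (e ∷ none)
  ... | inj₂ (y , b , c , vy , q , r , refl) = inj₂ (y , suc b , c , vy , e′ ∷ q , r , refl)

  -- The piece between `x` and `y` has length at least two, so the chord is strictly shorter than
  -- the piece that it replaces.
  Shortcut : ℕ → V → V → Set
  Shortcut k u w = ∃[ x ] ∃[ y ] ∃[ a ] ∃[ b ] ∃[ c ]
    Walk G a u x × Walk G (2 + b) x y × Walk G c y w × G x y ≡ true × a + (2 + b) + c ≡ k

  induced-or-shortcut : ∀ {k u w} (p : Walk G k u w) →
                        InducedPath Γ (vertices p) ⊎ Shortcut k u w
  induced-or-shortcut [] = inj₁ (tt , tt)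
  induced-or-shortcut (e ∷ []) = inj₁ ((e , []) , tt , tt)
  induced-or-shortcut {u = u} (e ∷ e′ ∷ p) with induced-or-shortcut (e′ ∷ p) | neighbour-on u p
  ... | inj₂ (x , y , a , b , c , p₁ , p₂ , p₃ , xy , l) | _ =
    inj₂ (x , y , suc a , b , c , e ∷ p₁ , p₂ , p₃ , xy , cong suc l)
  ... | inj₁ _ | inj₂ (y , b , c , uy , q , r , refl) =
    inj₂ (u , y , 0 , b , c , [] , e ∷ e′ ∷ q , r , uy , refl)
  ... | inj₁ induced | inj₁ none = inj₁ ((e , none) , induced)

  module _ (free₉ : ¬ ContainsInduced Γ (path 9))
           (none₃ : ∀ v → ¬ Walk G 3 v v) (none₅ : ∀ v → ¬ Walk G 5 v v) (v₀ : V) where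

    private
      Q : V → Set
      Q v = connected G v₀ v ≡ true

    ClosedIn : ℕ → Set
    ClosedIn k = ∃[ v ] Q v × Walk G k v v

    -- A chord of the first nine vertices splits an odd closed walk into two closed
    -- walks, one of which is odd; both are shorter if the length exceeds nine.
    short-odd-walk : ∀ k → flips k 0F ≡ 1F → ClosedIn k → ClosedIn 7 ⊎ ClosedIn 9
    short-odd-walk = <-rec _ shorten
      where
      shorten : ∀ k → (∀ {l} → l < k → flips l 0F ≡ 1F → ClosedIn l → ClosedIn 7 ⊎ ClosedIn 9) →
                flips k 0F ≡ 1F → ClosedIn k → ClosedIn 7 ⊎ ClosedIn 9
      shorten 1 _ _ (v , _ , e ∷ []) with () ← trans (sym e) (irreflexive Γ v)
      shorten 3 _ _ (v , _ , p) = ⊥-elim (none₃ v p)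
      shorten 5 _ _ (v , _ , p) = ⊥-elim (none₅ v p)
      shorten 7 _ _ closed = inj₁ closed
      shorten 9 _ _ closed = inj₂ closed
      shorten (suc (suc (suc (suc (suc (suc (suc (suc (suc (suc r))))))))))
        rec odd (v , q , e₁ ∷ e₂ ∷ e₃ ∷ e₄ ∷ e₅ ∷ e₆ ∷ e₇ ∷ e₈ ∷ rest)
        with induced-or-shortcut (e₁ ∷ e₂ ∷ e₃ ∷ e₄ ∷ e₅ ∷ e₆ ∷ e₇ ∷ e₈ ∷ [])
      ... | inj₁ induced = ⊥-elim (free₉ (contains-path₉ Γ _ refl induced))
      ... | inj₂ (x , y , a , b , c , p₁ , p₂ , p₃ , xy , e) with flips (2 + b + 1) 0F in parity
      ... | 1F = rec
        (s≤s (≤-trans (≤-trans (≤-reflexive (sum₁ b)) (s≤s (≤-trans (m≤n+m (2 + b) a)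
          (≤-trans (m≤m+n (a + (2 + b)) c) (≤-reflexive e))))) (m≤m+n 9 r)))
        parity (x , connected-walk q p₁ , p₂ ++ʷ (reversed Γ xy ∷ []))
        where
        sum₁ : ∀ b → 2 + b + 1 ≡ suc (2 + b)
        sum₁ b = trans (+-suc (2 + b) 0) (cong suc (+-identityʳ (2 + b)))
      ... | 0F = rec
        (≤-trans (≤-trans (m≤m+n _ b) (≤-reflexive (sum₂ a b c r))) (≤-reflexive (cong (_+ (2 + r)) e)))
        (trans (sym (trans (flips-+ (2 + b + 1) (a + (1 + (c + (2 + r)))) 0F)
                      (cong (flips (a + (1 + (c + (2 + r))))) parity)))
          (trans (cong (λ k → flips k 0F) (trans (sum₃ a b c r) (cong (λ s → 2 + (s + (2 + r))) e)))
            odd))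
        (v , q , p₁ ++ʷ (xy ∷ (p₃ ++ʷ rest)))
        where
        open +-*-Solver
        sum₂ : ∀ a b c r → suc (a + (1 + (c + (2 + r)))) + b ≡ a + (2 + b) + c + (2 + r)
        sum₂ = solve 4 (λ a b c r → con 1 :+ (a :+ (con 1 :+ (c :+ (con 2 :+ r)))) :+ b :=
                                    a :+ (con 2 :+ b) :+ c :+ (con 2 :+ r)) refl
        sum₃ : ∀ a b c r → 2 + b + 1 + (a + (1 + (c + (2 + r)))) ≡ 2 + (a + (2 + b) + c + (2 + r))
        sum₃ = solve 4 (λ a b c r → con 2 :+ b :+ con 1 :+ (a :+ (con 1 :+ (c :+ (con 2 :+ r)))) :=
                                    con 2 :+ (a :+ (con 2 :+ b) :+ c :+ (con 2 :+ r))) refl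

    closed-7? : ClosedIn 7 ⊎ (∀ v → Q v → ¬ Walk G 7 v v)
    closed-7? = search (λ v → v)
      where
      search : ∀ {m} (f : Fin m → V) → ClosedIn 7 ⊎ (∀ i → Q (f i) → ¬ Walk G 7 (f i) (f i))
      search {zero}  f = inj₂ λ ()
      search {suc m} f with decide (connected G v₀ (f zero)) | closed-walk? 7 (f zero) (f zero) | search (f ∘ suc)
      ... | _      | _      | inj₁ found = inj₁ found
      ... | inj₁ q | inj₁ p | inj₂ _     = inj₁ (f zero , q , p)
      ... | inj₂ q | _      | inj₂ none  = inj₂ λ { zero q′ _ → neg-elim q q′ ; (suc i) → none i }
      ... | _      | inj₂ p | inj₂ none  = inj₂ λ { zero _ → p ; (suc i) → none i }

    module Nine (none₇ : ∀ v → Q v → ¬ Walk G 7 v v) where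

      open Rotation G next₉

      rotation-to : ∀ j → ∃[ k ] rotate k 0F ≡ j
      rotation-to 0F = 0 , refl
      rotation-to 1F = 1 , refl
      rotation-to 2F = 2 , refl
      rotation-to 3F = 3 , refl
      rotation-to 4F = 4 , refl
      rotation-to 5F = 5 , refl
      rotation-to 6F = 6 , refl
      rotation-to 7F = 7 , refl
      rotation-to 8F = 8 , refl

      module _ {c : Fin 9 → V} (ring : Ring c) (q : ∀ i → Q (c i)) {v w : V}
               (v0 : G v (c 0F) ≡ true) (wv : G w v ≡ true) (far : ∀ i → G w (c i) ≡ false) where

        private
          qv : Q v
          qv = Connected.connected-step G (q 0F) (reversed Γ v0)

          qw : Q w
          qw = Connected.connected-step G qv (reversed Γ wv)

        open Search Γ Q (2 ∷ 4 ∷ 6 ∷ [])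
          ((λ v _ → none₃ v) ∷ (λ v _ → none₅ v) ∷ none₇ ∷ [])
          (c 0F) (c 0F ∷ c 1F ∷ c 2F ∷ c 3F ∷ c 4F ∷ c 5F ∷ c 6F ∷ c 7F ∷ c 8F ∷ v ∷ w ∷ [])
          (q 0F ∷ q 0F ∷ q 1F ∷ q 2F ∷ q 3F ∷ q 4F ∷ q 5F ∷ q 6F ∷ q 7F ∷ q 8F ∷ qv ∷ qw ∷ [])

        private
          edges : All Edge ((0 , 1) ∷ (1 , 2) ∷ (2 , 3) ∷ (3 , 4) ∷ (4 , 5) ∷ (5 , 6) ∷ (6 , 7) ∷
                            (7 , 8) ∷ (8 , 0) ∷ (9 , 0) ∷ (10 , 9) ∷ [])
          edges = ring 0F ∷ ring 1F ∷ ring 2F ∷ ring 3F ∷ ring 4F ∷ ring 5F ∷ ring 6F ∷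
                  ring 7F ∷ ring 8F ∷ v0 ∷ wv ∷ []

          nonEdges : All NonEdge ((10 , 0) ∷ (10 , 1) ∷ (10 , 2) ∷ (10 , 3) ∷ (10 , 4) ∷ (10 , 5) ∷
                                  (10 , 6) ∷ (10 , 7) ∷ (10 , 8) ∷ [])
          nonEdges = far 0F ∷ far 1F ∷ far 2F ∷ far 3F ∷ far 4F ∷ far 5F ∷ far 6F ∷ far 7F ∷ far 8F ∷ []

        not-2 : ¬ G v (c 2F) ≡ true
        not-2 v2 = nine-path (_∷_ {x = 9 , 2} v2 edges) nonEdges free₉
          (10 ∷ 9 ∷ 2 ∷ 3 ∷ 4 ∷ 5 ∷ 6 ∷ 7 ∷ 8 ∷ []) refl

        not-neither : G v (c 2F) ≡ false → ¬ G v (c 7F) ≡ false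
        not-neither v2 v7 = nine-path edges (_∷_ {x = 9 , 2} v2 (_∷_ {x = 9 , 7} v7 [])) free₉
          (9 ∷ 0 ∷ 1 ∷ 2 ∷ 3 ∷ 4 ∷ 5 ∷ 6 ∷ 7 ∷ []) refl

      -- With closed walks of length 3, 5 and 7 excluded, `v` attached at 0 can otherwise be
      -- attached only at 2 or 7. Attached at 0 alone, it gives the induced P₉ on `v` and 0 to 7;
      -- attached at 0 and 2, that on `w`, `v` and 2 to 8. Hence nothing in the component is at
      -- distance two from the ring, and the ring dominates the component.
      not-far : ∀ {c} → Ring c → (∀ i → Q (c i)) → ∀ {v w} → ∃[ i ] G v (c i) ≡ true →
                G w v ≡ true → ¬ (∀ i → G w (c i) ≡ false)
      not-far {c} ring q {v} (i , e) wv far with k , refl ← rotation-to i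
        with G v (c (rotate k 2F)) in e₂ | G v (c (rotate k 7F)) in e₇
      ... | true  | _     = not-2 (rotate-ring ring k) (λ _ → q _) e wv (λ _ → far _) e₂
      ... | false | false = not-neither (rotate-ring ring k) (λ _ → q _) e wv (λ _ → far _) e₂ e₇
      -- Seen from 7, the place 0 is at distance two in the direction of the ring, since 7 + 2 = 9.
      ... | false | true  = not-2 (rotate-ring ring (7 + k)) (λ _ → q _)
        (subst (λ i → G v (c i) ≡ true) (at-7 k 0F) e₇) wv (λ _ → far _)
        (subst (λ i → G v (c i) ≡ true) (back k) e)
        where
        at-7 : ∀ k i → rotate k (rotate 7 i) ≡ rotate (7 + k) i
        at-7 zero    i = refl
        at-7 (suc k) i = cong next₉ (at-7 k i)
        back : ∀ k → rotate k 0F ≡ rotate (7 + k) 2F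
        back k = at-7 k 2F

-- Far vertices without far neighbours

-- The relation is like inclusion of neighbourhoods, in which different elements may be equivalent;
-- minimal means that whatever lies below also lies above.
minimal : ∀ {A : Set} {m} (f : Fin m → A) (P : A → Bool) (_≲_ : A → A → Bool) →
  (∀ {x y z} → x ≲ y ≡ true → y ≲ z ≡ true → x ≲ z ≡ true) →
  (∀ i → ¬ P (f i) ≡ true) ⊎
  ∃[ i ] P (f i) ≡ true × (∀ j → P (f j) ≡ true → f j ≲ f i ≡ true → f i ≲ f j ≡ true)
minimal {m = zero}  f P _≲_ ≲-trans = inj₁ λ ()
minimal {m = suc m} f P _≲_ ≲-trans
  with decide (P (f zero)) | minimal (f ∘ suc) P _≲_ ≲-trans
... | inj₂ p | inj₁ none = inj₁ λ { zero → neg-elim p ; (suc i) → none i }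
... | inj₂ p | inj₂ (i , q , least) = inj₂ (suc i , q , λ where
  zero    r _ → ⊥-elim (neg-elim p r)
  (suc j) r s → least j r s)
... | inj₁ p | inj₁ none = inj₂ (zero , p , λ where
  zero    _ s → s
  (suc j) r _ → ⊥-elim (none j r))
... | inj₁ p | inj₂ (i , q , least) with decide (f zero ≲ f (suc i))
... | inj₂ s = inj₂ (suc i , q , λ where
  zero    _ t → ⊥-elim (neg-elim s t)
  (suc j) r t → least j r t)
... | inj₁ s = inj₂ (zero , p , λ where
  zero    _ t → t
  (suc j) r t → ≲-trans s (least j r (≲-trans t s)))

third-colour : ∀ (a b : Fin 3) → a ≢ b → ∃[ c ] ∀ d → d ≡ c ⊎ d ≡ a ⊎ d ≡ b
third-colour 0F 0F p = ⊥-elim (p refl)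
third-colour 1F 1F p = ⊥-elim (p refl)
third-colour 2F 2F p = ⊥-elim (p refl)
third-colour 0F 1F _ = 2F , λ { 0F → inj₂ (inj₁ refl) ; 1F → inj₂ (inj₂ refl) ; 2F → inj₁ refl }
third-colour 1F 0F _ = 2F , λ { 1F → inj₂ (inj₁ refl) ; 0F → inj₂ (inj₂ refl) ; 2F → inj₁ refl }
third-colour 0F 2F _ = 1F , λ { 0F → inj₂ (inj₁ refl) ; 2F → inj₂ (inj₂ refl) ; 1F → inj₁ refl }
third-colour 2F 0F _ = 1F , λ { 2F → inj₂ (inj₁ refl) ; 0F → inj₂ (inj₂ refl) ; 1F → inj₁ refl }
third-colour 1F 2F _ = 0F , λ { 1F → inj₂ (inj₁ refl) ; 2F → inj₂ (inj₂ refl) ; 0F → inj₁ refl }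
third-colour 2F 1F _ = 0F , λ { 2F → inj₂ (inj₁ refl) ; 1F → inj₂ (inj₂ refl) ; 0F → inj₁ refl }

module _ {n : ℕ} (G : Adjacency n) (F : Lists n) where

  Full : Fin n → Set
  Full w = ∀ a → refined G (available G F) w a ≡ true

  Excluded : Fin n → Fin 3 → Set
  Excluded v a = ∃[ x ] G v x ≡ true × F x a ≡ true

  excluded-unavailable : ∀ {v a} → Excluded v a → ¬ available G F v a ≡ true
  excluded-unavailable {v} {a} (x , e , f) p = neg-elim p (any-intro x (and-intro e f))

  full-excludes-none : ∀ {w a} → Full w → ¬ Excluded w a
  full-excludes-none {w} {a} full ex =
    excluded-unavailable ex (proj₁ (and-elim {available G F w a} (full a)))

  -- Two different colours excluded at `u` would force the third one there, and the refinement would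
  -- have removed it from the list of `w`.
  full-neighbour : ∀ {w u a b} → Full w → G w u ≡ true → Excluded u a → Excluded u b → a ≡ b
  full-neighbour {w} {u} {a} {b} full e ea eb with a ≟ᶠ b
  ... | yes p = p
  ... | no p with c , only ← third-colour a b p =
    ⊥-elim (neg-elim (proj₂ (and-elim {available G F w c} (full c)))
      (any-intro u (and-intro e (all-intro forces))))
    where
    forces : ∀ d → d == c or neg (available G F u d) ≡ true
    forces d with only d
    ... | inj₁ q           = or-introˡ (==-intro q)
    ... | inj₂ (inj₁ refl) = or-introʳ {a = d == c} (neg-intro (excluded-unavailable ea))
    ... | inj₂ (inj₂ refl) = or-introʳ {a = d == c} (neg-intro (excluded-unavailable eb))

module _ {n : ℕ} (Γ : Graph n)
  (free₉ : ¬ ContainsInduced Γ (path 9))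
  (none₃ : ∀ v → ¬ Walk (adj Γ) 3 v v)
  (none₅ : ∀ v → ¬ Walk (adj Γ) 5 v v)
  (γ : Fin n → Fin 3) (γ-colouring : IsColouring Γ γ)
  (N : Fin n → Bool) (c d : Fin n)
  (near-c : ∀ {v} → adj Γ v c ≡ true → N v ≡ true)
  (near-d : ∀ {v} → adj Γ v d ≡ true → N v ≡ true)
  (c≢d : γ c ≢ γ d) where

  private
    G = adj Γ
    V = Fin n

    c-side d-side : V → V → Bool
    c-side w v = G w v and G v c and neg (G v d)
    d-side w u = G w u and G u d and neg (G u c)

  record Between (w : V) : Set where
    field
      outside   : ¬ N w ≡ true
      solitary  : ∀ {u} → G w u ≡ true → N u ≡ true
      c-witness : ∃[ v ] c-side w v ≡ true
      d-witness : ∃[ u ] d-side w u ≡ true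

  open Between

  private
    between : V → Bool
    between w = neg (N w) and (all λ u → G w u implies N u) and any (c-side w) and any (d-side w)

    between-intro : ∀ {w} → Between w → between w ≡ true
    between-intro {w} b = and-intro (neg-intro (outside b)) (and-intro
      (all-intro λ u → implies-intro {G w u} (solitary b))
      (and-intro (any-intro {p = c-side w} _ (proj₂ (c-witness b)))
                 (any-intro {p = d-side w} _ (proj₂ (d-witness b)))))

    between-elim : ∀ {w} → between w ≡ true → Between w
    between-elim {w} p with p₁ , p ← and-elim {neg (N w)} p
      with p₂ , p ← and-elim {all λ u → G w u implies N u} p
      with p₃ , p₄ ← and-elim {any (c-side w)} p = record
      { outside   = neg-elim p₁
      ; solitary  = λ {u} e → implies-elim (all-elim p₂ u) e
      ; c-witness = any-elim p₃
      ; d-witness = any-elim p₄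
      }

    c-side-elim : ∀ w v → c-side w v ≡ true → G w v ≡ true × G v c ≡ true × ¬ G v d ≡ true
    c-side-elim w v p with p₁ , p ← and-elim {G w v} p with p₂ , p₃ ← and-elim {G v c} p =
      p₁ , p₂ , neg-elim p₃

    d-side-elim : ∀ w u → d-side w u ≡ true → G w u ≡ true × G u d ≡ true × ¬ G u c ≡ true
    d-side-elim w v p with p₁ , p ← and-elim {G w v} p with p₂ , p₃ ← and-elim {G v d} p =
      p₁ , p₂ , neg-elim p₃

    c-side-move : ∀ {w w′ v} → c-side w v ≡ true → G w′ v ≡ true → c-side w′ v ≡ true
    c-side-move {w} {w′} {v} p e = and-intro e (proj₂ (and-elim {G w v} p))

    coloured-c : V → Bool
    coloured-c w = between w and γ w == γ c

  Knows : Lists n → (Fin 6 → V) → Set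
  Knows F e = F c (γ c) ≡ true × F d (γ d) ≡ true × (∀ k → F (e k) (γ (e k)) ≡ true)

  -- Once the vertices e k are coloured, every w between c and d whose list is
  -- still full must avoid the colour of c.
  Determines : (Fin 6 → V) → Set
  Determines e = ∀ F → Knows F e → ∀ w → Between w → Full G F w → γ w ≢ γ c

  private
    _⊑_ : V → V → Bool
    w ⊑ w′ = all λ v → c-side w v implies G w′ v

    ⊑-trans : ∀ {x y z} → x ⊑ y ≡ true → y ⊑ z ≡ true → x ⊑ z ≡ true
    ⊑-trans {x} {y} {z} p q = all-intro λ v → implies-intro {c-side x v} λ r →
      implies-elim (all-elim q v) (c-side-move {x} {y} {v} r (implies-elim (all-elim p v) r))

    -- If some w between c and d has the colour of c, take such a w₂ with as few
    -- neighbours on the side of c as possible, and then w₃ among the remaining ones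
    -- with as few neighbours on that side outside N(w₂) as possible.  A further
    -- w of this colour would close the path w v c v₃ w₃ u₃ d u₂ w₂.
    module Second (w₂ : V) (w₂-coloured : coloured-c w₂ ≡ true)
      (w₂-minimal : ∀ w → coloured-c w ≡ true → w ⊑ w₂ ≡ true → w₂ ⊑ w ≡ true) where

      b₂ : Between w₂
      b₂ = between-elim (proj₁ (and-elim {between w₂} w₂-coloured))

      γ₂ : γ w₂ ≡ γ c
      γ₂ = ==-elim (proj₂ (and-elim {between w₂} w₂-coloured))

      v₂ u₂ : V
      v₂ = proj₁ (c-witness b₂)
      u₂ = proj₁ (d-witness b₂)

      -- By `full-remaining`, this holds for every w between c and d that has the colour of c and a
      -- full list once w₂, v₂, u₂ are coloured. It mentions no lists, so that w₃ can be chosen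
      -- before the guess is complete.
      remaining : V → Bool
      remaining w = coloured-c w and neg (G w v₂) and neg (G w u₂) and
        (all λ u → d-side w u implies neg (G u w₂)) and
        (all λ v → c-side w v implies neg (G v u₂))

      record Remaining (w : V) : Set where
        field
          coloured : coloured-c w ≡ true
          not-v₂   : ¬ G w v₂ ≡ true
          not-u₂   : ¬ G w u₂ ≡ true
          d-free   : ∀ {u} → d-side w u ≡ true → ¬ G u w₂ ≡ true
          c-free   : ∀ {v} → c-side w v ≡ true → ¬ G v u₂ ≡ true

      open Remaining

      remaining-intro : ∀ {w} → Remaining w → remaining w ≡ true
      remaining-intro {w} r = and-intro (coloured r) (and-intro (neg-intro (not-v₂ r))
        (and-intro (neg-intro (not-u₂ r)) (and-intro
          (all-intro λ u → implies-intro {d-side w u} λ p → neg-intro (d-free r p))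
          (all-intro λ u → implies-intro {c-side w u} λ p → neg-intro (c-free r p)))))

      remaining-elim : ∀ {w} → remaining w ≡ true → Remaining w
      remaining-elim {w} p with p₁ , p ← and-elim {coloured-c w} p
        with p₂ , p ← and-elim {neg (G w v₂)} p
        with p₃ , p ← and-elim {neg (G w u₂)} p
        with p₄ , p₅ ← and-elim {all λ u → d-side w u implies neg (G u w₂)} p = record
        { coloured = p₁
        ; not-v₂   = neg-elim p₂
        ; not-u₂   = neg-elim p₃
        ; d-free   = λ {u} q → neg-elim (implies-elim (all-elim p₄ u) q)
        ; c-free   = λ {u} q → neg-elim (implies-elim (all-elim p₅ u) q)
        }

      u₂≢c : γ u₂ ≢ γ c
      u₂≢c p = γ-colouring w₂ u₂ (proj₁ (d-side-elim w₂ u₂ (proj₂ (d-witness b₂)))) (trans γ₂ (sym p))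

      full-remaining : ∀ F → F c (γ c) ≡ true → F d (γ d) ≡ true → F w₂ (γ w₂) ≡ true →
        F v₂ (γ v₂) ≡ true → F u₂ (γ u₂) ≡ true →
        ∀ w → Between w → Full G F w → γ w ≡ γ c → Remaining w
      full-remaining F fc fd fw₂ fv₂ fu₂ w b full e = record
        { coloured = and-intro (between-intro b) (==-intro e)
        ; not-v₂   = λ p → full-excludes-none G F full (v₂ , p , fv₂)
        ; not-u₂   = λ p → full-excludes-none G F full (u₂ , p , fu₂)
        ; d-free   = λ {u} p q → let wu , ud , _ = d-side-elim w u p in
            c≢d (trans (sym γ₂) (full-neighbour G F full wu (w₂ , q , fw₂) (d , ud , fd)))
        ; c-free   = λ {v} p q → let wv , vc , _ = c-side-elim w v p in
            u₂≢c (full-neighbour G F full wv (u₂ , q , fu₂) (c , vc , fc))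
        }

      _⊑₂_ : V → V → Bool
      w ⊑₂ w′ = all λ v → (c-side w v and neg (G v w₂)) implies G w′ v

      ⊑₂-trans : ∀ {x y z} → x ⊑₂ y ≡ true → y ⊑₂ z ≡ true → x ⊑₂ z ≡ true
      ⊑₂-trans {x} {y} {z} p q = all-intro λ v → implies-intro {c-side x v and neg (G v w₂)} λ r →
        implies-elim (all-elim q v)
          (and-intro (c-side-move {x} {y} {v} (proj₁ (and-elim {c-side x v} r))
                       (implies-elim (all-elim p v) r))
                     (proj₂ (and-elim {c-side x v} r)))

      module Third (w₃ : V) (w₃-remaining : remaining w₃ ≡ true)
        (w₃-minimal : ∀ w → remaining w ≡ true → w ⊑₂ w₃ ≡ true → w₃ ⊑₂ w ≡ true) where

        r₃ : Remaining w₃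
        r₃ = remaining-elim w₃-remaining

        b₃ : Between w₃
        b₃ = between-elim (proj₁ (and-elim {between w₃} (coloured r₃)))

        γ₃ : γ w₃ ≡ γ c
        γ₃ = ==-elim (proj₂ (and-elim {between w₃} (coloured r₃)))

        u₃ : V
        u₃ = proj₁ (d-witness b₃)

        stray : V → Bool
        stray v = c-side w₃ v and neg (G v w₂)

        -- If N(w₂) contained all neighbours of w₃ on the side of c, minimality of w₂ would give the
        -- converse inclusion, and v₂ would be adjacent to w₃.
        escape : ∃[ v ] stray v ≡ true
        escape with decide (any stray)
        ... | inj₁ p = any-elim {p = stray} p
        ... | inj₂ p = ⊥-elim (not-v₂ r₃ (implies-elim
          (all-elim (w₂-minimal w₃ (coloured r₃) (all-intro below)) v₂)
          (proj₂ (c-witness b₂))))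
          where
          below : ∀ v → c-side w₃ v implies G w₂ v ≡ true
          below v = implies-intro {c-side w₃ v} λ q → inside q (decide (G v w₂))
            where
            inside : c-side w₃ v ≡ true → G v w₂ ≡ true ⊎ neg (G v w₂) ≡ true → G w₂ v ≡ true
            inside q (inj₁ r) = reversed Γ r
            inside q (inj₂ r) = ⊥-elim (neg-elim p (any-intro v (and-intro q r)))

        v₃ : V
        v₃ = proj₁ (escape)

        side₃ : c-side w₃ v₃ ≡ true
        side₃ = proj₁ (and-elim {c-side w₃ v₃} (proj₂ (escape)))

        v₃w₂ : ¬ G v₃ w₂ ≡ true
        v₃w₂ = neg-elim (proj₂ (and-elim {c-side w₃ v₃} (proj₂ (escape))))

        -- If w has no suitable v outside both N(w₂) and N(w₃), it lies below w₃, so by minimality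
        -- it is adjacent to v₃. But v₃ is coloured and would shorten the list of w. Otherwise v
        -- completes the induced P₉.
        determined : ∀ F → F c (γ c) ≡ true → F d (γ d) ≡ true → F w₂ (γ w₂) ≡ true →
          F v₂ (γ v₂) ≡ true → F u₂ (γ u₂) ≡ true →
          F v₃ (γ v₃) ≡ true → F u₃ (γ u₃) ≡ true →
          ∀ w → Between w → Full G F w → γ w ≢ γ c
        determined F fc fd fw₂ fv₂ fu₂ fv₃ fu₃ w b full e =
          contradict (decide (any λ v → c-side w v and neg (G v w₂) and neg (G v w₃)))
          where
          r : Remaining w
          r = full-remaining F fc fd fw₂ fv₂ fu₂ w b full e

          wv₃ : ¬ G w v₃ ≡ true
          wv₃ p = full-excludes-none G F full (v₃ , p , fv₃)

          u₃≢c : γ u₃ ≢ γ c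
          u₃≢c p = γ-colouring w₃ u₃ (proj₁ (d-side-elim w₃ u₃ (proj₂ (d-witness b₃)))) (trans γ₃ (sym p))

          contradict : (any λ v → c-side w v and neg (G v w₂) and neg (G v w₃)) ≡ true ⊎
                       neg (any λ v → c-side w v and neg (G v w₂) and neg (G v w₃)) ≡ true → ⊥
          contradict (inj₂ p) = wv₃ (implies-elim
            (all-elim (w₃-minimal w (remaining-intro r) (all-intro below)) v₃)
            (proj₂ (escape)))
            where
            below : ∀ v → (c-side w v and neg (G v w₂)) implies G w₃ v ≡ true
            below v = implies-intro {c-side w v and neg (G v w₂)} λ q → inside q (decide (G v w₃))
              where
              inside : c-side w v and neg (G v w₂) ≡ true → G v w₃ ≡ true ⊎ neg (G v w₃) ≡ true →
                       G w₃ v ≡ true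
              inside q (inj₁ s) = reversed Γ s
              inside q (inj₂ s) = ⊥-elim (neg-elim p (any-intro v
                (and-intro (proj₁ (and-elim {c-side w v} q))
                  (and-intro (proj₂ (and-elim {c-side w v} q)) s))))
          contradict (inj₁ p) with v , p ← any-elim p
            with side , p ← and-elim {c-side w v} p
            with vw₂ , vw₃ ← and-elim {neg (G v w₂)} p
            with wv , vc , vd ← c-side-elim w v side
               | w₃v₃ , v₃c , v₃d ← c-side-elim w₃ v₃ side₃
               | w₃u₃ , u₃d , u₃c ← d-side-elim w₃ u₃ (proj₂ (d-witness b₃))
               | w₂u₂ , u₂d , u₂c ← d-side-elim w₂ u₂ (proj₂ (d-witness b₂)) =
            nine-path edges nonEdges free₉ (0 ∷ 1 ∷ 2 ∷ 3 ∷ 4 ∷ 5 ∷ 6 ∷ 7 ∷ 8 ∷ []) refl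
            where
            open Search Γ (λ _ → ⊤) (2 ∷ 4 ∷ []) ((λ v _ → none₃ v) ∷ (λ v _ → none₅ v) ∷ [])
              c (w ∷ v ∷ c ∷ v₃ ∷ w₃ ∷ u₃ ∷ d ∷ u₂ ∷ w₂ ∷ []) (All.universal (λ _ → tt) _)

            edges : All Edge ((0 , 1) ∷ (1 , 2) ∷ (2 , 3) ∷ (3 , 4) ∷ (4 , 5) ∷ (5 , 6) ∷
                              (6 , 7) ∷ (7 , 8) ∷ [])
            edges = wv ∷ vc ∷ reversed Γ v₃c ∷ reversed Γ w₃v₃ ∷ w₃u₃ ∷ u₃d ∷ reversed Γ u₂d ∷
                    reversed Γ w₂u₂ ∷ []

            apart-c : ∀ {x} → Between x → G x c ≡ false
            apart-c b = ¬-not λ p → outside b (near-c p)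

            apart-d : ∀ {x} → Between x → G x d ≡ false
            apart-d b = ¬-not λ p → outside b (near-d p)

            separate : ∀ {x y} → Between x → Between y → G x y ≡ false
            separate b b′ = ¬-not λ p → outside b′ (solitary b p)

            -- Four pairs are left to the search: v and v₃, v₃ and u₃, u₃ and u₂ have a common
            -- neighbour on the path, while c and d are joined by the walk c v₃ w₃ u₃ d of length
            -- four.
            nonEdges : All NonEdge
              ((0 , 2) ∷ (0 , 3) ∷ (0 , 4) ∷ (0 , 5) ∷ (0 , 6) ∷ (0 , 7) ∷ (0 , 8) ∷
               (1 , 4) ∷ (1 , 5) ∷ (1 , 6) ∷ (1 , 7) ∷ (1 , 8) ∷
               (4 , 2) ∷ (5 , 2) ∷ (7 , 2) ∷ (8 , 2) ∷
               (3 , 6) ∷ (3 , 7) ∷ (3 , 8) ∷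
               (4 , 6) ∷ (4 , 7) ∷ (4 , 8) ∷ (5 , 8) ∷ (8 , 6) ∷ [])
            nonEdges =
              apart-c b ∷ ¬-not wv₃ ∷ separate b b₃ ∷
              ¬-not (λ p → full-excludes-none G F full (u₃ , p , fu₃)) ∷
              apart-d b ∷ ¬-not (not-u₂ r) ∷ separate b b₂ ∷
              ¬-not (neg-elim vw₃) ∷
              ¬-not (λ p → u₃≢c (full-neighbour G F full wv (u₃ , p , fu₃) (c , vc , fc))) ∷
              ¬-not vd ∷ ¬-not (c-free r side) ∷ ¬-not (neg-elim vw₂) ∷
              apart-c b₃ ∷ ¬-not u₃c ∷ ¬-not u₂c ∷ apart-c b₂ ∷
              ¬-not v₃d ∷ ¬-not (c-free r₃ side₃) ∷ ¬-not v₃w₂ ∷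
              apart-d b₃ ∷ ¬-not (not-u₂ r₃) ∷ separate b₃ b₂ ∷
              ¬-not (d-free r₃ (proj₂ (d-witness b₃))) ∷ apart-d b₂ ∷ []

  -- The six places hold w₂, v₂, u₂, v₃, u₃ and a repetition; shorter choices are padded by
  -- repetition, and if no w between c and d has the colour of c, any vertices do.
  determining : ∃[ e ] Determines e
  determining with minimal (λ v → v) coloured-c _⊑_ ⊑-trans
  ... | inj₁ none = (λ _ → c) , λ F _ w b _ e → none w (and-intro (between-intro b) (==-intro e))
  ... | inj₂ (w₂ , p₂ , least₂)
    with minimal (λ v → v) (Second.remaining w₂ p₂ least₂) (Second._⊑₂_ w₂ p₂ least₂)
           (Second.⊑₂-trans w₂ p₂ least₂)
  ... | inj₁ none = lookup (w₂ ∷ v₂ ∷ u₂ ∷ w₂ ∷ v₂ ∷ u₂ ∷ []) , λ F (fc , fd , f) w b full e →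
        none w (remaining-intro (full-remaining F fc fd (f 0F) (f 1F) (f 2F) w b full e))
    where open Second w₂ p₂ least₂
  ... | inj₂ (w₃ , p₃ , least₃) = lookup (w₂ ∷ v₂ ∷ u₂ ∷ v₃ ∷ u₃ ∷ u₃ ∷ []) ,
        λ F (fc , fd , f) → determined F fc fd (f 0F) (f 1F) (f 2F) (f 3F) (f 4F)
    where
    open Second w₂ p₂ least₂
    open Third w₃ p₃ least₃

-- A correct guess colours its component

guessed-base : ∀ {n m k} (C : Base n m) (X : Extra n m k) i →
               guessed C X (proj₁ (C i)) (proj₂ (C i)) ≡ true
guessed-base C X i = or-introˡ (any-intro {p = λ j → is (C j) (proj₁ (C i)) (proj₂ (C i))} i
  (and-intro (==-intro {i = proj₁ (C i)} refl) (==-intro {i = proj₂ (C i)} refl)))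

guessed-extra : ∀ {n m k} (C : Base n m) (X : Extra n m k) i j l →
                guessed C X (proj₁ (X i j l)) (proj₂ (X i j l)) ≡ true
guessed-extra C X i j l =
  or-introʳ {a = any λ i′ → is (C i′) v d}
    (any-intro {p = λ i′ → any λ j′ → any λ l′ → is (X i′ j′ l′) v d} i
      (any-intro {p = λ j′ → any λ l′ → is (X i j′ l′) v d} j
        (any-intro {p = λ l′ → is (X i j l′) v d} l
          (and-intro (==-intro {i = v} refl) (==-intro {i = d} refl)))))
  where
  v = proj₁ (X i j l)
  d = proj₂ (X i j l)

guessed-colour : ∀ {n m k} (C : Base n m) (X : Extra n m k) (γ : Fin n → Fin 3) →
  (∀ i → proj₂ (C i) ≡ γ (proj₁ (C i))) →
  (∀ i j l → proj₂ (X i j l) ≡ γ (proj₁ (X i j l))) →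
  ∀ v a → guessed C X v a ≡ true → a ≡ γ v
guessed-colour C X γ coloured coloured′ v a p with or-elim {any λ i → is (C i) v a} p
... | inj₁ q with i , r ← any-elim {p = λ i → is (C i) v a} q =
  read (C i) (coloured i) r
  where
  read : ∀ p → proj₂ p ≡ γ (proj₁ p) → is p v a ≡ true → a ≡ γ v
  read (x , b) e r with s , t ← and-elim {x == v} r
    with refl ← ==-elim {i = x} s | refl ← ==-elim {i = b} t = e
... | inj₂ q with i , q ← any-elim {p = λ i → any λ j → any λ l → is (X i j l) v a} q
  with j , q ← any-elim {p = λ j → any λ l → is (X i j l) v a} q
  with l , r ← any-elim {p = λ l → is (X i j l) v a} q =
  read (X i j l) (coloured′ i j l) r
  where
  read : ∀ p → proj₂ p ≡ γ (proj₁ p) → is p v a ≡ true → a ≡ γ v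
  read (x , b) e r with s , t ← and-elim {x == v} r
    with refl ← ==-elim {i = x} s | refl ← ==-elim {i = b} t = e

-- Two loops in lockstep: the picks at the two ends of a far edge have to be compared pass by pass.
fold₂-keeps : ∀ {n} {S T : Set} (P : S → T → Set) {f : Fin n → S → S} {g : Fin n → T → T} {s t} →
  (∀ i s t → P s t → P (f i s) (g i t)) → P s t → P (fold n f s) (fold n g t)
fold₂-keeps {zero}  P step p = p
fold₂-keeps {suc n} P step p = step zero _ _ (fold₂-keeps P (step ∘ suc) p)

fold₂-visits : ∀ {n} {S T : Set} (P : S → T → Set) {f : Fin n → S → S} {g : Fin n → T → T} {s t} i →
  (∀ s t → P (f i s) (g i t)) → (∀ j s t → P s t → P (f j s) (g j t)) →
  P (fold n f s) (fold n g t)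
fold₂-visits P zero    reach keep = reach _ _
fold₂-visits P (suc i) reach keep = keep zero _ _ (fold₂-visits P i reach (keep ∘ suc))

-- A list that lacks a colour has at most two, its least and its greatest.
extremes-cover : ∀ {n} (L : Lists n) v a b → L v a ≡ true → ¬ L v b ≡ true →
                 a ≡ extremes L v 0F ⊎ a ≡ extremes L v 1F
extremes-cover L v a b p q with L v 0F in e₀ | L v 1F in e₁ | L v 2F in e₂
extremes-cover L v 0F b p q | true | _ | _ = inj₁ refl
extremes-cover L v 1F b p q | false | true | _ = inj₁ refl
extremes-cover L v 2F b p q | _ | _ | true = inj₂ refl
extremes-cover L v 1F b p q | _ | true | false = inj₂ refl
extremes-cover L v 1F 0F p q | true | true | true = ⊥-elim (q e₀)
extremes-cover L v 1F 1F p q | true | true | true = ⊥-elim (q e₁)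
extremes-cover L v 1F 2F p q | true | true | true = ⊥-elim (q e₂)
extremes-cover L v 0F b p q | false | _ | _ with () ← trans (sym p) e₀
extremes-cover L v 1F b p q | true | false | _ with () ← trans (sym p) e₁
extremes-cover L v 1F b p q | false | false | _ with () ← trans (sym p) e₁
extremes-cover L v 2F b p q | true | _ | false with () ← trans (sym p) e₂
extremes-cover L v 2F b p q | false | true | false with () ← trans (sym p) e₂
extremes-cover L v 2F b p q | false | false | false with () ← trans (sym p) e₂

least-allowed : ∀ {n} (L : Lists n) v → any (L v) ≡ true → L v (extremes L v 0F) ≡ true
least-allowed L v p with L v 0F in e₀ | L v 1F in e₁
... | true  | _    = e₀
... | false | true = e₁
... | false | false with or-elim {L v 2F} p
... | inj₁ q = q

true-or-false : ∀ b → b ≡ true ⊎ b ≡ false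
true-or-false true  = inj₁ refl
true-or-false false = inj₂ refl

choose-true : ∀ {b} {x y : Bool} → b ≡ true → (ifᵇ b then x else y) ≡ x
choose-true refl = refl

choose-false : ∀ {b} {x y : Bool} → b ≡ false → (ifᵇ b then x else y) ≡ y
choose-false refl = refl

differs-from-one : ∀ {n} {a b : Fin n} c → a ≢ b → c ≢ a ⊎ c ≢ b
differs-from-one {a = a} c a≢b with c ≟ᶠ a
... | no c≢a   = inj₁ c≢a
... | yes refl = inj₂ a≢b

extremes-cong : ∀ {n} (L L′ : Lists n) v s → (∀ a → L v a ≡ L′ v a) →
                extremes L v s ≡ extremes L′ v s
extremes-cong L L′ v s same rewrite same 0F | same 1F | same 2F = refl

other-colour : ∀ (a : Fin 3) → ∃[ b ] a ≢ b
other-colour 0F = 1F , λ ()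
other-colour 1F = 0F , λ ()
other-colour 2F = 0F , λ ()

all-counterexample : ∀ {n} (p : Fin n → Bool) → all p ≡ false → ∃[ i ] ¬ p i ≡ true
all-counterexample {suc n} p e with p zero in e₀
... | false = zero , λ q → true≢false (trans (sym q) e₀)
... | true with i , q ← all-counterexample (p ∘ suc) e = suc i , q

module _ {n m : ℕ} (Γ : Graph n)
  (free₉ : ¬ ContainsInduced Γ (path 9))
  (none₃ : ∀ v → ¬ Walk (adj Γ) 3 v v)
  (none₅ : ∀ v → ¬ Walk (adj Γ) 5 v v)
  (γ : Fin n → Fin 3) (γ-colouring : IsColouring Γ γ)
  (C : Base n m)
  (C-coloured : ∀ i → proj₂ (C i) ≡ γ (proj₁ (C i))) where

  private
    G = adj Γ
    N = near G C
    V = Fin n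

    c : Fin m → V
    c i = proj₁ (C i)

    near-base : ∀ i {v} → G v (c i) ≡ true → N v ≡ true
    near-base i e = any-intro i e

  DeterminesPair : Fin m → Fin m → (Fin 6 → V) → Set
  DeterminesPair i j e = ∀ (p : γ (c i) ≢ γ (c j)) →
    Determines Γ free₉ none₃ none₅ γ γ-colouring N (c i) (c j) (near-base i) (near-base j) p e

  extra : ∀ i j → ∃[ e ] DeterminesPair i j e
  extra i j with γ (c i) ≟ᶠ γ (c j)
  ... | yes p = (λ _ → c i) , λ q → ⊥-elim (q p)
  ... | no p with e , det ← determining Γ free₉ none₃ none₅ γ γ-colouring N (c i) (c j)
                              (near-base i) (near-base j) p = e , λ _ → det

  -- All that the colouring of far edges requires of C. It is vacuous if C dominates the component,
  -- and for a C₇ it comes from `folds` and `mates`.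
  record Structured (v₀ : V) : Set where
    field
      exists    : ∀ {x y} → connected G v₀ x ≡ true → G x y ≡ true →
                  ¬ N x ≡ true → ¬ N y ≡ true → ∃[ i ] ∃[ j ] valid G N C x i j ≡ true
      swap      : ∀ {x y i j} → connected G v₀ x ≡ true → G x y ≡ true →
                  ¬ N x ≡ true → ¬ N y ≡ true →
                  valid G N C x i j ≡ true → valid G N C y j i ≡ true
      exclusive : ∀ {x y i j} → connected G v₀ x ≡ true → G x y ≡ true →
                  ¬ N x ≡ true → ¬ N y ≡ true →
                  valid G N C x i j ≡ true → ¬ valid G N C x j i ≡ true

  module _ {v₀ : V} (structured : Structured v₀) (X : Extra n m 6)
    (X-coloured : ∀ i j l → proj₂ (X i j l) ≡ γ (proj₁ (X i j l)))
    (X-determines : ∀ i j → DeterminesPair i j (λ l → proj₁ (X i j l))) where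

    open Structured structured
    open Connected G

    private
      Q : V → Set
      Q v = connected G v₀ v ≡ true

      F L₁ L₂ L : Lists n
      F  = guessed C X
      L₁ = available G F
      L₂ = refined G L₁
      L  = lists G C N L₁ L₂

      F-colour : ∀ {v a} → F v a ≡ true → a ≡ γ v
      F-colour = guessed-colour C X γ C-coloured X-coloured _ _

      F-base : ∀ i → F (c i) (γ (c i)) ≡ true
      F-base i = subst (λ a → F (c i) a ≡ true) (C-coloured i) (guessed-base C X i)

      F-extra : ∀ i j l → F (proj₁ (X i j l)) (γ (proj₁ (X i j l))) ≡ true
      F-extra i j l = subst (λ a → F (proj₁ (X i j l)) a ≡ true) (X-coloured i j l) (guessed-extra C X i j l)

      available-γ : ∀ v → L₁ v (γ v) ≡ true
      available-γ v = neg-intro λ p → let u , q = any-elim {p = λ u → G v u and F u (γ v)} p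
                                          e , f = and-elim {G v u} q in
        γ-colouring v u e (F-colour f)

      refined-γ : ∀ v → L₂ v (γ v) ≡ true
      refined-γ v = and-intro (available-γ v) (neg-intro refute)
        where
        refute : ¬ any (λ u → G v u and forced L₁ u (γ v)) ≡ true
        refute p with u , q ← any-elim {p = λ u → G v u and forced L₁ u (γ v)} p
          with e , f ← and-elim {G v u} q
          with or-elim {γ u == γ v} (all-elim {p = λ b → b == γ v or neg (L₁ u b)} f (γ u))
        ... | inj₁ r = γ-colouring v u e (sym (==-elim {i = γ u} r))
        ... | inj₂ r = neg-elim r (available-γ u)

      near-limited : ∀ {v} → N v ≡ true → ∃[ a ] ¬ L₂ v a ≡ true
      near-limited {v} p with i , e ← any-elim {p = λ i → G v (c i)} p =
        γ (c i) , λ q → excluded-unavailable G F (c i , e , F-base i)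
                          (proj₁ (and-elim {L₁ v (γ (c i))} q))

      Linked : V → V → Set
      Linked x y = G x y ≡ true × ¬ N x ≡ true × ¬ N y ≡ true

      linked-intro : ∀ {x y} → Linked x y → linked G N x ≡ true
      linked-intro {x} {y} (e , p , q) = and-intro (neg-intro p)
        (any-intro {p = λ u → G x u and neg (N u)} y (and-intro e (neg-intro q)))

      linked-elim : ∀ {x} → linked G N x ≡ true → ∃[ y ] Linked x y
      linked-elim {x} p with q , r ← and-elim {neg (N x)} p
        with y , s ← any-elim {p = λ u → G x u and neg (N u)} r
        with e , t ← and-elim {G x y} s = y , e , neg-elim q , neg-elim t

      valid-elim : ∀ {x i j} → valid G N C x i j ≡ true → G (c i) (c j) ≡ true ×
        (∀ {v} → G x v ≡ true → N v ≡ true → G v (c i) ≡ true)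
      valid-elim {x} {i} {j} p with q , r ← and-elim {G (c i) (c j)} p =
        q , λ {v} e f → implies-elim (all-elim {p = λ v → (G x v and N v) implies G v (c i)}
              (proj₁ (and-elim {covered G N x (c i)} r)) v) (and-intro e f)

      Picked : V → Fin 3 → Fin 3 → Set
      Picked x a b = ∃[ i ] ∃[ j ] valid G N C x i j ≡ true × a ≡ γ (c i) × b ≡ γ (c j)

      -- The tests at y are those at x with `i` and `j` swapped. The pass of a valid pair sets both
      -- colours to those of its edge, and every later pass either does so for another valid pair or
      -- changes neither.
      picks : ∀ {x y} → Q x → Linked x y → Picked x (pick G N C x) (pick G N C y)
      picks {x} {y} q (e , p , r) with i , j , w ← exists q e p r =
        fold₂-visits (Picked x) {f = outer x} {g = outer y} {s = 0F} {t = 0F} i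
          (λ a b → fold₂-visits (Picked x) {f = inner x i} {g = inner y i} {s = a} {t = b} j
            (λ a b → reach i j a b w) (λ j → keep i j))
          (λ i a b → fold₂-keeps (Picked x) {f = inner x i} {g = inner y i} {s = a} {t = b}
            (λ j → keep i j))
        where
        inner : V → Fin m → Fin m → Fin 3 → Fin 3
        inner x i j r =
          ifᵇ valid G N C x i j then proj₂ (C i)
          else ifᵇ valid G N C x j i then proj₂ (C j)
          else r

        outer : V → Fin m → Fin 3 → Fin 3
        outer x i r = fold m (inner x i) r

        e′ : G y x ≡ true
        e′ = reversed Γ e

        qy : Q y
        qy = connected-step q e

        across : ∀ i j → valid G N C x i j ≡ valid G N C y j i
        across i j with valid G N C x i j in s | valid G N C y j i in t
        ... | true  | _     = trans (sym (swap q e p r s)) t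
        ... | false | false = refl
        ... | false | true  = trans (sym s) (swap qy e′ r p t)

        reach : ∀ i j a b → valid G N C x i j ≡ true → Picked x (inner x i j a) (inner y i j b)
        reach i j a b w
          rewrite sym (across j i) | sym (across i j) | w
          with valid G N C x j i in s
        ... | true  = ⊥-elim (exclusive q e p r w s)
        -- At y only the swapped pair is valid, so the second test succeeds there and yields the
        -- colour of `C j`.
        ... | false = i , j , w , C-coloured i , C-coloured j

        keep : ∀ i j a b → Picked x a b → Picked x (inner x i j a) (inner y i j b)
        keep i j a b P with decide (valid G N C x i j)
        ... | inj₁ w = reach i j a b w
        ... | inj₂ w = skipped (¬-not (neg-elim w))
          where
          skipped : valid G N C x i j ≡ false → Picked x (inner x i j a) (inner y i j b)
          skipped w rewrite sym (across j i) | sym (across i j) | w with valid G N C x j i in s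
          ... | true  = j , i , s , C-coloured j , C-coloured i
          ... | false = P

      -- The colouring that witnesses success. It departs from γ on far edges, which take the
      -- colours of an edge of C, and at `free` vertices, which take a colour available at none of
      -- their neighbours.
      data Choice (v : V) : Fin 3 → Set where
        inner   : ∀ {y} → Linked v y → linked G N v ≡ true → Choice v (pick G N C v)
        free    : linked G N v ≡ false → all (L₂ v) ≡ true → any (safe G L₁ v) ≡ true →
                  Choice v (extremes (safe G L₁) v 0F)
        rigid   : linked G N v ≡ false → all (L₂ v) ≡ true → any (safe G L₁ v) ≡ false →
                  Choice v (γ v)
        limited : linked G N v ≡ false → all (L₂ v) ≡ false → Choice v (γ v)

      choice : ∀ v → ∃[ a ] Choice v a
      choice v with true-or-false (linked G N v)
      ... | inj₁ l with y , k ← linked-elim l = _ , inner k l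
      ... | inj₂ l with true-or-false (all (L₂ v))
      ... | inj₂ f = _ , limited l f
      ... | inj₁ f with true-or-false (any (safe G L₁ v))
      ... | inj₁ s = _ , free l f s
      ... | inj₂ s = _ , rigid l f s

      full-outside : ∀ {v} → all (L₂ v) ≡ true → ¬ N v ≡ true
      full-outside {v} f p with a , q ← near-limited p = q (all-elim {p = L₂ v} f a)

      full-full : ∀ {v} → all (L₂ v) ≡ true → Full G F v
      full-full {v} f = all-elim {p = L₂ v} f

      solitary-neighbour : ∀ {v u} → linked G N v ≡ false → ¬ N v ≡ true → G v u ≡ true → N u ≡ true
      solitary-neighbour {v} {u} l p e with decide (N u)
      ... | inj₁ q = q
      ... | inj₂ q with () ← trans (sym l) (linked-intro (e , p , neg-elim q))

      pick-γ : ∀ {v y u} → Q v → Linked v y → G v u ≡ true → N u ≡ true → pick G N C v ≢ γ u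
      pick-γ {v} {u = u} q l e p same with i , j , w , a , _ ← picks q l =
        γ-colouring u (c i) (proj₂ (valid-elim {v} {i} {j} w) e p) (trans (sym same) a)

      safe-γ : ∀ {v u} → any (safe G L₁ v) ≡ true → G v u ≡ true →
               extremes (safe G L₁) v 0F ≢ γ u
      safe-γ {v} {u} s e same =
        neg-elim (implies-elim (all-elim {p = λ u → G v u implies neg (L₁ u (extremes (safe G L₁) v 0F))}
                    (least-allowed (safe G L₁) v s) u) e)
          (subst (λ a → L₁ u a ≡ true) (sym same) (available-γ u))

      unlinked-near : ∀ {v y u} → Linked v y → linked G N u ≡ false → G v u ≡ true → N u ≡ true
      unlinked-near {u = u} (_ , p , _) l e with decide (N u)
      ... | inj₁ q = q
      ... | inj₂ q with () ← trans (sym l) (linked-intro (reversed Γ e , neg-elim q , p))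

      -- A vertex near C never has a full list, and unlinked neighbours of a far vertex are near C.
      -- So two recoloured vertices are adjacent only if they form a far edge, which `picks`
      -- settles; all other conflicts are between a recoloured vertex and one coloured by γ, or
      -- between two of the latter.
      proper : ∀ {v u a b} → Q v → G v u ≡ true → Choice v a → Choice u b → a ≢ b
      proper {v} {u} q e (inner l@(_ , p , _) _) (inner (_ , p′ , _) _) same
        with i , j , w , a , b ← picks q (e , p , p′) =
        γ-colouring (c i) (c j) (proj₁ (valid-elim {v} {i} {j} w)) (trans (sym a) (trans same b))
      proper q e (inner l _) (free l′ f _)  _ = full-outside f (unlinked-near l l′ e)
      proper q e (inner l _) (rigid l′ f _) _ = full-outside f (unlinked-near l l′ e)
      proper q e (inner l _) (limited l′ _)   = pick-γ q l e (unlinked-near l l′ e)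
      proper q e (free l′ f _) (inner l _)  _ = full-outside f (unlinked-near l l′ (reversed Γ e))
      proper q e (free l f _) (free _ f′ _) _ =
        full-outside f′ (solitary-neighbour l (full-outside f) e)
      proper q e (free l f _) (rigid _ f′ _) _ =
        full-outside f′ (solitary-neighbour l (full-outside f) e)
      proper q e (free _ _ s) (limited _ _) = safe-γ s e
      proper q e (rigid l′ f _) (inner l _) _ = full-outside f (unlinked-near l l′ (reversed Γ e))
      proper q e (rigid l f _) (free _ f′ _) _ =
        full-outside f′ (solitary-neighbour l (full-outside f) e)
      proper q e (rigid _ _ _) (rigid _ _ _) = γ-colouring _ _ e
      proper q e (rigid _ _ _) (limited _ _) = γ-colouring _ _ e
      proper q e (limited l′ _) (inner l _) same =
        pick-γ (connected-step q e) l (reversed Γ e) (unlinked-near l l′ (reversed Γ e)) (sym same)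
      proper q e (limited _ _) (free _ _ s) same = safe-γ s (reversed Γ e) (sym same)
      proper q e (limited _ _) (rigid _ _ _)   = γ-colouring _ _ e
      proper q e (limited _ _) (limited _ _)   = γ-colouring _ _ e

      Touches : V → Fin m → Set
      Touches v i = ∃[ u ] G v u ≡ true × G u (c i) ≡ true

      -- The neighbours that touch `c i` and `c j` lie strictly on their sides: one adjacent to both
      -- would see two colours, against `full-neighbour`. So `v` is between them, and the six extra
      -- vertices of the pair apply.
      full-avoids : ∀ {v} → linked G N v ≡ false → all (L₂ v) ≡ true → ∀ {i j} →
        Touches v i → Touches v j → γ (c i) ≢ γ (c j) → γ v ≢ γ (c i)
      full-avoids {v} l f {i} {j} (u , vu , ui) (u′ , vu′ , u′j) i≢j =
        X-determines i j i≢j F (F-base i , F-base j , F-extra i j) v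
          (record
            { outside   = full-outside f
            ; solitary  = solitary-neighbour l (full-outside f)
            ; c-witness = u , and-intro vu (and-intro ui (neg-intro λ uj →
                i≢j (full-neighbour G F (full-full f) vu (c i , ui , F-base i) (c j , uj , F-base j))))
            ; d-witness = u′ , and-intro vu′ (and-intro u′j (neg-intro λ u′i →
                i≢j (full-neighbour G F (full-full f) vu′ (c i , u′i , F-base i) (c j , u′j , F-base j))))
            })
          (full-full f)

      unsafe : ∀ {v} → any (safe G L₁ v) ≡ false → ∀ a → ∃[ u ] G v u ≡ true × L₁ u a ≡ true
      unsafe {v} s a with decide (any λ u → G v u and L₁ u a)
      ... | inj₁ p with u , q ← any-elim {p = λ u → G v u and L₁ u a} p = u , and-elim q
      ... | inj₂ p with () ← trans (sym s) (any-intro {p = safe G L₁ v} a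
              (all-intro λ u → implies-intro {G v u} λ e → neg-intro λ f →
                neg-elim p (any-intro {p = λ u → G v u and L₁ u a} u (and-intro e f))))

      two-colours-touched : ∀ {v} → linked G N v ≡ false → all (L₂ v) ≡ true →
        any (safe G L₁ v) ≡ false →
        ∃[ i ] ∃[ j ] Touches v i × Touches v j × γ (c i) ≢ γ (c j)
      -- The colour 0 is arbitrary; it only supplies some neighbour.
      two-colours-touched {v} l f s with u , vu , _ ← unsafe s 0F
        with i , ui ← any-elim {p = λ i → G u (c i)} (solitary-neighbour l (full-outside f) vu)
        with u′ , vu′ , a ← unsafe s (γ (c i))
        with j , u′j ← any-elim {p = λ i → G u′ (c i)} (solitary-neighbour l (full-outside f) vu′) =
        i , j , (u , vu , ui) , (u′ , vu′ , u′j) , λ same →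
          excluded-unavailable G F (c j , u′j , F-base j) (subst (λ a → L₁ u′ a ≡ true) same a)

      -- Every touched vertex `c k` differs in colour from one of two differently coloured touched
      -- vertices, and `full-avoids` applies to that pair.
      avoids-touched : ∀ {v} → linked G N v ≡ false → all (L₂ v) ≡ true →
        any (safe G L₁ v) ≡ false → ∀ {k} → Touches v k → γ v ≢ γ (c k)
      avoids-touched l f s {k} tk =
        let i , j , ti , tj , i≢j = two-colours-touched l f s
        in either (full-avoids l f tk ti) (full-avoids l f tk tj)
             (differs-from-one (γ (c k)) i≢j)

      third-touches : ∀ {v a} → ¬ third G C v a ≡ true → ∃[ k ] Touches v k × proj₂ (C k) ≡ a
      third-touches {v} {a} p = fromAny (decide (any spoils))
        where
        spoils : V → Bool
        spoils u = G v u and any λ i → G u (c i) and proj₂ (C i) == a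

        fromSpoiler : ∀ {u} → spoils u ≡ true → ∃[ k ] Touches v k × proj₂ (C k) ≡ a
        fromSpoiler {u} q =
          let vu , q₁ = and-elim {G v u} q
              k , q₂ = any-elim {p = λ i → G u (c i) and proj₂ (C i) == a} q₁
              uk , same = and-elim {G u (c k)} q₂
          in k , (u , vu , uk) , ==-elim {i = proj₂ (C k)} same

        fromAny : any spoils ≡ true ⊎ neg (any spoils) ≡ true →
                  ∃[ k ] Touches v k × proj₂ (C k) ≡ a
        fromAny (inj₁ q) = fromSpoiler (proj₂ (any-elim {p = spoils} q))
        fromAny (inj₂ q) = ⊥-elim (p q)

      third-γ : ∀ {v} → linked G N v ≡ false → all (L₂ v) ≡ true → any (safe G L₁ v) ≡ false →
                third G C v (γ v) ≡ true
      third-γ {v} l f s = fromDecision (decide (third G C v (γ v)))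
        where
        fromDecision : third G C v (γ v) ≡ true ⊎ neg (third G C v (γ v)) ≡ true →
                       third G C v (γ v) ≡ true
        fromDecision (inj₁ p) = p
        fromDecision (inj₂ p) =
          let k , tk , same = third-touches (neg-elim p)
          in ⊥-elim (avoids-touched l f s tk (trans (sym same) (C-coloured k)))

      third-excludes : ∀ {v i} → Touches v i → ¬ third G C v (γ (c i)) ≡ true
      third-excludes {v} {i} (u , vu , ui) p = neg-elim p
        (any-intro {p = λ u → G v u and any λ j → G u (c j) and proj₂ (C j) == γ (c i)} u
          (and-intro vu (any-intro {p = λ j → G u (c j) and proj₂ (C j) == γ (c i)} i
            (and-intro ui (==-intro (C-coloured i))))))

      inner-list : ∀ {v} → linked G N v ≡ true → ∀ a → L v a ≡ pick G N C v == a
      inner-list l a = choose-true l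

      free-list : ∀ {v} → linked G N v ≡ false → all (L₂ v) ≡ true → any (safe G L₁ v) ≡ true →
                  ∀ a → L v a ≡ safe G L₁ v a
      free-list l f s a = trans (choose-false l) (trans (choose-true f) (choose-true s))

      rigid-list : ∀ {v} → linked G N v ≡ false → all (L₂ v) ≡ true → any (safe G L₁ v) ≡ false →
                   ∀ a → L v a ≡ third G C v a
      rigid-list l f s a = trans (choose-false l) (trans (choose-true f) (choose-false s))

      limited-list : ∀ {v} → linked G N v ≡ false → all (L₂ v) ≡ false → ∀ a → L v a ≡ L₂ v a
      limited-list l f a = trans (choose-false l) (choose-false f)

      covers : ∀ {v a b} → L v a ≡ true → ¬ L v b ≡ true →
               a ≡ extremes L v 0F ⊎ a ≡ extremes L v 1F
      covers {v} {a} {b} = extremes-cover L v a b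

      candidate : ∀ {v a} → Choice v a → a ≡ extremes L v 0F ⊎ a ≡ extremes L v 1F
      candidate {v} (inner _ l) =
        let b , a≢b = other-colour (pick G N C v) in
        covers (trans (inner-list l _) (==-intro {i = pick G N C v} refl))
          (λ p → a≢b (==-elim {i = pick G N C v} (trans (sym (inner-list l b)) p)))
      candidate {v} (free l f s) =
        inj₁ (extremes-cong (safe G L₁) L v 0F λ a → sym (free-list l f s a))
      candidate {v} (rigid l f s) =
        let i , j , ti , _ = two-colours-touched l f s in
        covers (trans (rigid-list l f s (γ v)) (third-γ l f s))
          (λ p → third-excludes ti (trans (sym (rigid-list l f s (γ (c i)))) p))
      candidate {v} (limited l f) =
        let b , r = all-counterexample (L₂ v) f in
        covers (trans (limited-list l f (γ v)) (refined-γ v))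
          (λ p → r (trans (sym (limited-list l f b)) p))

    opaque
      unfolding candidates

      component-assigned : assigned G (solution Γ (candidates G C X)) v₀ ≡ true
      component-assigned =
        all-assigned Γ (candidates G C X) v₀ (λ v → proj₁ (choice v))
          (λ {v} _ → candidate (proj₂ (choice v)))
          (λ {v} {u} q e → proper q e (proj₂ (choice v)) (proj₂ (choice u)))

module _ {n m : ℕ} (Γ : Graph n)
  (free₉ : ¬ ContainsInduced Γ (path 9))
  (none₃ : ∀ v → ¬ Walk (adj Γ) 3 v v)
  (none₅ : ∀ v → ¬ Walk (adj Γ) 5 v v)
  (γ : Fin n → Fin 3) (γ-colouring : IsColouring Γ γ)
  (C : Base n m)
  (C-coloured : ∀ i → proj₂ (C i) ≡ γ (proj₁ (C i))) where

  private
    G = adj Γ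
    N = near G C
    V = Fin n

    Struct = Structured Γ free₉ none₃ none₅ γ γ-colouring C C-coloured

  dominated-structured : ∀ {v₀} → (∀ {v} → connected G v₀ v ≡ true → N v ≡ true) → Struct v₀
  dominated-structured dominated = record
    { exists    = λ q _ p → ⊥-elim (p (dominated q))
    ; swap      = λ q _ p → ⊥-elim (p (dominated q))
    ; exclusive = λ q _ p → ⊥-elim (p (dominated q))
    }

  -- The base has `m` places for seven vertices: `r` tells which vertex of the cycle a place holds,
  -- and the section `s` finds a place for each vertex.
  module _ {v₀ : V} (c : Fin 7 → V) (r : Fin m → Fin 7) (s : Fin 7 → Fin m)
    (r-s : ∀ i → r (s i) ≡ i) (positions : ∀ i → proj₁ (C i) ≡ c (r i))
    (c-inside : connected G v₀ (c 0F) ≡ true) where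

    open SevenCycle Γ free₉ none₃ none₅
    open Connected G

    module _ (ring : Ring c) where

      private
        at-s : ∀ i → proj₁ (C (s i)) ≡ c i
        at-s i = trans (positions (s i)) (cong c (r-s i))

        near-cycle : ∀ {v} → N v ≡ true → Near c v
        near-cycle {v} p with i , e ← any-elim {p = λ i → G v (proj₁ (C i))} p =
          r i , subst (λ u → G v u ≡ true) (positions i) e

        cycle-near : ∀ {v} i → G v (c i) ≡ true → N v ≡ true
        cycle-near {v} i e = any-intro {p = λ i → G v (proj₁ (C i))} (s i)
          (subst (λ u → G v u ≡ true) (sym (at-s i)) e)

        far : ∀ {v} → ¬ N v ≡ true → Far c v
        far p i = ¬-not (λ e → p (cycle-near i e))

        Attached : V → Set
        Attached x = ∃[ v ] G x v ≡ true × N v ≡ true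

        -- Distance at most three from the cycle. Going further is impossible in the component: on a
        -- path of three far vertices `mates` hands the attachments of the first to the third.
        Reached : V → Set
        Reached x = N x ≡ true ⊎ Attached x ⊎ ∃[ y ] G x y ≡ true × ¬ N y ≡ true × Attached y

        shared : ∀ {x y z v} → G x y ≡ true → G y z ≡ true →
                 ¬ N x ≡ true → ¬ N y ≡ true → ¬ N z ≡ true →
                 G x v ≡ true → N v ≡ true → G z v ≡ true
        shared xy yz p q r xv near =
          mates ring xv (reversed Γ xy) (reversed Γ yz) (far p) (far q) (far r) (near-cycle near)

        reach : ∀ {x} → connected G (c 0F) x ≡ true → Reached x
        reach = connected-induction Reached (inj₁ (cycle-near 1F (ring 0F))) step
          where
          step : ∀ {u w} → connected G (c 0F) u ≡ true → Reached u → G u w ≡ true → Reached w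
          step {u} {w} _ reached e with decide (N w) | decide (N u) | reached
          ... | inj₁ p | _      | _ = inj₁ p
          ... | inj₂ _ | inj₁ q | _ = inj₂ (inj₁ (u , reversed Γ e , q))
          ... | inj₂ _ | inj₂ q | inj₁ q′ = ⊥-elim (neg-elim q q′)
          ... | inj₂ _ | inj₂ q | inj₂ (inj₁ a) = inj₂ (inj₂ (u , reversed Γ e , neg-elim q , a))
          ... | inj₂ p | inj₂ q | inj₂ (inj₂ (y , uy , p′ , v , yv , near)) =
            inj₂ (inj₁ (v , shared (reversed Γ uy) e p′ (neg-elim q) (neg-elim p) yv near , near))

        reached : ∀ {x} → connected G v₀ x ≡ true → Reached x
        reached q = reach (connected-trans (connected-sym Γ c-inside) q)

        valid-intro : ∀ {x i j} → G (proj₁ (C i)) (proj₁ (C j)) ≡ true →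
          (∀ {v} → G x v ≡ true → N v ≡ true → G v (proj₁ (C i)) ≡ true) →
          (∀ {y v} → G x y ≡ true → ¬ N y ≡ true → G y v ≡ true → N v ≡ true →
            G v (proj₁ (C j)) ≡ true) →
          valid G N C x i j ≡ true
        valid-intro {x} {i} {j} e f g = and-intro e (and-intro
          (all-intro {p = λ v → (G x v and N v) implies G v (proj₁ (C i))} λ v →
            implies-intro {G x v and N v} λ p → let p₁ , p₂ = and-elim {G x v} p in f p₁ p₂)
          (all-intro {p = λ y → (G x y and neg (N y)) implies covered G N y (proj₁ (C j))} λ y →
            implies-intro {G x y and neg (N y)} λ p → let p₁ , p₂ = and-elim {G x y} p in
              all-intro {p = λ v → (G y v and N v) implies G v (proj₁ (C j))} λ v →
                implies-intro {G y v and N v} λ q → let q₁ , q₂ = and-elim {G y v} q in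
                  g p₁ (neg-elim p₂) q₁ q₂))

        valid-parts : ∀ {x i j} → valid G N C x i j ≡ true →
          G (proj₁ (C i)) (proj₁ (C j)) ≡ true ×
          (∀ {v} → G x v ≡ true → N v ≡ true → G v (proj₁ (C i)) ≡ true) ×
          (∀ {y v} → G x y ≡ true → ¬ N y ≡ true → G y v ≡ true → N v ≡ true →
            G v (proj₁ (C j)) ≡ true)
        valid-parts {x} {i} {j} w
          with e , w ← and-elim {G (proj₁ (C i)) (proj₁ (C j))} w
          with f , g ← and-elim {covered G N x (proj₁ (C i))} w =
          e ,
          (λ {v} p q → implies-elim
            (all-elim {p = λ v → (G x v and N v) implies G v (proj₁ (C i))} f v) (and-intro p q)) ,
          (λ {y} {v} p q p′ q′ → implies-elim
            (all-elim {p = λ v → (G y v and N v) implies G v (proj₁ (C j))}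
              (implies-elim
                (all-elim {p = λ y → (G x y and neg (N y)) implies covered G N y (proj₁ (C j))} g y)
                (and-intro p (neg-intro q))) v) (and-intro p′ q′))

        no-triangle : ∀ {v u w} → G v u ≡ true → G v w ≡ true → ¬ G u w ≡ true
        no-triangle vu vw uw = none₃ _ (vu ∷ uw ∷ reversed Γ vw ∷ [])

        moved : ∀ {v i} → G v (c i) ≡ true → G v (proj₁ (C (s i))) ≡ true
        moved {v} {i} = subst (λ u → G v u ≡ true) (sym (at-s i))

      -- A valid pair for x comes from folding an edge, and `shared` extends the condition to all
      -- far neighbours. If both orders were valid, some vertex near the cycle would be adjacent to
      -- both ends of an edge of the cycle, a triangle.
      cycle-structured : Struct v₀
      cycle-structured = record { exists = exists ; swap = swap ; exclusive = exclusive }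
        where
        exists : ∀ {x y} → connected G v₀ x ≡ true → G x y ≡ true →
                 ¬ N x ≡ true → ¬ N y ≡ true → ∃[ i ] ∃[ j ] valid G N C x i j ≡ true
        exists {x} {y} q e p p′ with reached q
        ... | inj₁ near = ⊥-elim (p near)
        ... | inj₂ (inj₁ (v , xv , near))
          with i , j , ij , fx , fy ← folds ring xv (near-cycle near) (reversed Γ e) (far p) (far p′) =
          s i , s j , valid-intro
            (subst₂ (λ a b → G a b ≡ true) (sym (at-s i)) (sym (at-s j)) ij)
            (λ xu near → moved (fx xu (near-cycle near)))
            (λ xy′ p″ y′u near →
              moved (fy (shared (reversed Γ xy′) e p″ p p′ y′u near) (near-cycle near)))
        -- The attachment is known at another far neighbour of x, with which y shares it, so the
        -- edge is folded from the side of y.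
        ... | inj₂ (inj₂ (y′ , xy′ , p″ , v , y′v , near))
          with i , j , ij , fy , fx ← folds ring (shared (reversed Γ xy′) e p″ p p′ y′v near)
                 (near-cycle near) e (far p′) (far p) =
          s j , s i , valid-intro
            (subst₂ (λ a b → G a b ≡ true) (sym (at-s j)) (sym (at-s i)) (reversed Γ ij))
            (λ xu near → moved (fx xu (near-cycle near)))
            (λ xy′ p″ y′u near →
              moved (fy (shared (reversed Γ xy′) e p″ p p′ y′u near) (near-cycle near)))

        swap : ∀ {x y i j} → connected G v₀ x ≡ true → G x y ≡ true →
               ¬ N x ≡ true → ¬ N y ≡ true →
               valid G N C x i j ≡ true → valid G N C y j i ≡ true
        swap {x} {y} {i} {j} q e p p′ w with ij , fx , fy ← valid-parts {x} {i} {j} w =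
          valid-intro {y} {j} {i} (reversed Γ ij) (λ yu near → fy e p′ yu near)
            (λ yx′ p″ x′u near → fx (shared (reversed Γ yx′) (reversed Γ e) p″ p′ p x′u near) near)

        exclusive : ∀ {x y i j} → connected G v₀ x ≡ true → G x y ≡ true →
                    ¬ N x ≡ true → ¬ N y ≡ true →
                    valid G N C x i j ≡ true → ¬ valid G N C x j i ≡ true
        exclusive {x} {y} {i} {j} q e p p′ w w′
          with ij , fx , fy ← valid-parts {x} {i} {j} w
             | _ , fx′ , fy′ ← valid-parts {x} {j} {i} w′
          with reached q
        ... | inj₁ near = p near
        ... | inj₂ (inj₁ (v , xv , near)) = no-triangle (fx xv near) (fx′ xv near) ij
        ... | inj₂ (inj₂ (z , xz , p″ , v , zv , near)) =
          no-triangle (fy′ xz p″ zv near) (fy xz p″ zv near) ij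

-- The search over all guesses

data Enumerable : Ty → Set where
  ixᵉ  : ∀ s → Enumerable (ix s)
  _⊗ᵉ_ : ∀ {A B} → Enumerable A → Enumerable B → Enumerable (A ⊗ B)
  arrᵉ : ∀ {A} k → Enumerable A → Enumerable (arr (const k) A)

-- Loops run over the values of an array type only up to pointwise equality.
_≈[_]_ : ∀ {A n} → Val A n → Enumerable A → Val A n → Set
x ≈[ ixᵉ s ] y                = x ≡ y
(x , x′) ≈[ e ⊗ᵉ e′ ] (y , y′) = (x ≈[ e ] y) × (x′ ≈[ e′ ] y′)
f ≈[ arrᵉ k e ] g             = ∀ i → f i ≈[ e ] g i

forEach : ∀ {A T S} → Enumerable T → Mor ((A ⊗ T) ⊗ S) S → Mor (A ⊗ S) S
forEach (ixᵉ s) body =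
  loopₘ s sndₘ (body ⊙ ⟨ ⟨ fstₘ ⊙ fstₘ ⊙ fstₘ , sndₘ ⊙ fstₘ ⟩ₘ , sndₘ ⟩ₘ)
forEach (e ⊗ᵉ e′) body =
  forEach e (forEach e′ (body ⊙ ⟨ ⟨ fstₘ ⊙ fstₘ ⊙ fstₘ , ⟨ sndₘ ⊙ fstₘ ⊙ fstₘ , sndₘ ⊙ fstₘ ⟩ₘ ⟩ₘ , sndₘ ⟩ₘ))
forEach (arrᵉ zero e) body = body ⊙ ⟨ ⟨ fstₘ , nilₘ ⟩ₘ , sndₘ ⟩ₘ
forEach (arrᵉ (suc k) e) body =
  forEach e (forEach (arrᵉ k e)
    (body ⊙ ⟨ ⟨ fstₘ ⊙ fstₘ ⊙ fstₘ , consₘ (sndₘ ⊙ fstₘ ⊙ fstₘ) (sndₘ ⊙ fstₘ) ⟩ₘ , sndₘ ⟩ₘ))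

forEach-keeps : ∀ {A T S n} (e : Enumerable T) (body : Mor ((A ⊗ T) ⊗ S) S) {a : Val A n}
  (P : Val S n → Set) → (∀ t {s} → P s → P (⟦ body ⟧ ((a , t) , s))) →
  ∀ {s} → P s → P (⟦ forEach e body ⟧ (a , s))
forEach-keeps (ixᵉ s) body P step p = fold-keeps P (λ i _ → step i) p
forEach-keeps (e ⊗ᵉ e′) body P step p =
  forEach-keeps e _ P (λ t → forEach-keeps e′ _ P λ t′ → step (t , t′)) p
forEach-keeps (arrᵉ zero e) body P step p = step _ p
forEach-keeps (arrᵉ (suc k) e) body P step p =
  forEach-keeps e _ P (λ t → forEach-keeps (arrᵉ k e) _ P λ t′ → step _) p

forEach-visits : ∀ {A T S n} (e : Enumerable T) (body : Mor ((A ⊗ T) ⊗ S) S) {a : Val A n}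
  (P : Val S n → Set) (t₀ : Val T n) →
  (∀ t → t ≈[ e ] t₀ → ∀ s → P (⟦ body ⟧ ((a , t) , s))) →
  (∀ t {s} → P s → P (⟦ body ⟧ ((a , t) , s))) →
  ∀ s → P (⟦ forEach e body ⟧ (a , s))
forEach-visits (ixᵉ s) body P t₀ reach keep _ =
  fold-visits P t₀ (reach t₀ refl) (λ i _ → keep i)
forEach-visits (e ⊗ᵉ e′) body P (t₀ , t₀′) reach keep =
  forEach-visits e _ P t₀
    (λ t p → forEach-visits e′ _ P t₀′ (λ t′ p′ → reach (t , t′) (p , p′)) (λ t′ → keep (t , t′)))
    (λ t → forEach-keeps e′ _ P λ t′ → keep (t , t′))
forEach-visits (arrᵉ zero e) body P t₀ reach keep s = reach _ (λ ()) s
forEach-visits (arrᵉ (suc k) e) body P t₀ reach keep =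
  forEach-visits e _ P (t₀ zero)
    (λ t p → forEach-visits (arrᵉ k e) _ P (t₀ ∘ suc)
      (λ t′ p′ → reach _ λ { zero → p ; (suc i) → p′ i }) (λ t′ → keep _))
    (λ t → forEach-keeps (arrᵉ k e) _ P λ t′ → keep _)

vcᵉ : Enumerable vc
vcᵉ = ixᵉ vertex ⊗ᵉ ixᵉ (const 3)

baseᵉ : ∀ m → Enumerable (baseT m)
baseᵉ m = arrᵉ m vcᵉ

extraᵉ : ∀ m k → Enumerable (extraT m k)
extraᵉ m k = arrᵉ m (arrᵉ m (arrᵉ k vcᵉ))

answerₘ : Mor adjT partT → Mor adjT (bool ⊗ arr vertex colour)
answerₘ f = letₘ f ⟨ allₘ (fstₘ ⊙ (#1 ! #0)) , tabₘ (sndₘ ⊙ (#1 ! #0)) ⟩ₘ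

-- Compiled terms expect the number of vertices in unary in front of the input; it is the number of
-- rows of the adjacency matrix.
countRows : Program
countRows =
  pair skip null ⨾
  (while head repeat pair (head ⨾ tail) (pair null tail)) ⨾
  tail

countRows≲ : ∀ {n} (f : Fin n → Tree) →
             countRows ⟨ encodeList (tabulate f) ⟩⇓ encodeℕ n ≲ suc (3 + suc ((n * 9 + 2) + 1))
countRows≲ {n} f =
  seq≲ (pair≲ skip≲ null≲)
    (seq≲ (count n f 0)
      (subst (λ m → tail ⟨ nil ∙ encodeℕ (n + 0) ⟩⇓ encodeℕ m ≲ 1) (+-identityʳ n) tail≲))
  where
  count : ∀ n (f : Fin n → Tree) a →
    (while head repeat pair (head ⨾ tail) (pair null tail))
      ⟨ encodeList (tabulate f) ∙ encodeℕ a ⟩⇓ nil ∙ encodeℕ (n + a) ≲ n * 9 + 2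
  count zero    f a = stop≲ head≲
  count (suc n) f a =
    loop≲ head≲ (pair≲ (seq≲ head≲ tail≲) (pair≲ null≲ tail≲))
      (subst (λ b → (while head repeat pair (head ⨾ tail) (pair null tail))
                      ⟨ encodeList (tabulate (f ∘ suc)) ∙ encodeℕ (suc a) ⟩⇓ nil ∙ encodeℕ b ≲ n * 9 + 2)
         (+-suc n a) (count n (f ∘ suc) (suc a)))

opaque
  unfolding attempt attemptₘ candidates candidatesₘ

  attempt≡ : ∀ {A n} (a : Val A n) G c g →
             ⟦ attemptₘ {A} G c g ⟧ a ≡ attempt (⟦ G ⟧ a) (⟦ c ⟧ a) (⟦ g ⟧ a)
  attempt≡ a G c g = refl

  candidates≡ : ∀ {A n m k} (a : Val A n) G (C : Mor A (baseT m)) (X : Mor A (extraT m k)) →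
                ⟦ candidatesₘ G C X ⟧ a ≡ candidates (⟦ G ⟧ a) (⟦ C ⟧ a) (⟦ X ⟧ a)
  candidates≡ a G C X = refl

module _ (m k : ℕ) where

  private
    Context : Ty
    Context = ((adjT ⊗ baseT m) ⊗ extraT m k) ⊗ partT

    Gₘ : Mor Context adjT
    Gₘ = fstₘ ⊙ fstₘ ⊙ fstₘ

    Cₘ : Mor Context (baseT m)
    Cₘ = sndₘ ⊙ fstₘ ⊙ fstₘ

    Xₘ : Mor Context (extraT m k)
    Xₘ = sndₘ ⊙ fstₘ

  tryₘ : Mor Context partT
  tryₘ = attemptₘ Gₘ (candidatesₘ Gₘ Cₘ Xₘ) sndₘ

  try≡ : ∀ {n} (G : Adjacency n) (C : Base n m) (X : Extra n m k) (g : Partial n) →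
         ⟦ tryₘ ⟧ (((G , C) , X) , g) ≡ attempt G (candidates G C X) g
  try≡ G C X g = trans (attempt≡ env Gₘ (candidatesₘ Gₘ Cₘ Xₘ) sndₘ)
    (cong (λ c → attempt G c g) (candidates≡ env Gₘ Cₘ Xₘ))
    where
    env : Val Context _
    env = ((G , C) , X) , g

initialₘ : Mor adjT partT
initialₘ = attemptₘ idₘ twoColoursₘ (tabₘ ⟨ litₘ false , numₘ 0F ⟩ₘ)

initial≡ : ∀ {n} (G : Adjacency n) →
           ⟦ initialₘ ⟧ G ≡ attempt G twoColours (λ _ → false , 0F)
initial≡ G = attempt≡ G idₘ twoColoursₘ (tabₘ ⟨ litₘ false , numₘ 0F ⟩ₘ)

opaque
  searchₘ : (m k : ℕ) → Mor (adjT ⊗ partT) partT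
  searchₘ m k = forEach (baseᵉ m) (forEach (extraᵉ m k) (tryₘ m k))

colouringₘ : (m k : ℕ) → Mor adjT partT
colouringₘ m k = searchₘ m k ⊙ ⟨ idₘ , initialₘ ⟩ₘ

module _ {n : ℕ} (G : Adjacency n) (P : Partial n → Set)
         (keep : ∀ c g → P g → P (attempt G c g)) where

  private
    keep-try : ∀ m k (C : Base n m) (X : Extra n m k) {g} → P g →
               P (⟦ tryₘ m k ⟧ (((G , C) , X) , g))
    keep-try m k C X {g} p = subst P (sym (try≡ m k G C X g)) (keep (candidates G C X) g p)

    keep-extras : ∀ m k (C : Base n m) {g} → P g →
                  P (⟦ forEach (extraᵉ m k) (tryₘ m k) ⟧ ((G , C) , g))
    keep-extras m k C {g} =
      forEach-keeps (extraᵉ m k) (tryₘ m k) {a = G , C} P (λ X {g} → keep-try m k C X {g}) {s = g}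

    visit-extras : ∀ m k (C : Base n m) (X₀ : Extra n m k) →
      (∀ X → X ≈[ extraᵉ m k ] X₀ → ∀ g → P (attempt G (candidates G C X) g)) →
      ∀ g → P (⟦ forEach (extraᵉ m k) (tryₘ m k) ⟧ ((G , C) , g))
    visit-extras m k C X₀ reach =
      forEach-visits (extraᵉ m k) (tryₘ m k) {a = G , C} P X₀
        (λ X X≈ g → subst P (sym (try≡ m k G C X g)) (reach X X≈ g))
        (λ X {g} → keep-try m k C X {g})

  opaque
    unfolding searchₘ

    search-keeps : ∀ (m k : ℕ) g → P g → P (⟦ searchₘ m k ⟧ (G , g))
    search-keeps m k g =
      forEach-keeps (baseᵉ m) (forEach (extraᵉ m k) (tryₘ m k)) {a = G} P
        (λ C {g} → keep-extras m k C {g}) {s = g}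

    -- `X₀` may depend on `C`, because the extra vertices are determined for the base that the loop
    -- actually meets, which agrees with `C₀` only pointwise.
    search-visits : ∀ (m k : ℕ) (C₀ : Base n m) →
      (∀ C → C ≈[ baseᵉ m ] C₀ → ∃[ X₀ ] ∀ X → X ≈[ extraᵉ m k ] X₀ →
        ∀ g → P (attempt G (candidates G C X) g)) →
      ∀ g → P (⟦ searchₘ m k ⟧ (G , g))
    search-visits m k C₀ reach =
      forEach-visits (baseᵉ m) (forEach (extraᵉ m k) (tryₘ m k)) {a = G} P C₀
        (λ C C≈ → visit-extras m k C (proj₁ (reach C C≈)) (proj₂ (reach C C≈)))
        (λ C {g} → keep-extras m k C {g})

colouring : ∀ (m k : ℕ) {n} → Graph n → Partial n
colouring m k Γ = ⟦ colouringₘ m k ⟧ (adj Γ)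

colouring-sound : ∀ m k {n} (Γ : Graph n) → Sound Γ (colouring m k Γ)
colouring-sound m k Γ =
  search-keeps (adj Γ) (λ g → Sound Γ g) (λ c g s {v} {u} → attempt-sound Γ c g s {v} {u}) m k
    (⟦ initialₘ ⟧ (adj Γ))
    (subst (λ g → Sound Γ g) (sym (initial≡ (adj Γ)))
      (λ {v} {u} → attempt-sound Γ twoColours (λ _ → false , 0F) (λ ()) {v} {u}))

-- Every component of a 3-colourable graph gets coloured

module _ {n : ℕ} (Γ : Graph n)
  (free₉ : ¬ ContainsInduced Γ (path 9))
  (none₃ : ∀ v → ¬ Walk (adj Γ) 3 v v)
  (none₅ : ∀ v → ¬ Walk (adj Γ) 5 v v)
  (γ : Fin n → Fin 3) (γ-colouring : IsColouring Γ γ) (v₀ : Fin n) where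

  private
    G = adj Γ
    V = Fin n

    Done : Partial n → Set
    Done g = proj₁ (g v₀) ≡ true

    done-keeps : ∀ c g → Done g → Done (attempt G c g)
    done-keeps c g = attempt-keeps-done Γ c g v₀

  search-done : ∀ {m} (b : Fin m → V) →
    (∀ C → (∀ i → proj₁ (C i) ≡ b i) → (C-coloured : ∀ i → proj₂ (C i) ≡ γ (proj₁ (C i))) →
      Structured Γ free₉ none₃ none₅ γ γ-colouring C C-coloured v₀) →
    ∀ g → Done (⟦ searchₘ m 6 ⟧ (G , g))
  search-done {m} b structured = search-visits G Done done-keeps m 6 (λ i → b i , γ (b i)) reach
    where
    reach : ∀ C → C ≈[ baseᵉ m ] (λ i → b i , γ (b i)) → ∃[ X₀ ] ∀ X → X ≈[ extraᵉ m 6 ] X₀ →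
            ∀ g → Done (attempt G (candidates G C X) g)
    reach C C≈ = X₀ , λ X X≈ g → attempt-done Γ (candidates G C X) g v₀
      (component-assigned Γ free₉ none₃ none₅ γ γ-colouring C C-coloured
        (structured C (λ i → proj₁ (C≈ i)) C-coloured) X
        (λ i j l → trans (proj₂ (X≈ i j l)) (cong γ (sym (proj₁ (X≈ i j l)))))
        (λ i j p F (fc , fd , f) → proj₂ (extras i j) p F
          (fc , fd , λ l → subst (λ x → F x (γ x) ≡ true) (proj₁ (X≈ i j l)) (f l))))
      where
      C-coloured : ∀ i → proj₂ (C i) ≡ γ (proj₁ (C i))
      C-coloured i = trans (proj₂ (C≈ i)) (cong γ (sym (proj₁ (C≈ i))))

      extras = extra Γ free₉ none₃ none₅ γ γ-colouring C C-coloured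

      X₀ : Extra n m 6
      X₀ i j l = proj₁ (extras i j) l , γ (proj₁ (extras i j) l)

  private
    ClosedWalk : ℕ → Set
    ClosedWalk k = ClosedIn Γ free₉ none₃ none₅ v₀ k

  search-done-7 : ClosedWalk 7 → ∀ g → Done (⟦ searchₘ 9 6 ⟧ (G , g))
  search-done-7 (v , q , _∷_ {v = a} e₀ (_∷_ {v = b} e₁ (_∷_ {v = c} e₂ (_∷_ {v = d} e₃
                  (_∷_ {v = e} e₄ (_∷_ {v = f} e₅ (_∷_ {v = g} e₆ [])))))))  =
    search-done (ring-vertex ∘ shrink) λ C positions C-coloured →
      cycle-structured Γ free₉ none₃ none₅ γ γ-colouring C C-coloured
        ring-vertex shrink grow shrink-grow positions q ring
    where
    ring-vertex : Fin 7 → V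
    ring-vertex = lookup (a ∷ b ∷ c ∷ d ∷ e ∷ f ∷ g ∷ [])

    ring : ∀ i → G (ring-vertex i) (ring-vertex (next i)) ≡ true
    ring 0F = e₀
    ring 1F = e₁
    ring 2F = e₂
    ring 3F = e₃
    ring 4F = e₄
    ring 5F = e₅
    ring 6F = e₆

    shrink : Fin 9 → Fin 7
    -- The last two of the nine places repeat vertex 0 of the cycle, so that the search for a C₉
    -- also finds a C₇.
    shrink = lookup (0F ∷ 1F ∷ 2F ∷ 3F ∷ 4F ∷ 5F ∷ 6F ∷ 0F ∷ 0F ∷ [])

    grow : Fin 7 → Fin 9
    grow = lookup (0F ∷ 1F ∷ 2F ∷ 3F ∷ 4F ∷ 5F ∷ 6F ∷ [])

    shrink-grow : ∀ i → shrink (grow i) ≡ i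
    shrink-grow 0F = refl
    shrink-grow 1F = refl
    shrink-grow 2F = refl
    shrink-grow 3F = refl
    shrink-grow 4F = refl
    shrink-grow 5F = refl
    shrink-grow 6F = refl

  search-done-9 : (∀ v → connected G v₀ v ≡ true → ¬ Walk G 7 v v) → ClosedWalk 9 →
                  ∀ g → Done (⟦ searchₘ 9 6 ⟧ (G , g))
  search-done-9 none₇ (v , q , _∷_ {v = a} e₀ (_∷_ {v = b} e₁ (_∷_ {v = c} e₂ (_∷_ {v = d} e₃
      (_∷_ {v = e} e₄ (_∷_ {v = f} e₅ (_∷_ {v = g} e₆ (_∷_ {v = h} e₇ (_∷_ {v = i} e₈ []))))))))) =
    search-done ring-vertex λ C positions C-coloured →
      dominated-structured Γ free₉ none₃ none₅ γ γ-colouring C C-coloured (dominated C positions)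
    where
    open Connected G

    ring-vertex : Fin 9 → V
    ring-vertex = lookup (a ∷ b ∷ c ∷ d ∷ e ∷ f ∷ g ∷ h ∷ i ∷ [])

    ring : ∀ i → G (ring-vertex i) (ring-vertex (next₉ i)) ≡ true
    ring 0F = e₀
    ring 1F = e₁
    ring 2F = e₂
    ring 3F = e₃
    ring 4F = e₄
    ring 5F = e₅
    ring 6F = e₆
    ring 7F = e₇
    ring 8F = e₈

    inside : ∀ i → connected G v₀ (ring-vertex i) ≡ true
    inside 0F = q
    inside 1F = connected-step q e₀
    inside 2F = connected-walk Γ q (e₀ ∷ e₁ ∷ [])
    inside 3F = connected-walk Γ q (e₀ ∷ e₁ ∷ e₂ ∷ [])
    inside 4F = connected-walk Γ q (e₀ ∷ e₁ ∷ e₂ ∷ e₃ ∷ [])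
    inside 5F = connected-walk Γ q (e₀ ∷ e₁ ∷ e₂ ∷ e₃ ∷ e₄ ∷ [])
    inside 6F = connected-walk Γ q (e₀ ∷ e₁ ∷ e₂ ∷ e₃ ∷ e₄ ∷ e₅ ∷ [])
    inside 7F = connected-walk Γ q (e₀ ∷ e₁ ∷ e₂ ∷ e₃ ∷ e₄ ∷ e₅ ∷ e₆ ∷ [])
    inside 8F = connected-walk Γ q (e₀ ∷ e₁ ∷ e₂ ∷ e₃ ∷ e₄ ∷ e₅ ∷ e₆ ∷ e₇ ∷ [])

    dominated : ∀ (C : Base n 9) → (∀ i → proj₁ (C i) ≡ ring-vertex i) →
                ∀ {x} → connected G v₀ x ≡ true → near G C x ≡ true
    dominated C positions p =
      connected-induction (λ x → near G C x ≡ true) (to-near 1F e₀) step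
        (connected-trans (connected-sym Γ q) p)
      where
      to-near : ∀ {x} j → G x (ring-vertex j) ≡ true → near G C x ≡ true
      to-near {x} j e = any-intro {p = λ j → G x (proj₁ (C j))} j
        (subst (λ u → G x u ≡ true) (sym (positions j)) e)

      from-near : ∀ {x} → near G C x ≡ true → ∃[ j ] G x (ring-vertex j) ≡ true
      from-near {x} p = let j , e = any-elim {p = λ j → G x (proj₁ (C j))} p in
        j , subst (λ u → G x u ≡ true) (positions j) e

      step : ∀ {u w} → connected G v u ≡ true → near G C u ≡ true → G u w ≡ true →
             near G C w ≡ true
      step {u} {w} _ p e with decide (near G C w)
      ... | inj₁ r = r
      ... | inj₂ r = ⊥-elim (Nine.not-far Γ free₉ none₃ none₅ v₀ none₇ ring inside (from-near p)
              (trans (symmetric Γ w u) e) (λ j → ¬-not λ f → neg-elim r (to-near j f)))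

  private
    start : Partial n
    start = ⟦ initialₘ ⟧ G

  bipartite-done : assigned G (solution Γ twoColours) v₀ ≡ true → Done (⟦ searchₘ 9 6 ⟧ (G , start))
  bipartite-done p = search-keeps G Done done-keeps 9 6 start
    (subst Done (sym (initial≡ G)) (attempt-done Γ twoColours (λ _ → false , 0F) v₀ p))

  odd-walk-done : ∀ k → flips k 0F ≡ 1F → ClosedWalk k → Done (⟦ searchₘ 9 6 ⟧ (G , start))
  odd-walk-done k odd closed = by-length (closed-7? Γ free₉ none₃ none₅ v₀)
    where
    by-length : ClosedWalk 7 ⊎ (∀ v → connected G v₀ v ≡ true → ¬ Walk G 7 v v) →
                Done (⟦ searchₘ 9 6 ⟧ (G , start))
    by-length (inj₁ seven) = search-done-7 seven start
    by-length (inj₂ none₇) =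
      either (λ seven → search-done-7 seven start) (λ nine → search-done-9 none₇ nine start)
        (short-odd-walk Γ free₉ none₃ none₅ v₀ k odd closed)

  colouring-complete : Done (colouring 9 6 Γ)
  colouring-complete =
    either bipartite-done (λ (u , q , k , p , odd) → odd-walk-done k odd (u , q , p))
      (two-colours-or-odd-walk Γ v₀)

-- The program, its running time and its correctness

program : Mor adjT partT → Program
program f =
  pair countRows skip ⨾ compile (answerₘ f) ⨾ (if head then pair null tail else null)

program-time : Mor adjT partT → ℕ → ℕ
program-time f n =
  suc (suc (suc (3 + suc ((n * 9 + 2) + 1)) + 1) + suc (cost (answerₘ f) n + 5))

program-time-poly : ∀ f → PolyBounded (program-time f)
program-time-poly f =
  poly-+ (poly-const 1)
    (poly-+ (poly-+ (poly-const 1) (poly-+ (poly-+ (poly-const 5)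
              (poly-+ (poly-+ (poly-* poly-id (poly-const 9)) (poly-const 2)) (poly-const 1)))
              (poly-const 1)))
      (poly-+ (poly-const 1) (poly-+ (poly-cost (answerₘ f)) (poly-const 5))))

answer : ∀ {n} → Partial n → Answer n
answer g = ifᵇ all (λ v → proj₁ (g v)) then just (λ v → proj₂ (g v)) else nothing

program≲ : ∀ (f : Mor adjT partT) {n} (Γ : Graph n) →
  program f ⟨ encodeGraph Γ ⟩⇓ encodeAnswer (answer (⟦ f ⟧ (adj Γ))) ≲ program-time f n
program≲ f {n} Γ =
  seq≲ (pair≲ (countRows≲ _) skip≲) (seq≲ (compile≲ (answerₘ f) (adj Γ)) output)
  where
  g = ⟦ f ⟧ (adj Γ)
  output : (if head then pair null tail else null)
    ⟨ enc (bool ⊗ arr vertex colour) (all (λ v → proj₁ (g v)) , λ v → proj₂ (g v)) ⟩⇓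
    encodeAnswer (answer g) ≲ 5
  output with all (λ v → proj₁ (g v))
  ... | true  = true≲ head≲ (pair≲ null≲ tail≲)
  ... | false = weaken≲ (s≤s (s≤s (s≤s z≤n))) (false≲ head≲ null≲)

answer-correct : ∀ {n} (Γ : Graph n) →
  ¬ ContainsInduced Γ (path 9) → ¬ ContainsInduced Γ (cycle 3) → ¬ ContainsInduced Γ (cycle 5) →
  Correct Γ (answer (colouring 9 6 Γ))
answer-correct Γ free₉ free₃ free₅ = by-cases (all (λ v → proj₁ (g v))) refl
  where
  g = colouring 9 6 Γ
  by-cases : ∀ b → all (λ v → proj₁ (g v)) ≡ b →
             Correct Γ (ifᵇ b then just (λ v → proj₂ (g v)) else nothing)
  by-cases true  e u v uv = proj₂ (colouring-sound 9 6 Γ (all-elim e u) uv)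
  by-cases false e (γ , γ-colouring) with v₀ , undone ← all-counterexample (λ v → proj₁ (g v)) e =
    undone (colouring-complete Γ free₉ (no-closed-3 Γ free₃) (no-closed-5 Γ free₃ free₅)
              γ γ-colouring v₀)

theorem1p2 : Σ[ p ∈ Program ] Σ[ a ∈ ℕ ] Σ[ k ∈ ℕ ]
    (∀ (n : ℕ) (G : Graph n) →
    ¬ ContainsInduced G (path 9) →
    ¬ ContainsInduced G (cycle 3) →
    ¬ ContainsInduced G (cycle 5) →
    Σ[ r ∈ Answer n ] ∃[ t ]
    (p ⟨ encodeGraph G ⟩⇓ encodeAnswer r [ t ]) ×
    t ≤ a * n ^ k + a ×
    Correct G r)
theorem1p2 =
  program (colouringₘ 9 6) , proj₁ polynomial , proj₁ (proj₂ polynomial) , λ n G free₉ free₃ free₅ →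
    let t , run , fast = program≲ (colouringₘ 9 6) G in
    answer (colouring 9 6 G) , t , run , ≤-trans fast (proj₂ (proj₂ polynomial) n) ,
    answer-correct G free₉ free₃ free₅
  where
  polynomial = poly-standard (program-time-poly (colouringₘ 9 6))
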